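{- Let $C$ be a maximal cap in $AG(4,3)$. There are exactly 36 unordered pairs $\{D,D'\}$ of disjoint demicaps with $C=D\cup D'$, and exactly 36 maximal caps $C'$ such that $\{C,C'\}$ is a 1-completable pair. For such a pair $\{D,D'\}$, let $C'$ be the set of points of $AG(4,3)$ that complete exactly one line with a pair of points of $D$ and exactly one line with a pair of points of $D'$. Then $C'$ is a maximal cap, $\{C,C'\}$ is a 1-completable pair, and the assignment $\{D,D'\}\mapsto C'$ is a bijection between the 36 decompositions of $C$ into two disjoint demicaps and the 36 maximal caps forming a 1-completable pair with $C$.
   Context: $AG(4,3)=\mathbb{F}_3^4$ with lines the triples of distinct points $x,y,z$ with $x+y+z=0$. A cap is a set of points containing no line; a maximal cap is a cap of largest size (20 points in $AG(4,3)$). Every maximal cap $C$ in $AG(4,3)$ has a unique anchor point $a\notin C$ such that $C$ is the union of 10 pairs $\{b,c\}$ with $\{a,b,c\}$ a line. A hyperplane is a 3-dimensional affine subspace. For a point $a$, an $a$-line is a pair $\{b,c\}$ with $\{a,b,c\}$ a line. A demicap with anchor point $a$ is a cap consisting of five $a$-lines such that no four of the corresponding lines through $a$ lie in a common hyperplane. A point $p\notin S$ completes a line with a pair of points of $S$ if $\{p,x,y\}$ is a line for some $x,y\in S$; the number of such lines is the number of such pairs. A partition of $AG(4,3)$ here means a partition into a single point $a$ and four pairwise disjoint maximal caps each having anchor point $a$. Two disjoint maximal caps form a $k$-completable pair if they appear together as blocks in exactly $k$ such partitions. -}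

module Defs where

open import Data.Nat using (ℕ; zero; suc; _+_; _*_; _≤_; _<_; _%_; _/_)
open import Data.Nat.Properties using () renaming (_≟_ to _≟ℕ_)
open import Data.Fin using (Fin; zero; suc; toℕ)
open import Data.Fin.Properties using (all?) renaming (_≟_ to _≟F_)
open import Data.Fin.Subset using (Subset; _∈_; _∉_; _∪_; ∣_∣)
open import Data.Fin.Subset.Properties using (_∈?_)
open import Data.Bool using (Bool; true; false; if_then_else_)
open import Data.List using (List; length; map; allFin)
open import Data.Nat.ListAction using (sum)
open import Data.List.Membership.Propositional using () renaming (_∈_ to _∈L_)
open import Data.List.Relation.Unary.All using (All)
open import Data.List.Relation.Unary.AllPairs using (AllPairs)
open import Data.List.Relation.Unary.Unique.Propositional using (Unique)
open import Data.Vec using (tabulate)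
open import Data.Product using (Σ; ∃; _×_; _,_; uncurry)
open import Data.Sum using (_⊎_)
open import Relation.Nullary using (¬_; Dec; yes; no; _×-dec_; ¬?)
open import Relation.Nullary.Decidable using (⌊_⌋)
open import Relation.Binary.PropositionalEquality using (_≡_; _≢_)

-- The affine space AG(4,3) = F_3^4.
-- Points are encoded as Fin 81: the point p has coordinates the four
-- base-3 digits of toℕ p.  Sets of points are library subsets Subset 81.

Point : Set
Point = Fin 81

PSet : Set
PSet = Subset 81

coord : Point → Fin 4 → ℕ
coord p zero = toℕ p % 3
coord p (suc zero) = (toℕ p / 3) % 3
coord p (suc (suc zero)) = (toℕ p / 9) % 3
coord p (suc (suc (suc zero))) = (toℕ p / 27) % 3

IsLine : Point → Point → Point → Set
IsLine x y z = x ≢ y × x ≢ z × y ≢ z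
             × (∀ i → (coord x i + coord y i + coord z i) % 3 ≡ 0)

isLine? : ∀ x y z → Dec (IsLine x y z)
isLine? x y z =
  ¬? (x ≟F y) ×-dec ¬? (x ≟F z) ×-dec ¬? (y ≟F z)
  ×-dec all? (λ i → ((coord x i + coord y i + coord z i) % 3) ≟ℕ 0)

Cap : PSet → Set
Cap S = ∀ x y z → x ∈ S → y ∈ S → z ∈ S → ¬ IsLine x y z

MaxCap : PSet → Set
MaxCap C = Cap C × (∀ T → Cap T → ∣ T ∣ ≤ ∣ C ∣)

Disjoint : PSet → PSet → Set
Disjoint S T = ∀ x → x ∈ S → x ∉ T

-- a is an anchor point of C: a ∉ C and C is a union of a-lines
-- (pairs {b,c} with {a,b,c} a line)
AnchorOf : Point → PSet → Set
AnchorOf a C = a ∉ C × (∀ b → b ∈ C → ∃ λ c → c ∈ C × IsLine a b c)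

record Hyperplane : Set where
  constructor hyp
  field
    w       : Fin 4 → Fin 3
    k       : Fin 3
    nonzero : ∃ λ i → w i ≢ zero

_∈H_ : Point → Hyperplane → Set
x ∈H hyp w k _ =
  (toℕ (w zero) * coord x zero
   + toℕ (w (suc zero)) * coord x (suc zero)
   + toℕ (w (suc (suc zero))) * coord x (suc (suc zero))
   + toℕ (w (suc (suc (suc zero)))) * coord x (suc (suc (suc zero)))) % 3
  ≡ toℕ k

LineInH : Point → Point → Hyperplane → Set
LineInH a b H = a ∈H H × b ∈H H × (∀ c → IsLine a b c → c ∈H H)

DiffALines : Point → Point → Point → Set
DiffALines a b b' = b ≢ b' × ¬ IsLine a b b'

-- a demicap with anchor point a: a cap consisting of five a-lines
-- (a ∉ D, D is closed under completing a-lines, and has 10 points)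
-- such that no four of the corresponding lines through a lie in a
-- common hyperplane
DemicapWith : Point → PSet → Set
DemicapWith a D =
  Cap D × a ∉ D × ∣ D ∣ ≡ 10
  × (∀ b → b ∈ D → ∃ λ c → c ∈ D × IsLine a b c)
  × ¬ (Σ Hyperplane λ H → Σ (Fin 4 → Point) λ b →
         (∀ i → b i ∈ D) × (∀ i j → i ≢ j → DiffALines a (b i) (b j))
         × (∀ i → LineInH a (b i) H))

Demicap : PSet → Set
Demicap D = ∃ λ a → DemicapWith a D

Partition : Point → PSet → PSet → PSet → PSet → Set
Partition a C₁ C₂ C₃ C₄ =
  MaxCap C₁ × MaxCap C₂ × MaxCap C₃ × MaxCap C₄
  × AnchorOf a C₁ × AnchorOf a C₂ × AnchorOf a C₃ × AnchorOf a C₄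
  × Disjoint C₁ C₂ × Disjoint C₁ C₃ × Disjoint C₁ C₄
  × Disjoint C₂ C₃ × Disjoint C₂ C₄ × Disjoint C₃ C₄
  × (∀ p → p ≡ a ⊎ p ∈ C₁ ⊎ p ∈ C₂ ⊎ p ∈ C₃ ⊎ p ∈ C₄)

SamePair : PSet × PSet → PSet × PSet → Set
SamePair (A , B) (A' , B') = (A ≡ A' × B ≡ B') ⊎ (A ≡ B' × B ≡ A')

-- {C , C'} is a 1-completable pair: C, C' are disjoint maximal caps that
-- appear together as blocks in exactly one partition.  A partition
-- containing the blocks C, C' is determined by its point a and the
-- unordered pair {C₃ , C₄} of remaining blocks.
OneCompletable : PSet → PSet → Set
OneCompletable C C' =
  MaxCap C × MaxCap C' × Disjoint C C'
  × (∃ λ a → ∃ λ C₃ → ∃ λ C₄ → Partition a C C' C₃ C₄)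
  × (∀ a C₃ C₄ b D₃ D₄ → Partition a C C' C₃ C₄ → Partition b C C' D₃ D₄
       → a ≡ b × SamePair (C₃ , C₄) (D₃ , D₄))

count : (Point → Bool) → ℕ
count f = sum (map (λ x → if f x then 1 else 0) (allFin 81))

-- number of ORDERED pairs (x , y) of points of S with {p,x,y} a line;
-- this is twice the number of (unordered) pairs, i.e. of lines p
-- completes with a pair of points of S
orderedCompletions : Point → PSet → ℕ
orderedCompletions p S =
  sum (map (λ x → count (λ y → ⌊ (x ∈? S) ×-dec (y ∈? S) ×-dec isLine? p x y ⌋))
           (allFin 81))

CompletesExactlyOne : Point → PSet → Set
CompletesExactlyOne p S = p ∉ S × orderedCompletions p S ≡ 2

completesExactlyOne? : ∀ p S → Dec (CompletesExactlyOne p S)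
completesExactlyOne? p S = ¬? (p ∈? S) ×-dec (orderedCompletions p S ≟ℕ 2)

completionSet : PSet → PSet → PSet
completionSet D D' =
  tabulate (λ p → ⌊ completesExactlyOne? p D ×-dec completesExactlyOne? p D' ⌋)

Decomposition : PSet → PSet → PSet → Set
Decomposition C D D' = Demicap D × Demicap D' × Disjoint D D' × C ≡ D ∪ D'

ExactlyN : ℕ → (PSet → Set) → Set
ExactlyN n P = Σ (List PSet) λ L →
  length L ≡ n × Unique L × All P L × (∀ S → P S → S ∈L L)

ExactlyNUnordered : ℕ → (PSet → PSet → Set) → Set
ExactlyNUnordered n R = Σ (List (PSet × PSet)) λ L →
  length L ≡ n × AllPairs (λ p q → ¬ SamePair p q) L × All (uncurry R) L
  × (∀ D D' → R D D' → ((D , D') ∈L L) ⊎ ((D' , D) ∈L L))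

-- A set symmetric about the origin is a cap iff its pairs {b, −b}, viewed as points of PG(3,3), contain
-- no three collinear points; the 20-caps with anchor 0 are thus the double covers of the elliptic quadrics.
--
-- Every cap with 20 points is equivalent to one model.  Counting pairs and triples of its points over
-- the 120 hyperplanes gives Σ n² = 5740 and Σ n³ = 42980 for the section sizes n, which forces a
-- section of at least 9 points.  After moving that hyperplane to x₃ = 0 and an affine basis to the unit
-- vectors, the section and then the cap are found by exhaustive search, up to affine maps.
--
-- All notions involved are invariant under collineations (a hyperplane is the zero set of a map u to
-- 𝔽₃ with u (−x − y) = −u x − u y), so the model is enough.  A partition containing the model has the same
-- anchor, since any other point completes at most three lines with it, so its other blocks are ovoids
-- of PG(3,3) among the 30 remaining points: there are 198, of which 36, 90 and 72 lie in exactly 1, 2 and 6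
-- partitions.  A demicap in the model likewise has anchor 0 and consists of five points of the quadric, no
-- four coplanar; 36 of the 126 splittings into two fives qualify.
module Submission where

open import Defs
open import Data.Bool using (Bool; true; false; if_then_else_; _∧_; T; not; _∨_)
open import Data.Bool.ListAction using (any; all)
open import Data.Bool.Properties using (T-≡; ¬-not)
open import Data.Empty using (⊥-elim; ⊥)
open import Data.Fin using (Fin; zero; suc; toℕ; punchOut; fromℕ<; inject≤)
open import Data.Fin.Patterns using (0F; 1F; 2F; 3F)
open import Data.Fin.Properties using (toℕ-fromℕ<; toℕ-injective; toℕ<n; any?; injective⇒≤; punchOut-injective;
  suc-injective; inject≤-injective) renaming (_≟_ to _≟F_)
open import Data.Fin.Subset using (Subset; _∈_; _∉_; _∪_; ∣_∣; inside; outside)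
open import Data.Fin.Subset.Properties using (_∈?_; x∈p∪q⁻; x∈p∪q⁺; ∪-comm)
open import Data.List using (List; []; _∷_; _++_; length; map; allFin; filterᵇ; upTo; downFrom; take; applyUpTo)
open import Data.List.Membership.Propositional using (find; lose) renaming (_∈_ to _∈L_)
open import Data.List.Membership.Propositional.Properties using (∈-∃++; ∈-filter⁺; ∈-filter⁻; ∈-++⁻; ∈-++⁺ˡ; ∈-++⁺ʳ; ∈-map⁺; ∈-map⁻;
  ∈-allFin; ∈-upTo⁺; ∈-upTo⁻; ∈-tabulate⁻) renaming (∈-lookup to ∈-lookupL)
open import Data.List.Membership.Propositional.Properties.WithK using (unique∧set⇒bag)
open import Data.List.Properties using (length-++; length-++-sucʳ; length-map; map-∘; map-cong; length-take)
open import Data.List.Relation.Binary.BagAndSetEquality using (∼bag⇒↭)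
open import Data.List.Relation.Binary.Permutation.Propositional using (_↭_)
open import Data.List.Relation.Binary.Permutation.Propositional.Properties using () renaming (map⁺ to ↭-map⁺)
open import Data.List.Relation.Unary.All as All using (All; []; _∷_)
open import Data.List.Relation.Unary.All.Properties using (all⁺) renaming (map⁺ to All-map⁺)
open import Data.List.Relation.Unary.AllPairs as AllPairs using ([]; _∷_; AllPairs)
open import Data.List.Relation.Unary.AllPairs.Properties using () renaming (map⁺ to AllPairs-map⁺)
open import Data.List.Relation.Unary.Any as Any using (here; there)
open import Data.List.Relation.Unary.Any.Properties using (any⁺; any⁻)
open import Data.List.Relation.Unary.Unique.Propositional using (Unique)
open import Data.List.Relation.Unary.Unique.Propositional.Properties using (allFin⁺;
  take⁺) renaming (map⁺ to Unique-map⁺; filter⁺ to Unique-filter⁺; tabulate⁺ to Unique-tabulate⁺)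
open import Data.Nat using (ℕ; zero; suc; _+_; _*_; _≤_; _<_; _%_; _/_; _≡ᵇ_; z≤n; s≤s; s≤s⁻¹; _≤ᵇ_; _<ᵇ_; _≤?_;
  _∸_; _<?_)
open import Data.Nat.DivMod using (_mod_; m%n<n; m<n⇒m%n≡m; m%n%n≡m%n; %-distribˡ-+; %-distribˡ-*; [m+kn]%n≡m%n)
open import Data.Nat.ListAction using (sum)
open import Data.Nat.ListAction.Properties using (sum-↭)
open import Data.Nat.Properties using (≡ᵇ⇒≡; +-comm; ≤-trans; ≤-reflexive; m<1+n⇒m<n∨m≡n; 1+n≰n; ≤-antisym;
  ≤ᵇ⇒≤; *-mono-≤; *-zeroʳ; *-identityˡ; *-comm; +-identityʳ; ≤⇒≤ᵇ; <ᵇ⇒<; *-assoc; *-distribˡ-+; *-identityʳ;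
  +-mono-≤; +-mono-<; ≰⇒>; <⇒≱; ≤-refl; m≤n⇒m≤1+n; <⇒<ᵇ; +-cancelˡ-≤; m≤n⇒m⊓n≡m; ≤-total)
open import Data.Nat.Tactic.RingSolver using (solve-∀)
open import Data.Product using (Σ; ∃; _×_; _,_; proj₁; proj₂)
open import Data.Sum using (_⊎_; inj₁; inj₂; [_,_]′) renaming (map to ⊎-map)
open import Data.Vec using ([]; _∷_; tabulate; lookup; here; there)
open import Data.Vec.Properties using (lookup∘tabulate; tabulate∘lookup; tabulate-cong; lookup⇒[]=) renaming ([]=⇒lookup to ∈-lookup)
open import Function.Bundles using (Equivalence; mk⇔)
open import Relation.Binary.PropositionalEquality
open import Relation.Nullary using (¬_; contradiction; yes; no; Dec; _×-dec_; ¬?; _⊎-dec_)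
open import Relation.Nullary.Decidable using (⌊_⌋; isYes≗does; does-⇔; decidable-stable; T?)
import Data.List as L

-- The second moment alone does not force a large section: it averages 143.5 over the parallel
-- classes, and sections 8, 8, 4 reach 144. The combination 19 Σ n² - Σ n³ does: with all sections
-- at most 8 it is at most 1648 on a class, attained at 8, 8, 4, whereas its average is 1652.
--
-- That no cap exceeds 20 points is not assumed. The moments are taken over 20 chosen points, but
-- both searches follow the whole cap, so any cap with at least 20 points is carried onto the model
-- and has exactly 20.
--
-- Uniqueness of a partition becomes a property of a list. Beside the model and a second block M, a
-- third block determines the fourth; the possible third blocks form a list in which every partition
-- appears twice, and 1-completable means that this list is one pair of complementary entries. A
-- single finite check compares this with being the image of a decomposition; it gives both
-- surjectivity and the count of completable caps.
--
-- The searches are run by the type checker. Hence points are coded by natural numbers, tests are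
-- Boolean, and much of the proof translates between these tests and statements on subsets.

-- Finite checks by evaluation.

bool-ext : ∀ {a b} → (a ≡ true → b ≡ true) → (b ≡ true → a ≡ true) → a ≡ b
bool-ext {true}          f g = sym (f refl)
bool-ext {false} {true}  f g = g refl
bool-ext {false} {false} f g = refl

∧-true : ∀ {a b} → a ∧ b ≡ true → a ≡ true × b ≡ true
∧-true {true} p = refl , p

≡ᵇ-sound : ∀ {m n} → (m ≡ᵇ n) ≡ true → m ≡ n
≡ᵇ-sound {m} {n} e = ≡ᵇ⇒≡ m n (Equivalence.from T-≡ e)

≡ᵇ-refl : ∀ n → (n ≡ᵇ n) ≡ true
≡ᵇ-refl zero    = refl
≡ᵇ-refl (suc n) = ≡ᵇ-refl n

-- Identities modulo 3 and facts about all 81 points are phrased with this Boolean quantifier, so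
-- that `refl` proves them by evaluation and `all<-sound` extracts the instances.
all< : ℕ → (ℕ → Bool) → Bool
all< zero    p = true
all< (suc n) p = p n ∧ all< n p

all<-sound : ∀ n (p : ℕ → Bool) → all< n p ≡ true → ∀ {m} → m < n → p m ≡ true
all<-sound (suc n) p e m<1+n with m<1+n⇒m<n∨m≡n m<1+n
... | inj₁ m<n  = all<-sound n p (proj₂ (∧-true e)) m<n
... | inj₂ refl = proj₁ (∧-true e)

residues₂ : ∀ (p : ℕ → ℕ → Bool) → all< 3 (λ a → all< 3 (p a)) ≡ true → ∀ {a b} → a < 3 → b < 3 → p a b ≡ true
residues₂ p e {a} a<3 b<3 = all<-sound 3 (p a) (all<-sound 3 (λ a → all< 3 (p a)) e a<3) b<3

residues₃ : ∀ (p : ℕ → ℕ → ℕ → Bool) → all< 3 (λ a → all< 3 λ b → all< 3 (p a b)) ≡ true →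
            ∀ {a b c} → a < 3 → b < 3 → c < 3 → p a b c ≡ true
residues₃ p e {a} a<3 b<3 c<3 = residues₂ (p a) (all<-sound 3 (λ a → all< 3 λ b → all< 3 (p a b)) e a<3) b<3 c<3

-- Pigeonhole by cutting: the head of `xs` is cut out of `ys` at one occurrence, and uniqueness
-- keeps the tail of `xs` away from the cut.
length-⊆ : ∀ {A : Set} {xs ys : List A} → Unique xs → (∀ {x} → x ∈L xs → x ∈L ys) →
           length xs ≤ length ys
length-⊆ []       _   = z≤n
length-⊆ {A} {x ∷ xs} (x∉ ∷ uxs) sub with ∈-∃++ (sub (here refl))
... | as , bs , refl =
  ≤-trans (s≤s (length-⊆ uxs sub′)) (≤-reflexive (sym (length-++-sucʳ as x bs)))
  where
  sub′ : ∀ {y} → y ∈L xs → y ∈L (as ++ bs)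
  sub′ {y} y∈ with ∈-++⁻ as (sub (there y∈))
  ... | inj₁ p              = ∈-++⁺ˡ p
  ... | inj₂ (here refl)    = contradiction refl (All.lookup x∉ y∈)
  ... | inj₂ (there p)      = ∈-++⁺ʳ as p

-- Points as codes below 81, coordinates as base-3 digits.

pt : ℕ → Point
pt n = n mod 81

toℕ-pt : ∀ {n} → n < 81 → toℕ (pt n) ≡ n
toℕ-pt {n} n<81 = trans (toℕ-fromℕ< (m%n<n n 81)) (m<n⇒m%n≡m n<81)

pt-toℕ : ∀ (x : Point) → pt (toℕ x) ≡ x
pt-toℕ x = toℕ-injective (toℕ-pt (toℕ<n x))

digit : Fin 4 → ℕ → ℕ
digit 0F n = n % 3
digit 1F n = (n / 3) % 3
digit 2F n = (n / 9) % 3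
digit 3F n = (n / 27) % 3

coord-digit : ∀ x i → coord x i ≡ digit i (toℕ x)
coord-digit x 0F = refl
coord-digit x 1F = refl
coord-digit x 2F = refl
coord-digit x 3F = refl

digit<3 : ∀ i n → digit i n < 3
digit<3 0F n = m%n<n n 3
digit<3 1F n = m%n<n (n / 3) 3
digit<3 2F n = m%n<n (n / 9) 3
digit<3 3F n = m%n<n (n / 27) 3

coord<3 : ∀ x i → coord x i < 3
coord<3 x i = subst (_< 3) (sym (coord-digit x i)) (digit<3 i (toℕ x))

code : ℕ → ℕ → ℕ → ℕ → ℕ
code a b c d = a + 3 * (b + 3 * (c + 3 * d))

select : {A : Set} → A → A → A → A → Fin 4 → A
select a b c d 0F = a
select a b c d 1F = b
select a b c d 2F = c
select a b c d 3F = d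

private
  codeCheck : ℕ → ℕ → ℕ → ℕ → Bool
  codeCheck a b c d =
    let n = code a b c d in
    -- The last conjunct says n < 81 in the form n % 81 = n; `code<81` reads it off.
    (digit 0F n ≡ᵇ a) ∧ (digit 1F n ≡ᵇ b) ∧ (digit 2F n ≡ᵇ c) ∧ (digit 3F n ≡ᵇ d) ∧ (n % 81 ≡ᵇ n)

  codeCheck-true : all< 3 (λ a → all< 3 λ b → all< 3 λ c → all< 3 (codeCheck a b c)) ≡ true
  codeCheck-true = refl

  codeCheck-sound : ∀ {a b c d} → a < 3 → b < 3 → c < 3 → d < 3 → codeCheck a b c d ≡ true
  codeCheck-sound {a} {b} {c} {d} a<3 b<3 c<3 d<3 =
    residues₃ (codeCheck a) (all<-sound 3 (λ a → all< 3 λ b → all< 3 λ c → all< 3 (codeCheck a b c)) codeCheck-true a<3)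
      b<3 c<3 d<3

digit-code : ∀ {a b c d} → a < 3 → b < 3 → c < 3 → d < 3 →
             ∀ i → digit i (code a b c d) ≡ select a b c d i
digit-code {a} {b} {c} {d} p q r s i
  with ∧-true {digit 0F (code a b c d) ≡ᵇ a} (codeCheck-sound p q r s)
... | e₀ , e with ∧-true {digit 1F (code a b c d) ≡ᵇ b} e
... | e₁ , e′ with ∧-true {digit 2F (code a b c d) ≡ᵇ c} e′
... | e₂ , e″ with ∧-true {digit 3F (code a b c d) ≡ᵇ d} e″
digit-code p q r s 0F | e₀ , _ | _ | _ | _ = ≡ᵇ-sound e₀
digit-code p q r s 1F | _ | e₁ , _ | _ | _ = ≡ᵇ-sound e₁
digit-code p q r s 2F | _ | _ | e₂ , _ | _ = ≡ᵇ-sound e₂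
digit-code p q r s 3F | _ | _ | _ | e₃ , _ = ≡ᵇ-sound e₃

select-η : {A : Set} (f : Fin 4 → A) → ∀ i → select (f 0F) (f 1F) (f 2F) (f 3F) i ≡ f i
select-η f 0F = refl
select-η f 1F = refl
select-η f 2F = refl
select-η f 3F = refl

code<81 : ∀ {a b c d} → a < 3 → b < 3 → c < 3 → d < 3 → code a b c d < 81
code<81 {a} {b} {c} {d} p q r s =
  subst (_< 81) (≡ᵇ-sound (proj₂ (∧-true {digit 3F n ≡ᵇ d} (proj₂ (∧-true {digit 2F n ≡ᵇ c}
    (proj₂ (∧-true {digit 1F n ≡ᵇ b} (proj₂ (∧-true {digit 0F n ≡ᵇ a} (codeCheck-sound p q r s))))))))))
    (m%n<n n 81)
  where n = code a b c d

code-digits : ∀ {n} → n < 81 → code (digit 0F n) (digit 1F n) (digit 2F n) (digit 3F n) ≡ n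
code-digits {n} n<81 =
  ≡ᵇ-sound (all<-sound 81 (λ n → code (digit 0F n) (digit 1F n) (digit 2F n) (digit 3F n) ≡ᵇ n) refl n<81)

point-ext : ∀ {x y : Point} → (∀ i → coord x i ≡ coord y i) → x ≡ y
point-ext {x} {y} e = toℕ-injective (begin
  toℕ x                                              ≡⟨ code-digits (toℕ<n x) ⟨
  code (coord x 0F) (coord x 1F) (coord x 2F) (coord x 3F) ≡⟨ cong₂ (λ a b → code a b (coord x 2F) (coord x 3F)) (e 0F)
    (e 1F) ⟩
  code (coord y 0F) (coord y 1F) (coord x 2F) (coord x 3F) ≡⟨ cong₂ (code (coord y 0F) (coord y 1F)) (e 2F) (e 3F) ⟩
  code (coord y 0F) (coord y 1F) (coord y 2F) (coord y 3F) ≡⟨ code-digits (toℕ<n y) ⟩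
  toℕ y                                              ∎)
  where open ≡-Reasoning

fromForms : (Fin 4 → ℕ) → ℕ
fromForms f = code (f 0F % 3) (f 1F % 3) (f 2F % 3) (f 3F % 3)

fromForms<81 : ∀ f → fromForms f < 81
fromForms<81 f = code<81 (m%n<n (f 0F) 3) (m%n<n (f 1F) 3) (m%n<n (f 2F) 3) (m%n<n (f 3F) 3)

digit-fromForms : ∀ f i → digit i (fromForms f) ≡ f i % 3
digit-fromForms f i = trans (digit-code (m%n<n (f 0F) 3) (m%n<n (f 1F) 3) (m%n<n (f 2F) 3) (m%n<n (f 3F) 3) i)
  (select-η (λ i → f i % 3) i)

coord-fromForms : ∀ f i → coord (pt (fromForms f)) i ≡ f i % 3
coord-fromForms f i = trans (coord-digit (pt (fromForms f)) i)
  (trans (cong (digit i) (toℕ-pt (fromForms<81 f))) (digit-fromForms f i))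

-- On codes and on points, third and ∘ compute −x − y: the lines are the sets {x, y, x ∘ y} with x ≢ y.
third : ℕ → ℕ → ℕ
third x y = fromForms λ i → 2 * (digit i x + digit i y)

third<81 : ∀ x y → third x y < 81
third<81 x y = fromForms<81 (λ i → 2 * (digit i x + digit i y))

infixl 7 _∘_
abstract
  _∘_ : Point → Point → Point
  x ∘ y = pt (third (toℕ x) (toℕ y))

  ∘-pt : ∀ x y → x ∘ y ≡ pt (third (toℕ x) (toℕ y))
  ∘-pt x y = refl

toℕ-∘ : ∀ x y → toℕ (x ∘ y) ≡ third (toℕ x) (toℕ y)
toℕ-∘ x y = trans (cong toℕ (∘-pt x y)) (toℕ-pt (third<81 (toℕ x) (toℕ y)))

coord-∘ : ∀ x y i → coord (x ∘ y) i ≡ (2 * (coord x i + coord y i)) % 3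
coord-∘ x y i = trans (cong (λ p → coord p i) (∘-pt x y)) (trans
  (coord-fromForms (λ i → 2 * (digit i (toℕ x) + digit i (toℕ y))) i)
  (cong₂ (λ a b → (2 * (a + b)) % 3) (sym (coord-digit x i)) (sym (coord-digit y i))))

∘-comm : ∀ x y → x ∘ y ≡ y ∘ x
∘-comm x y = point-ext λ i → trans (coord-∘ x y i)
  (trans (cong (λ s → (2 * s) % 3) (+-comm (coord x i) (coord y i))) (sym (coord-∘ y x i)))

∘-idem : ∀ x → x ∘ x ≡ x
∘-idem x = point-ext λ i → trans (coord-∘ x x i)
  (≡ᵇ-sound (all<-sound 3 (λ a → (2 * (a + a)) % 3 ≡ᵇ a) refl (coord<3 x i)))

∘-invol : ∀ x y → x ∘ (x ∘ y) ≡ y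
∘-invol x y = point-ext λ i → trans (coord-∘ x (x ∘ y) i)
  (trans (cong (λ s → (2 * (coord x i + s)) % 3) (coord-∘ x y i))
  (≡ᵇ-sound (residues₂ (λ a b → (2 * (a + (2 * (a + b)) % 3)) % 3 ≡ᵇ b) refl (coord<3 x i) (coord<3 y i))))

∘-inj : ∀ x {y z} → x ∘ y ≡ x ∘ z → y ≡ z
∘-inj x {y} {z} e = trans (sym (∘-invol x y)) (trans (cong (x ∘_) e) (∘-invol x z))

x∘y≡x⇒y≡x : ∀ x {y} → x ∘ y ≡ x → y ≡ x
x∘y≡x⇒y≡x x e = ∘-inj x (trans e (sym (∘-idem x)))

line⇒∘ : ∀ {x y z} → IsLine x y z → z ≡ x ∘ y
line⇒∘ {x} {y} {z} (_ , _ , _ , l) = point-ext λ i → sym (trans (coord-∘ x y i)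
  (lemma (coord<3 x i) (coord<3 y i) (coord<3 z i) (l i)))
  where
  check : ℕ → ℕ → ℕ → Bool
  check a b c = if (a + b + c) % 3 ≡ᵇ 0 then (2 * (a + b)) % 3 ≡ᵇ c else true
  lemma : ∀ {a b c} → a < 3 → b < 3 → c < 3 → (a + b + c) % 3 ≡ 0 → (2 * (a + b)) % 3 ≡ c
  lemma {a} {b} {c} p q r e = ≡ᵇ-sound (subst (λ t → (if t ≡ᵇ 0 then (2 * (a + b)) % 3 ≡ᵇ c else true) ≡ true) e
    (residues₃ check refl p q r))

∘-line : ∀ {x y} → x ≢ y → IsLine x y (x ∘ y)
∘-line {x} {y} x≢y = x≢y , (λ e → x≢y (sym (x∘y≡x⇒y≡x x (sym e))))
  , (λ e → x≢y (x∘y≡x⇒y≡x y (trans (∘-comm y x) (sym e))))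
  , λ i → trans (cong (λ s → (coord x i + coord y i + s) % 3) (coord-∘ x y i)) (lemma (coord<3 x i) (coord<3 y i))
  where
  check : ℕ → ℕ → Bool
  check a b = (a + b + (2 * (a + b)) % 3) % 3 ≡ᵇ 0
  lemma : ∀ {a b} → a < 3 → b < 3 → (a + b + (2 * (a + b)) % 3) % 3 ≡ 0
  lemma {a} p q = ≡ᵇ-sound (residues₂ check refl p q)

-- Collineations

infix 4 _≋_
-- A record rather than the bare equation: a and b cannot be inferred from a % 3 ≡ b % 3, but they
-- can from `a ≋ b`.
record _≋_ (a b : ℕ) : Set where
  constructor mk≋
  field mod≡ : a % 3 ≡ b % 3
open _≋_

≋-refl : ∀ {a} → a ≋ a
≋-refl = mk≋ refl

≋-trans : ∀ {a b c} → a ≋ b → b ≋ c → a ≋ c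
≋-trans (mk≋ p) (mk≋ q) = mk≋ (trans p q)

≋-sym : ∀ {a b} → a ≋ b → b ≋ a
≋-sym (mk≋ p) = mk≋ (sym p)

%-≋ : ∀ a → a % 3 ≋ a
%-≋ a = mk≋ (m%n%n≡m%n a 3)

+-≋ : ∀ {a b c d} → a ≋ b → c ≋ d → a + c ≋ b + d
+-≋ {a} {b} {c} {d} (mk≋ p) (mk≋ q) = mk≋ (trans (%-distribˡ-+ a c 3)
  (trans (cong₂ (λ s t → (s + t) % 3) p q) (sym (%-distribˡ-+ b d 3))))

*-≋ : ∀ a {c d} → c ≋ d → a * c ≋ a * d
*-≋ a {c} {d} (mk≋ q) = mk≋ (trans (%-distribˡ-* a c 3) (trans (cong (λ t → (a % 3 * t) % 3) q)
  (sym (%-distribˡ-* a d 3))))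

+3*-≋ : ∀ a k → a ≋ a + k * 3
+3*-≋ a k = mk≋ (sym ([m+kn]%n≡m%n a k 3))

record Form : Set where
  constructor form
  field k q₀ q₁ q₂ q₃ : ℕ

eval : Form → ℕ → ℕ
eval (form k a b c d) x = k + (a * digit 0F x + b * digit 1F x + c * digit 2F x + d * digit 3F x)

eval-∘ : ∀ f x y → eval f (toℕ (x ∘ y)) ≋ 2 * (eval f (toℕ x) + eval f (toℕ y))
eval-∘ (form k a b c d) x y = ≋-trans
  (+-≋ (≋-refl {k}) (+-≋ (+-≋ (+-≋ (*-≋ a (step 0F)) (*-≋ b (step 1F))) (*-≋ c (step 2F))) (*-≋ d (step 3F))))
  -- The constant terms on the right add up to 2 (k + k) = k + 3k, so a multiple of 3 is supplied on
  -- the left before the ring identity.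
  (≋-trans (+3*-≋ _ k) (mk≋ (cong (_% 3) (identity k a b c d
    (digit 0F (toℕ x)) (digit 1F (toℕ x)) (digit 2F (toℕ x)) (digit 3F (toℕ x))
    (digit 0F (toℕ y)) (digit 1F (toℕ y)) (digit 2F (toℕ y)) (digit 3F (toℕ y))))))
  where
  step : ∀ i → digit i (toℕ (x ∘ y)) ≋ 2 * (digit i (toℕ x) + digit i (toℕ y))
  step i = ≋-trans (mk≋ (cong (_% 3) (trans (cong (digit i) (toℕ-∘ x y))
    (digit-fromForms (λ i → 2 * (digit i (toℕ x) + digit i (toℕ y))) i))))
                   (%-≋ (2 * (digit i (toℕ x) + digit i (toℕ y))))
  identity : ∀ k a b c d x₀ x₁ x₂ x₃ y₀ y₁ y₂ y₃ →
    k + (a * (2 * (x₀ + y₀)) + b * (2 * (x₁ + y₁)) + c * (2 * (x₂ + y₂)) + d * (2 * (x₃ + y₃))) + k * 3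
    ≡ 2 * (k + (a * x₀ + b * x₁ + c * x₂ + d * x₃) + (k + (a * y₀ + b * y₁ + c * y₂ + d * y₃)))
  identity = solve-∀

record Coll : Set where
  field
    to from : Point → Point
    to-from : ∀ x → to (from x) ≡ x
    from-to : ∀ x → from (to x) ≡ x
    to-∘    : ∀ x y → to (x ∘ y) ≡ to x ∘ to y

  to-inj : ∀ {x y} → to x ≡ to y → x ≡ y
  to-inj {x} {y} e = trans (sym (from-to x)) (trans (cong from e) (from-to y))

  from-∘ : ∀ x y → from (x ∘ y) ≡ from x ∘ from y
  from-∘ x y = to-inj (trans (to-from _) (sym (trans (to-∘ (from x) (from y)) (cong₂ _∘_ (to-from x) (to-from y)))))

inverse : Coll → Coll
inverse g = record { to = from ; from = to ; to-from = from-to ; from-to = to-from ; to-∘ = from-∘ }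
  where open Coll g

compose : Coll → Coll → Coll
compose g h = record
  { to      = λ x → G.to (H.to x)
  ; from    = λ x → H.from (G.from x)
  ; to-from = λ x → trans (cong G.to (H.to-from (G.from x))) (G.to-from x)
  ; from-to = λ x → trans (cong H.from (G.from-to (H.to x))) (H.from-to x)
  ; to-∘    = λ x y → trans (cong G.to (H.to-∘ x y)) (G.to-∘ (H.to x) (H.to y))
  }
  where
  module G = Coll g
  module H = Coll h

-- If y were missed, `punchOut` at y would embed `Fin (suc n)` into `Fin n`.
injective⇒surjective : ∀ {n} (f : Fin n → Fin n) → (∀ {x y} → f x ≡ f y → x ≡ y) → ∀ y → ∃ λ x → f x ≡ y
injective⇒surjective {suc n} f inj y with any? (λ x → f x ≟F y)
... | yes p = p
... | no ¬p = contradiction (injective⇒≤ {f = λ x → punchOut (λ e → ¬p (x , sym e))}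
                (λ {a} {b} e → inj (punchOut-injective (λ e → ¬p (a , sym e)) (λ e → ¬p (b , sym e)) e))) 1+n≰n

record Affine : Set where
  constructor affine
  field f₀ f₁ f₂ f₃ : Form

apply : Affine → ℕ → ℕ
apply (affine f₀ f₁ f₂ f₃) x = code (eval f₀ x % 3) (eval f₁ x % 3) (eval f₂ x % 3) (eval f₃ x % 3)

formAt : Affine → Fin 4 → Form
formAt (affine f₀ f₁ f₂ f₃) = select f₀ f₁ f₂ f₃

evals : Affine → ℕ → Fin 4 → ℕ
evals A x i = eval (formAt A i) x

apply<81 : ∀ A x → apply A x < 81
apply<81 A x = fromForms<81 (evals A x)

coord-apply : ∀ A n i → coord (pt (apply A n)) i ≡ eval (formAt A i) n % 3
coord-apply A n i = coord-fromForms (evals A n) i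

-- For an affine map it is enough that no other point shares the image of 0, so 80 comparisons
-- replace a test of all pairs; `hom-injective` justifies this.
isInjective : Affine → Bool
isInjective A = let z = apply A 0 in all< 80 λ n → not (apply A (suc n) ≡ᵇ z)

∘-cancel-diff : ∀ (z x y : Point) → (z ∘ y) ∘ x ≡ z → x ≡ y
∘-cancel-diff z x y e = ∘-inj (z ∘ y) (trans e (sym (trans (cong (_∘ y) (∘-comm z y))
  (trans (∘-comm (y ∘ z) y) (∘-invol y z)))))

-- The point (o ∘ y) ∘ x is o + y - x. If f x = f y, it has the same image as o, so it equals o and
-- x = y.
hom-injective : (f : Point → Point) → (∀ x y → f (x ∘ y) ≡ f x ∘ f y) →
                ∀ o → (∀ c → f c ≡ f o → c ≡ o) → ∀ {x y} → f x ≡ f y → x ≡ y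
hom-injective f f-∘ o kernel {x} {y} e = ∘-cancel-diff o x y (kernel ((o ∘ y) ∘ x) (begin
  f ((o ∘ y) ∘ x)     ≡⟨ f-∘ (o ∘ y) x ⟩
  f (o ∘ y) ∘ f x     ≡⟨ cong₂ _∘_ (f-∘ o y) e ⟩
  (f o ∘ f y) ∘ f y   ≡⟨ ∘-comm (f o ∘ f y) (f y) ⟩
  f y ∘ (f o ∘ f y)   ≡⟨ cong (f y ∘_) (∘-comm (f o) (f y)) ⟩
  f y ∘ (f y ∘ f o)   ≡⟨ ∘-invol (f y) (f o) ⟩
  f o                 ∎))
  where open ≡-Reasoning

not-≡ᵇ⇒≢ : ∀ {m n} → not (m ≡ᵇ n) ≡ true → m ≢ n
not-≡ᵇ⇒≢ {m} p refl with trans (sym p) (cong not (≡ᵇ-refl m))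
... | ()

abstract
  -- The inverse is obtained from surjectivity on a finite set, so no inverse matrix has to be
  -- written down. Outside the block only `to-affineColl` is known about the result, which keeps the
  -- inverse from being evaluated.
  affineColl : (A : Affine) → isInjective A ≡ true → Coll
  affineColl A inj = record
    { to = f ; from = λ y → proj₁ (sur y)
    ; to-from = λ y → proj₂ (sur y)
    ; from-to = λ x → f-inj (proj₂ (sur (f x)))
    ; to-∘ = f-∘ }
    where
    f : Point → Point
    f x = pt (apply A (toℕ x))
    f-∘ : ∀ x y → f (x ∘ y) ≡ f x ∘ f y
    f-∘ x y = point-ext λ i → trans (coord-apply A (toℕ (x ∘ y)) i) (trans
      (mod≡ (≋-trans (eval-∘ (formAt A i) x y)
                     (*-≋ 2 (+-≋ (≋-sym (%-≋ (eval (formAt A i) (toℕ x)))) (≋-sym (%-≋ (eval (formAt A i) (toℕ y))))))))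
      (sym (trans (coord-∘ (f x) (f y) i) (cong₂ (λ s t → (2 * (s + t)) % 3) (coord-apply A (toℕ x) i)
        (coord-apply A (toℕ y) i)))))
    kernel : ∀ c → f c ≡ f zero → c ≡ zero
    kernel zero    _ = refl
    kernel (suc c) e = contradiction
      (trans (sym (toℕ-pt (apply<81 A (suc (toℕ c))))) (trans (cong toℕ e) (toℕ-pt (apply<81 A 0))))
      (not-≡ᵇ⇒≢ (all<-sound 80 (λ n → not (apply A (suc n) ≡ᵇ apply A 0)) inj (toℕ<n c)))
    f-inj : ∀ {x y} → f x ≡ f y → x ≡ y
    f-inj = hom-injective f f-∘ zero kernel
    sur : ∀ y → ∃ λ x → f x ≡ y
    sur = injective⇒surjective f f-inj

  to-affineColl : ∀ A inj x → Coll.to (affineColl A inj) x ≡ pt (apply A (toℕ x))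
  to-affineColl A inj x = refl

-- Transport of structure along collineations

members : ∀ {n} → Subset n → List (Fin n)
members []            = []
members (inside  ∷ p) = zero ∷ map suc (members p)
members (outside ∷ p) = map suc (members p)

length-members : ∀ {n} (p : Subset n) → length (members p) ≡ ∣ p ∣
length-members []            = refl
length-members (inside  ∷ p) = cong suc (trans (length-map suc (members p)) (length-members p))
length-members (outside ∷ p) = trans (length-map suc (members p)) (length-members p)

members-! : ∀ {n} (p : Subset n) → Unique (members p)
members-! []            = []
members-! (inside  ∷ p) = All-map⁺ (All.tabulate λ _ ()) ∷ Unique-map⁺ suc-injective (members-! p)
members-! (outside ∷ p) = Unique-map⁺ suc-injective (members-! p)

∈-members⁺ : ∀ {n} {x : Fin n} (p : Subset n) → x ∈ p → x ∈L members p
∈-members⁺ (_ ∷ p)       here       = here refl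
∈-members⁺ (inside  ∷ p) (there x∈) = there (∈-map⁺ suc (∈-members⁺ p x∈))
∈-members⁺ (outside ∷ p) (there x∈) = ∈-map⁺ suc (∈-members⁺ p x∈)

∈-members⁻ : ∀ {n} {x : Fin n} (p : Subset n) → x ∈L members p → x ∈ p
∈-members⁻ (inside ∷ p) (here refl) = here
∈-members⁻ (inside ∷ p) (there x∈) with ∈-map⁻ suc x∈
... | y , y∈ , refl = there (∈-members⁻ p y∈)
∈-members⁻ (outside ∷ p) x∈ with ∈-map⁻ suc x∈
... | y , y∈ , refl = there (∈-members⁻ p y∈)

lookup-∈ : ∀ {n} {x : Fin n} {p : Subset n} → lookup p x ≡ true → x ∈ p
lookup-∈ {x = x} {p} = lookup⇒[]= x p

subset-ext : ∀ {n} {p q : Subset n} → (∀ x → lookup p x ≡ lookup q x) → p ≡ q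
subset-ext {p = p} {q} e = trans (sym (tabulate∘lookup p)) (trans (tabulate-cong e) (tabulate∘lookup q))

subset-antisym : ∀ {n} {p q : Subset n} → (∀ x → x ∈ p → x ∈ q) → (∀ x → x ∈ q → x ∈ p) → p ≡ q
subset-antisym {p = p} {q} f g = subset-ext lemma
  where
  lemma : ∀ x → lookup p x ≡ lookup q x
  lemma x = bool-ext (λ e → ∈-lookup (f x (lookup-∈ e))) (λ e → ∈-lookup (g x (lookup-∈ e)))

abstract
  -- The preimage under g: membership in `act g S` is decided by the image point, so no inverse
  -- enters. Consequently individual points such as anchors move by `from`, and `act` reverses
  -- composition.
  act : Coll → PSet → PSet
  act g S = tabulate λ x → lookup S (Coll.to g x)

  lookup-act : ∀ g S x → lookup (act g S) x ≡ lookup S (Coll.to g x)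
  lookup-act g S x = lookup∘tabulate (λ x → lookup S (Coll.to g x)) x

∈-act⁻ : ∀ g {S x} → x ∈ act g S → Coll.to g x ∈ S
∈-act⁻ g {S} {x} p = lookup-∈ (trans (sym (lookup-act g S x)) (∈-lookup p))

∈-act⁺ : ∀ g {S x} → Coll.to g x ∈ S → x ∈ act g S
∈-act⁺ g {S} {x} p = lookup-∈ (trans (lookup-act g S x) (∈-lookup p))

∈-act-from : ∀ g {S x} → x ∈ S → Coll.from g x ∈ act g S
∈-act-from g {S} {x} p = ∈-act⁺ g (subst (_∈ S) (sym (Coll.to-from g x)) p)

act-inverseˡ : ∀ g S → act g (act (inverse g) S) ≡ S
act-inverseˡ g S = subset-ext λ x → trans (lookup-act g (act (inverse g) S) x)
  (trans (lookup-act (inverse g) S (Coll.to g x)) (cong (lookup S) (Coll.from-to g x)))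

act-inverseʳ : ∀ g S → act (inverse g) (act g S) ≡ S
act-inverseʳ g S = subset-ext λ x → trans (lookup-act (inverse g) (act g S) x)
  (trans (lookup-act g S (Coll.from g x)) (cong (lookup S) (Coll.to-from g x)))

act-compose : ∀ g h S → act h (act g S) ≡ act (compose g h) S
act-compose g h S = subset-ext λ x → trans (lookup-act h (act g S) x)
  (trans (lookup-act g S (Coll.to h x)) (sym (lookup-act (compose g h) S x)))

act-inj : ∀ g {S T} → act g S ≡ act g T → S ≡ T
act-inj g {S} {T} e = trans (sym (act-inverseʳ g S)) (trans (cong (act (inverse g)) e) (act-inverseʳ g T))

line-to : ∀ g {x y z} → IsLine x y z → IsLine (Coll.to g x) (Coll.to g y) (Coll.to g z)
line-to g {x} {y} l@(x≢y , _) =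
  subst (IsLine (to x) (to y)) (trans (sym (to-∘ x y)) (cong to (sym (line⇒∘ l)))) (∘-line λ e → x≢y (to-inj e))
  where open Coll g

line-from : ∀ g {x y z} → IsLine (Coll.to g x) (Coll.to g y) (Coll.to g z) → IsLine x y z
line-from g {x} {y} {z} l =
  subst (λ x → IsLine x y z) (from-to x) (subst₂ (IsLine (from (to x))) (from-to y) (from-to z) (line-to (inverse g) l))
  where open Coll g

Cap-act : ∀ g {S} → Cap S → Cap (act g S)
Cap-act g cap x y z x∈ y∈ z∈ l = cap _ _ _ (∈-act⁻ g x∈) (∈-act⁻ g y∈) (∈-act⁻ g z∈) (line-to g l)

∣act∣≤ : ∀ g S → ∣ act g S ∣ ≤ ∣ S ∣
∣act∣≤ g S = subst₂ _≤_ (trans (length-map to (members (act g S))) (length-members (act g S))) (length-members S)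
  (length-⊆ (Unique-map⁺ to-inj (members-! (act g S))) sub)
  where
  open Coll g
  sub : ∀ {x} → x ∈L map to (members (act g S)) → x ∈L members S
  sub x∈ with ∈-map⁻ to x∈
  ... | y , y∈ , refl = ∈-members⁺ S (∈-act⁻ g (∈-members⁻ (act g S) y∈))

∣act∣ : ∀ g S → ∣ act g S ∣ ≡ ∣ S ∣
∣act∣ g S = ≤-antisym (∣act∣≤ g S) (subst (λ T → ∣ T ∣ ≤ ∣ act g S ∣) (act-inverseʳ g S) (∣act∣≤ (inverse g) (act g S)))

MaxCap-act : ∀ g {S} → MaxCap S → MaxCap (act g S)
MaxCap-act g {S} (cap , max) = Cap-act g cap , λ T capT →
  subst₂ _≤_ (∣act∣ (inverse g) T) (sym (∣act∣ g S)) (max (act (inverse g) T) (Cap-act (inverse g) capT))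

Disjoint-act : ∀ g {S T} → Disjoint S T → Disjoint (act g S) (act g T)
Disjoint-act g dis x x∈ x∈′ = dis _ (∈-act⁻ g x∈) (∈-act⁻ g x∈′)

line-at-from : ∀ g {a b c} → IsLine a (Coll.to g b) c → IsLine (Coll.from g a) b (Coll.from g c)
line-at-from g {a} {b} {c} l =
  subst (λ b → IsLine (from a) b (from c)) (from-to b) (line-to (inverse g) l)
  where open Coll g

closed-act : ∀ g {a S} → (∀ b → b ∈ S → ∃ λ c → c ∈ S × IsLine a b c) →
             ∀ b → b ∈ act g S → ∃ λ c → c ∈ act g S × IsLine (Coll.from g a) b c
closed-act g f b b∈ with f _ (∈-act⁻ g b∈)
... | c , c∈ , l = Coll.from g c , ∈-act-from g c∈ , line-at-from g l

∉-act : ∀ g {a S} → a ∉ S → Coll.from g a ∉ act g S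
∉-act g {a} {S} a∉ p = a∉ (subst (_∈ S) (Coll.to-from g a) (∈-act⁻ g p))

AnchorOf-act : ∀ g {a S} → AnchorOf a S → AnchorOf (Coll.from g a) (act g S)
AnchorOf-act g (a∉ , f) = ∉-act g a∉ , closed-act g f

Partition-act : ∀ g {a C₁ C₂ C₃ C₄} → Partition a C₁ C₂ C₃ C₄ →
                Partition (Coll.from g a) (act g C₁) (act g C₂) (act g C₃) (act g C₄)
Partition-act g (m₁ , m₂ , m₃ , m₄ , a₁ , a₂ , a₃ , a₄ , d₁ , d₂ , d₃ , d₄ , d₅ , d₆ , cover) =
  MaxCap-act g m₁ , MaxCap-act g m₂ , MaxCap-act g m₃ , MaxCap-act g m₄ ,
  AnchorOf-act g a₁ , AnchorOf-act g a₂ , AnchorOf-act g a₃ , AnchorOf-act g a₄ ,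
  Disjoint-act g d₁ , Disjoint-act g d₂ , Disjoint-act g d₃ ,
  Disjoint-act g d₄ , Disjoint-act g d₅ , Disjoint-act g d₆ ,
  λ p → ⊎-map (λ e → trans (sym (Coll.from-to g p)) (cong (Coll.from g) e))
    (⊎-map (∈-act⁺ g) (⊎-map (∈-act⁺ g) (⊎-map (∈-act⁺ g) (∈-act⁺ g)))) (cover (Coll.to g p))

SamePair-act⁻ : ∀ g {A B A′ B′} → SamePair (act g A , act g B) (act g A′ , act g B′) → SamePair (A , B) (A′ , B′)
SamePair-act⁻ g (inj₁ (p , q)) = inj₁ (act-inj g p , act-inj g q)
SamePair-act⁻ g (inj₂ (p , q)) = inj₂ (act-inj g p , act-inj g q)

OneCompletable-act : ∀ g {C C′} → OneCompletable C C′ → OneCompletable (act g C) (act g C′)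
OneCompletable-act g {C} {C′} (m , m′ , dis , (a , C₃ , C₄ , P) , unique) =
  MaxCap-act g m , MaxCap-act g m′ , Disjoint-act g dis ,
  (Coll.from g a , act g C₃ , act g C₄ , Partition-act g P) ,
  λ a C₃ C₄ b D₃ D₄ P Q → let e , s = unique _ _ _ _ _ _ (back P) (back Q) in
    Coll.to-inj g e , SamePair-act⁻ (inverse g) s
  where
  back : ∀ {a D₃ D₄} → Partition a (act g C) (act g C′) D₃ D₄ →
         Partition (Coll.to g a) C C′ (act (inverse g) D₃) (act (inverse g) D₄)
  back P = subst₂ (λ C C′ → Partition _ C C′ _ _) (act-inverseʳ g C) (act-inverseʳ g C′) (Partition-act (inverse g) P)

-- Maps u with u (x ∘ y) ≋ 2 (u x + u y) are the affine functions to 𝔽₃; they are determined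
-- by their values on the affine basis 0, 1, 3, 9, 27.
IsAffine : (Point → ℕ) → Set
IsAffine u = ∀ x y → u (x ∘ y) ≋ 2 * (u x + u y)

module _ (E : Point → Set) (E-∘ : ∀ {x y} → E x → E y → E (x ∘ y))
         (E₀ : E (pt 0)) (E₁ : E (pt 1)) (E₃ : E (pt 3)) (E₉ : E (pt 9)) (E₂₇ : E (pt 27)) where

  private
    -- Vector addition written as -(-m - n). A family E that is closed under ∘ and holds at 0 is
    -- therefore closed under addition.
    plus : ℕ → ℕ → ℕ
    plus m n = third 0 (third m n)

    low high : ℕ → ℕ
    low  n = plus (digit 0F n) (3 * digit 1F n)
    high n = plus (9 * digit 2F n) (27 * digit 3F n)

    decompose : ∀ n → n < 81 → plus (low n) (high n) ≡ n
    decompose n n<81 = ≡ᵇ-sound (all<-sound 81 (λ n → plus (low n) (high n) ≡ᵇ n) refl n<81)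

    E-third : ∀ {m n} → m < 81 → n < 81 → E (pt m) → E (pt n) → E (pt (third m n))
    E-third {m} {n} p q e f = subst E (trans (∘-pt (pt m) (pt n)) (cong₂ (λ s t → pt (third s t)) (toℕ-pt p) (toℕ-pt q)))
      (E-∘ e f)

    E-plus : ∀ {m n} → m < 81 → n < 81 → E (pt m) → E (pt n) → E (pt (plus m n))
    E-plus {m} {n} p q e f = E-third (s≤s z≤n) (third<81 m n) E₀ (E-third p q e f)

    plus<81 : ∀ m n → plus m n < 81
    plus<81 m n = third<81 0 (third m n)

    multiple<81 : ∀ k {d} → k ≤ 27 → d < 3 → k * d < 81
    multiple<81 k {d} k≤27 d<3 = ≤-trans (s≤s (*-mono-≤ k≤27 (s≤s⁻¹ d<3))) (≤ᵇ⇒≤ 55 81 _)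

    E-digit : ∀ k → E (pt (k * 1)) → E (pt (k * 2)) → ∀ {d} → d < 3 → E (pt (k * d))
    E-digit k e₁ e₂ {0} _ = subst (λ n → E (pt n)) (sym (*-zeroʳ k)) E₀
    E-digit k e₁ e₂ {1} _ = e₁
    E-digit k e₁ e₂ {2} _ = e₂
    E-digit k e₁ e₂ {suc (suc (suc d))} (s≤s (s≤s (s≤s ())))

    E-double : ∀ {n m} → n < 81 → E (pt n) → third 0 n ≡ m → E (pt m)
    E-double {n} n<81 e refl = E-third {0} {n} (s≤s z≤n) n<81 E₀ e

    gen-low : ∀ n → E (pt (low n))
    gen-low n = E-plus {digit 0F n} {3 * digit 1F n} (≤-trans (digit<3 0F n) (≤ᵇ⇒≤ 3 81 _))
      (multiple<81 3 (≤ᵇ⇒≤ 3 27 _) (digit<3 1F n))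
      (subst (λ m → E (pt m)) (*-identityˡ (digit 0F n)) (E-digit 1 E₁ (E-double (≤ᵇ⇒≤ 2 81 _) E₁ refl) (digit<3 0F n)))
      (E-digit 3 E₃ (E-double (≤ᵇ⇒≤ 4 81 _) E₃ refl) (digit<3 1F n))

    gen-high : ∀ n → E (pt (high n))
    gen-high n = E-plus {9 * digit 2F n} {27 * digit 3F n} (multiple<81 9 (≤ᵇ⇒≤ 9 27 _) (digit<3 2F n))
      (multiple<81 27 (≤ᵇ⇒≤ 27 27 _) (digit<3 3F n))
      (E-digit 9 E₉ (E-double (≤ᵇ⇒≤ 10 81 _) E₉ refl) (digit<3 2F n))
      (E-digit 27 E₂₇ (E-double (≤ᵇ⇒≤ 28 81 _) E₂₇ refl) (digit<3 3F n))

  -- Every point is the sum of its digits times the basis vectors 1, 3, 9, 27, and the digit 2 is a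
  -- negation, that is `third 0`. So an affine basis generates the space under ∘.
  generated : ∀ x → E x
  generated x = subst E (trans (cong pt (decompose (toℕ x) (toℕ<n x))) (pt-toℕ x))
    (E-plus {low (toℕ x)} {high (toℕ x)} (plus<81 (digit 0F (toℕ x)) (3 * digit 1F (toℕ x)))
      (plus<81 (9 * digit 2F (toℕ x)) (27 * digit 3F (toℕ x))) (gen-low (toℕ x)) (gen-high (toℕ x)))

affine-unique : ∀ {u v} → IsAffine u → IsAffine v →
  u (pt 0) ≋ v (pt 0) → u (pt 1) ≋ v (pt 1) → u (pt 3) ≋ v (pt 3) → u (pt 9) ≋ v (pt 9) → u (pt 27) ≋ v (pt 27) →
  ∀ x → u x ≋ v x
affine-unique {u} {v} uA vA = generated (λ x → u x ≋ v x)
  λ {x} {y} p q → ≋-trans (uA x y) (≋-trans (*-≋ 2 (+-≋ p q)) (≋-sym (vA x y)))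

-- Hyperplanes pulled back along collineations.

value : Hyperplane → Point → ℕ
value (hyp w k _) x = eval (form 0 (toℕ (w 0F)) (toℕ (w 1F)) (toℕ (w 2F)) (toℕ (w 3F))) (toℕ x)

value-affine : ∀ H → IsAffine (value H)
value-affine (hyp w k _) = eval-∘ (form 0 (toℕ (w 0F)) (toℕ (w 1F)) (toℕ (w 2F)) (toℕ (w 3F)))

basisPoint : Fin 4 → Point
basisPoint = select (pt 1) (pt 3) (pt 9) (pt 27)

-- The increment of u from 0 to the basis point, with 2 in place of -1 modulo 3.
slope : (Point → ℕ) → Fin 4 → ℕ
slope u i = u (basisPoint i) + 2 * u (pt 0)

-- Both sides are affine, so `affine-unique` leaves only the five basis points; there k + (e + 2k) =
-- e + 3k.
affine-form : ∀ u → IsAffine u → ∀ x →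
  u x ≋ eval (form (u (pt 0)) (slope u 0F) (slope u 1F) (slope u 2F) (slope u 3F)) (toℕ x)
affine-form u uA = affine-unique {u} {λ x → eval F (toℕ x)} uA (eval-∘ F)
  (mk≋ (cong (_% 3) (at0 (u (pt 0)) (slope u 0F) (slope u 1F) (slope u 2F) (slope u 3F))))
  (≋-trans (+3*-≋ (u (pt 1)) (u (pt 0))) (mk≋ (cong (_% 3) (at1 (u (pt 0)) (u (pt 1)) (slope u 1F) (slope u 2F)
    (slope u 3F)))))
  (≋-trans (+3*-≋ (u (pt 3)) (u (pt 0))) (mk≋ (cong (_% 3) (at3 (u (pt 0)) (u (pt 3)) (slope u 0F) (slope u 2F)
    (slope u 3F)))))
  (≋-trans (+3*-≋ (u (pt 9)) (u (pt 0))) (mk≋ (cong (_% 3) (at9 (u (pt 0)) (u (pt 9)) (slope u 0F) (slope u 1F)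
    (slope u 3F)))))
  (≋-trans (+3*-≋ (u (pt 27)) (u (pt 0))) (mk≋ (cong (_% 3) (at27 (u (pt 0)) (u (pt 27)) (slope u 0F) (slope u 1F)
    (slope u 2F)))))
  where
  F = form (u (pt 0)) (slope u 0F) (slope u 1F) (slope u 2F) (slope u 3F)
  at0 : ∀ k a b c d → k ≡ k + (a * 0 + b * 0 + c * 0 + d * 0)
  at0 = solve-∀
  at1 : ∀ k e b c d → e + k * 3 ≡ k + ((e + 2 * k) * 1 + b * 0 + c * 0 + d * 0)
  at1 = solve-∀
  at3 : ∀ k e b c d → e + k * 3 ≡ k + (b * 0 + (e + 2 * k) * 1 + c * 0 + d * 0)
  at3 = solve-∀
  at9 : ∀ k e b c d → e + k * 3 ≡ k + (b * 0 + c * 0 + (e + 2 * k) * 1 + d * 0)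
  at9 = solve-∀
  at27 : ∀ k e b c d → e + k * 3 ≡ k + (b * 0 + c * 0 + d * 0 + (e + 2 * k) * 1)
  at27 = solve-∀

some-nonzero : ∀ (w : Fin 4 → Fin 3) → ¬ (∀ i → w i ≡ 0F) → ∃ λ i → w i ≢ 0F
some-nonzero w ¬vanishing with any? (λ i → ¬? (w i ≟F 0F))
... | yes p = p
... | no ¬p = contradiction (λ i → decidable-stable (w i ≟F 0F) (λ q → ¬p (i , q))) ¬vanishing

toℕ-mod3 : ∀ n → toℕ (n mod 3) ≡ n % 3
toℕ-mod3 n = toℕ-fromℕ< (m%n<n n 3)

module _ (g : Coll) (H : Hyperplane) where
  open Hyperplane H

  private
    u : Point → ℕ
    u x = value H (Coll.to g x)

    u-affine : IsAffine u
    u-affine x y = subst (λ p → value H p ≋ 2 * (u x + u y)) (sym (Coll.to-∘ g x y))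
      (value-affine H (Coll.to g x) (Coll.to g y))

    w′ : Fin 4 → Fin 3
    w′ i = slope u i mod 3

    linear : Point → ℕ
    linear x = eval (form 0 (toℕ (w′ 0F)) (toℕ (w′ 1F)) (toℕ (w′ 2F)) (toℕ (w′ 3F))) (toℕ x)

    u-linear : ∀ x → u x ≋ u (pt 0) + linear x
    u-linear x = ≋-trans (affine-form u u-affine x)
      (+-≋ (≋-refl {u (pt 0)}) (+-≋ (+-≋ (+-≋ (term 0F) (term 1F)) (term 2F)) (term 3F)))
      where
      term : ∀ i → slope u i * digit i (toℕ x) ≋ toℕ (w′ i) * digit i (toℕ x)
      term i = subst₂ _≋_ (*-comm (digit i (toℕ x)) (slope u i)) (*-comm (digit i (toℕ x)) (toℕ (w′ i)))
        (*-≋ (digit i (toℕ x)) (subst (slope u i ≋_) (sym (toℕ-mod3 (slope u i))) (≋-sym (%-≋ (slope u i)))))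

    vanishes : (∀ i → w′ i ≡ 0F) → ∀ x → u x ≋ u (pt 0)
    vanishes e x = ≋-trans (u-linear x) (subst (λ t → u (pt 0) + t ≋ u (pt 0))
      (sym (linear≡0 (e 0F) (e 1F) (e 2F) (e 3F)))
      (mk≋ (cong (_% 3) (+-identityʳ (u (pt 0))))))
      where
      linear≡0 : w′ 0F ≡ 0F → w′ 1F ≡ 0F → w′ 2F ≡ 0F → w′ 3F ≡ 0F → linear x ≡ 0
      linear≡0 p q r s rewrite p | q | r | s = refl

    value-basis : ∀ i → value H (basisPoint i) ≡ toℕ (w i)
    value-basis 0F = lemma (toℕ (w 0F)) (toℕ (w 1F)) (toℕ (w 2F)) (toℕ (w 3F))
      where lemma : ∀ a b c d → a * 1 + b * 0 + c * 0 + d * 0 ≡ a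
            lemma = solve-∀
    value-basis 1F = lemma (toℕ (w 0F)) (toℕ (w 1F)) (toℕ (w 2F)) (toℕ (w 3F))
      where lemma : ∀ a b c d → a * 0 + b * 1 + c * 0 + d * 0 ≡ b
            lemma = solve-∀
    value-basis 2F = lemma (toℕ (w 0F)) (toℕ (w 1F)) (toℕ (w 2F)) (toℕ (w 3F))
      where lemma : ∀ a b c d → a * 0 + b * 0 + c * 1 + d * 0 ≡ c
            lemma = solve-∀
    value-basis 3F = lemma (toℕ (w 0F)) (toℕ (w 1F)) (toℕ (w 2F)) (toℕ (w 3F))
      where lemma : ∀ a b c d → a * 0 + b * 0 + c * 0 + d * 1 ≡ d
            lemma = solve-∀

    value-origin : value H (pt 0) ≡ 0
    value-origin = lemma (toℕ (w 0F)) (toℕ (w 1F)) (toℕ (w 2F)) (toℕ (w 3F))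
      where lemma : ∀ a b c d → a * 0 + b * 0 + c * 0 + d * 0 ≡ 0
            lemma = solve-∀

    u-from : ∀ x → u (Coll.from g x) ≡ value H x
    u-from x = cong (value H) (Coll.to-from g x)

    -- If all pulled-back coefficients vanished, u would be constant, and so would `value H`,
    -- because g is onto. But `value H` is 0 at the origin and w i at the i-th basis point.
    not-vanishing : ¬ (∀ i → w′ i ≡ 0F)
    not-vanishing e with nonzero
    ... | i , wi≢0 = wi≢0 (toℕ-injective (trans (sym (m<n⇒m%n≡m (toℕ<n (w i)))) (mod≡ wi≋0)))
      where
      wi≋0 : toℕ (w i) ≋ 0
      wi≋0 = subst₂ _≋_ (trans (u-from (basisPoint i)) (value-basis i)) (trans (u-from (pt 0)) value-origin)
        (≋-trans (vanishes e (Coll.from g (basisPoint i))) (≋-sym (vanishes e (Coll.from g (pt 0)))))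

    nonzero′ : ∃ λ i → w′ i ≢ 0F
    nonzero′ = some-nonzero w′ not-vanishing

  -- A hyperplane is given by coefficients, so the invariance of the demicap condition needs
  -- explicit coefficients for its preimage. The pulled-back function has constant term `u (pt 0)`,
  -- which is moved to the level as k - u(0).
  preimage : Hyperplane
  preimage = hyp w′ ((toℕ k + 2 * u (pt 0)) mod 3) nonzero′

  ∈-preimage : ∀ x → Coll.to g x ∈H H → x ∈H preimage
  ∈-preimage x p = trans (mod≡ shifted) (sym (toℕ-mod3 (toℕ k + 2 * u (pt 0))))
    where
    u≋k : u x ≋ toℕ k
    u≋k = mk≋ (trans p (sym (m<n⇒m%n≡m (toℕ<n k))))
    shifted : linear x ≋ toℕ k + 2 * u (pt 0)
    shifted = ≋-trans (+3*-≋ (linear x) (u (pt 0)))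
      (subst (_≋ toℕ k + 2 * u (pt 0)) (rearrange (u (pt 0)) (linear x))
        (+-≋ (≋-trans (≋-sym (u-linear x)) u≋k) ≋-refl))
      where rearrange : ∀ a b → a + b + 2 * a ≡ b + a * 3
            rearrange = solve-∀

DemicapWith-act : ∀ g {a D} → DemicapWith a D → DemicapWith (Coll.from g a) (act g D)
DemicapWith-act g {a} {D} (cap , a∉ , size , closed , generic) =
  Cap-act g cap , ∉-act g a∉ , trans (∣act∣ g D) size , closed-act g closed ,
  λ (H , b , b∈ , diff , inH) → generic (preimage (inverse g) H , (λ i → to (b i)) , (λ i → ∈-act⁻ g (b∈ i)) ,
    (λ i j i≢j → (λ e → proj₁ (diff i j i≢j) (to-inj e)) ,
                 λ l → proj₂ (diff i j i≢j) (subst (IsLine (from a) (b i)) (from-to (b j)) (line-at-from g l))) ,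
    λ i → ∈-preimage (inverse g) H a (proj₁ (inH i)) ,
          ∈-preimage (inverse g) H (to (b i)) (subst (_∈H H) (sym (from-to (b i))) (proj₁ (proj₂ (inH i)))) ,
          λ c l → ∈-preimage (inverse g) H c (proj₂ (proj₂ (inH i)) (from c) (line-at-from g l)))
  where open Coll g

∪-act : ∀ g D D′ → act g (D ∪ D′) ≡ act g D ∪ act g D′
∪-act g D D′ = subset-antisym
  (λ x x∈ → x∈p∪q⁺ (⊎-map (∈-act⁺ g) (∈-act⁺ g) (x∈p∪q⁻ D D′ (∈-act⁻ g x∈))))
  (λ x x∈ → ∈-act⁺ g (x∈p∪q⁺ (⊎-map (∈-act⁻ g) (∈-act⁻ g) (x∈p∪q⁻ (act g D) (act g D′) x∈))))

Decomposition-act : ∀ g {C D D′} → Decomposition C D D′ → Decomposition (act g C) (act g D) (act g D′)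
Decomposition-act g {C} {D} {D′} ((a , d) , (a′ , d′) , dis , e) =
  (Coll.from g a , DemicapWith-act g d) , (Coll.from g a′ , DemicapWith-act g d′) , Disjoint-act g dis ,
  trans (cong (act g) e) (∪-act g D D′)

-- Invariance of the completion sets and of the whole statement.

sum-to : ∀ g (f : Point → ℕ) → sum (map (λ x → f (Coll.to g x)) (allFin 81)) ≡ sum (map f (allFin 81))
sum-to g f = trans (cong sum (map-∘ {g = f} {f = to} (allFin 81))) (sum-↭ (↭-map⁺ f permutation))
  where
  open Coll g
  permutation : map to (allFin 81) ↭ allFin 81
  permutation = ∼bag⇒↭ (unique∧set⇒bag (Unique-map⁺ to-inj (allFin⁺ 81)) (allFin⁺ 81)
    (λ {x} → mk⇔ (λ _ → ∈-allFin x) (λ _ → subst (_∈L map to (allFin 81)) (to-from x) (∈-map⁺ to (∈-allFin (from x))))))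

isYes-⇔ : ∀ {A B : Set} (a : Dec A) (b : Dec B) → (A → B) → (B → A) → ⌊ a ⌋ ≡ ⌊ b ⌋
isYes-⇔ a b f g = trans (isYes≗does a) (trans (does-⇔ (mk⇔ f g) a b) (sym (isYes≗does b)))

module _ {A : Set} (f : A → A) (xs : List A) (invariant : ∀ (F : A → ℕ) → sum (map (λ x → F (f x)) xs) ≡ sum (map F xs))
  where

  -- With the list of points a variable, the double sum stays symbolic; it is instantiated at the 81
  -- points only in `orderedCompletions-act`.
  double-sum-to : ∀ (F G : A → A → ℕ) → (∀ x y → F x y ≡ G (f x) (f y)) →
                  sum (map (λ x → sum (map (F x) xs)) xs) ≡ sum (map (λ x → sum (map (G x) xs)) xs)
  double-sum-to F G e = trans
    (cong sum (map-cong (λ x → trans (cong sum (map-cong (e x) xs)) (invariant (G (f x)))) xs))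
    (invariant (λ x → sum (map (G x) xs)))

orderedCompletions-act : ∀ g p S → orderedCompletions p (act g S) ≡ orderedCompletions (Coll.to g p) S
orderedCompletions-act g p S = double-sum-to (Coll.to g) (allFin 81) (sum-to g)
  (λ x y → if ⌊ (x ∈? act g S) ×-dec (y ∈? act g S) ×-dec isLine? p x y ⌋ then 1 else 0)
  (λ x y → if ⌊ (x ∈? S) ×-dec (y ∈? S) ×-dec isLine? (Coll.to g p) x y ⌋ then 1 else 0)
  (λ x y → cong (λ b → if b then 1 else 0) (isYes-⇔ ((x ∈? act g S) ×-dec (y ∈? act g S) ×-dec isLine? p x y)
      ((Coll.to g x ∈? S) ×-dec (Coll.to g y ∈? S) ×-dec isLine? (Coll.to g p) (Coll.to g x) (Coll.to g y))
      (λ (x∈ , y∈ , l) → ∈-act⁻ g x∈ , ∈-act⁻ g y∈ , line-to g l)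
      (λ (x∈ , y∈ , l) → ∈-act⁺ g x∈ , ∈-act⁺ g y∈ , line-from g l)))

completesExactlyOne-act⁻ : ∀ g {p S} → CompletesExactlyOne p (act g S) → CompletesExactlyOne (Coll.to g p) S
completesExactlyOne-act⁻ g {p} {S} (p∉ , e) = (λ p∈ → p∉ (∈-act⁺ g p∈)) , trans (sym (orderedCompletions-act g p S)) e

completesExactlyOne-act⁺ : ∀ g {p S} → CompletesExactlyOne (Coll.to g p) S → CompletesExactlyOne p (act g S)
completesExactlyOne-act⁺ g {p} {S} (p∉ , e) = (λ p∈ → p∉ (∈-act⁻ g p∈)) , trans (orderedCompletions-act g p S) e

lookup-completionSet : ∀ D D′ p → lookup (completionSet D D′) p ≡ ⌊ completesExactlyOne? p D ×-dec completesExactlyOne? p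
  D′ ⌋
lookup-completionSet D D′ p = lookup∘tabulate (λ p → ⌊ completesExactlyOne? p D ×-dec completesExactlyOne? p D′ ⌋) p

completionSet-act : ∀ g D D′ → completionSet (act g D) (act g D′) ≡ act g (completionSet D D′)
completionSet-act g D D′ = subset-ext λ p → trans (lookup-completionSet (act g D) (act g D′) p) (trans
  (isYes-⇔ (completesExactlyOne? p (act g D) ×-dec completesExactlyOne? p (act g D′))
           (completesExactlyOne? (Coll.to g p) D ×-dec completesExactlyOne? (Coll.to g p) D′)
           (λ (c , c′) → completesExactlyOne-act⁻ g c , completesExactlyOne-act⁻ g c′)
           (λ (c , c′) → completesExactlyOne-act⁺ g c , completesExactlyOne-act⁺ g c′))
  (sym (trans (lookup-act g (completionSet D D′) p) (lookup-completionSet D D′ (Coll.to g p)))))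

completionSet-comm : ∀ D D′ → completionSet D D′ ≡ completionSet D′ D
completionSet-comm D D′ = subset-ext λ p → trans (lookup-completionSet D D′ p) (trans
  (isYes-⇔ (completesExactlyOne? p D ×-dec completesExactlyOne? p D′)
    (completesExactlyOne? p D′ ×-dec completesExactlyOne? p D)
    (λ (c , c′) → c′ , c) (λ (c , c′) → c′ , c))
  (sym (lookup-completionSet D′ D p)))

Correspondence : PSet → Set
Correspondence C =
    ExactlyNUnordered 36 (Decomposition C)
    × ExactlyN 36 (λ C' → MaxCap C' × OneCompletable C C')
    × (∀ D D' → Decomposition C D D' →
    MaxCap (completionSet D D') × OneCompletable C (completionSet D D'))
    × (∀ D D' → completionSet D D' ≡ completionSet D' D)
    × (∀ D₁ D₁' D₂ D₂' → Decomposition C D₁ D₁' → Decomposition C D₂ D₂' →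
    completionSet D₁ D₁' ≡ completionSet D₂ D₂' → SamePair (D₁ , D₁') (D₂ , D₂'))
    × (∀ C' → MaxCap C' → OneCompletable C C' →
    ∃ λ D → ∃ λ D' → Decomposition C D D' × completionSet D D' ≡ C')

-- This reduces the theorem to a single cap. Lists and witnesses are pushed forward by g, while a
-- decomposition or a completable cap of `act g C` is first pulled back by the inverse.
Correspondence-act : ∀ g {C} → Correspondence C → Correspondence (act g C)
Correspondence-act g {C} ((L , L-len , L-distinct , L-dec , L-complete) , (M , M-len , M-! , M-one , M-complete) , image ,
  _ , inj , sur) =
  (map actPair L , trans (length-map actPair L) L-len
    , AllPairs-map⁺ (AllPairs.map (λ d s → d (SamePair-act⁻ g s)) L-distinct)
    , All-map⁺ (All.map (Decomposition-act g) L-dec)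
    , λ D D′ d → ⊎-map (mem D D′) (mem D′ D) (L-complete _ _ (back d)))
  , (map (act g) M , trans (length-map (act g) M) M-len , Unique-map⁺ (act-inj g) M-!
    , All-map⁺ (All.map (λ (m , o) → MaxCap-act g m , OneCompletable-act g o) M-one)
    , λ S (m , o) → subst (_∈L map (act g) M) (act-inverseˡ g S)
      (∈-map⁺ (act g) (M-complete _ (MaxCap-act g⁻¹ m , backOne o))))
  , (λ D D′ d → let m , o = image _ _ (back d) in
       subst (λ S → MaxCap S × OneCompletable (act g C) S) (completion D D′) (MaxCap-act g m , OneCompletable-act g o))
  , completionSet-comm
  , (λ D₁ D₁′ D₂ D₂′ d₁ d₂ e → SamePair-act⁻ g⁻¹ (inj _ _ _ _ (back d₁) (back d₂)
       (trans (completionSet-act g⁻¹ D₁ D₁′) (trans (cong (act g⁻¹) e) (sym (completionSet-act g⁻¹ D₂ D₂′))))))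
  , λ C′ m o → let D , D′ , d , e = sur _ (MaxCap-act g⁻¹ m) (backOne o) in
       act g D , act g D′ , Decomposition-act g d ,
       trans (completionSet-act g D D′) (trans (cong (act g) e) (act-inverseˡ g C′))
  where
  g⁻¹ = inverse g
  actPair : PSet × PSet → PSet × PSet
  actPair (D , D′) = act g D , act g D′
  mem : ∀ D D′ → (act g⁻¹ D , act g⁻¹ D′) ∈L L → (D , D′) ∈L map actPair L
  mem D D′ p = subst (_∈L map actPair L) (cong₂ _,_ (act-inverseˡ g D) (act-inverseˡ g D′)) (∈-map⁺ actPair p)
  back : ∀ {D D′} → Decomposition (act g C) D D′ → Decomposition C (act g⁻¹ D) (act g⁻¹ D′)
  back {D} {D′} d = subst (λ C → Decomposition C (act g⁻¹ D) (act g⁻¹ D′)) (act-inverseʳ g C) (Decomposition-act g⁻¹ d)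
  backOne : ∀ {S} → OneCompletable (act g C) S → OneCompletable C (act g⁻¹ S)
  backOne {S} o = subst (λ C → OneCompletable C (act g⁻¹ S)) (act-inverseʳ g C) (OneCompletable-act g⁻¹ o)
  completion : ∀ D D′ → act g (completionSet (act g⁻¹ D) (act g⁻¹ D′)) ≡ completionSet D D′
  completion D D′ = trans (cong (act g) (completionSet-act g⁻¹ D D′)) (act-inverseˡ g (completionSet D D′))

-- Points on hyperplanes

∑ : {A : Set} → List A → (A → ℕ) → ℕ
∑ []       f = 0
∑ (x ∷ xs) f = f x + ∑ xs f

module _ {A : Set} where

  ∑-cong : ∀ (xs : List A) {f g} → (∀ {x} → x ∈L xs → f x ≡ g x) → ∑ xs f ≡ ∑ xs g
  ∑-cong []       e = refl
  ∑-cong (x ∷ xs) e = cong₂ _+_ (e (here refl)) (∑-cong xs λ p → e (there p))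

  ∑-mono : ∀ (xs : List A) {f g} → (∀ {x} → x ∈L xs → f x ≤ g x) → ∑ xs f ≤ ∑ xs g
  ∑-mono []       e = z≤n
  ∑-mono (x ∷ xs) e = +-mono-≤ (e (here refl)) (∑-mono xs λ p → e (there p))

  ∑-+ : ∀ (xs : List A) f g → ∑ xs (λ x → f x + g x) ≡ ∑ xs f + ∑ xs g
  ∑-+ []       f g = refl
  ∑-+ (x ∷ xs) f g = trans (cong (f x + g x +_) (∑-+ xs f g)) (shuffle (f x) (g x) (∑ xs f) (∑ xs g))
    where shuffle : ∀ a b c d → a + b + (c + d) ≡ a + c + (b + d)
          shuffle = solve-∀

  ∑-* : ∀ c (xs : List A) f → ∑ xs (λ x → c * f x) ≡ c * ∑ xs f
  ∑-* c []       f = sym (*-zeroʳ c)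
  ∑-* c (x ∷ xs) f = trans (cong (c * f x +_) (∑-* c xs f)) (sym (*-distribˡ-+ c (f x) (∑ xs f)))

  ∑-const : ∀ c (xs : List A) → ∑ xs (λ _ → c) ≡ length xs * c
  ∑-const c []       = refl
  ∑-const c (x ∷ xs) = cong (c +_) (∑-const c xs)

∑-swap : ∀ {A B : Set} (xs : List A) (ys : List B) (f : A → B → ℕ) →
         ∑ xs (λ x → ∑ ys (f x)) ≡ ∑ ys (λ y → ∑ xs (λ x → f x y))
∑-swap []       ys f = sym (trans (∑-const 0 ys) (*-zeroʳ (length ys)))
∑-swap (x ∷ xs) ys f = trans (cong (∑ ys (f x) +_) (∑-swap xs ys f)) (sym (∑-+ ys (f x) (λ y → ∑ xs (λ x → f x y))))

∑-*-∑ : ∀ {A B : Set} (xs : List A) (ys : List B) f g → ∑ xs f * ∑ ys g ≡ ∑ xs (λ x → ∑ ys (λ y → f x * g y))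
∑-*-∑ xs ys f g = trans (*-comm (∑ xs f) (∑ ys g)) (trans (sym (∑-* (∑ ys g) xs f))
  (∑-cong xs λ {x} _ → trans (*-comm (∑ ys g) (f x)) (sym (∑-* (f x) ys g))))

δ : ℕ → ℕ → ℕ
δ m n = if m ≡ᵇ n then 1 else 0

∑-filterᵇ : ∀ {A : Set} (p : A → Bool) (xs : List A) f → ∑ xs (λ x → if p x then f x else 0) ≡ ∑ (filterᵇ p xs) f
∑-filterᵇ p []       f = refl
∑-filterᵇ p (x ∷ xs) f with p x
... | true  = cong (f x +_) (∑-filterᵇ p xs f)
... | false = ∑-filterᵇ p xs f

≡ᵇ-false : ∀ {m n} → m ≢ n → (m ≡ᵇ n) ≡ false
≡ᵇ-false {m} {n} m≢n with m ≡ᵇ n in e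
... | true  = contradiction (≡ᵇ-sound e) m≢n
... | false = refl

δ-refl : ∀ n → δ n n ≡ 1
δ-refl n rewrite ≡ᵇ-refl n = refl

δ-≢ : ∀ {m n} → m ≢ n → δ m n ≡ 0
δ-≢ m≢n rewrite ≡ᵇ-false m≢n = refl

δₚ : Point → Point → ℕ
δₚ x y = δ (toℕ x) (toℕ y)

δₚ-≢ : ∀ {x y} → x ≢ y → δₚ x y ≡ 0
δₚ-≢ x≢y = δ-≢ (λ e → x≢y (toℕ-injective e))

∑-δₚ-∉ : ∀ (xs : List Point) {x} → All (x ≢_) xs → ∑ xs (δₚ x) ≡ 0
∑-δₚ-∉ []       []          = refl
∑-δₚ-∉ (y ∷ xs) (x≢y ∷ x∉) = cong₂ _+_ (δₚ-≢ x≢y) (∑-δₚ-∉ xs x∉)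

∑-δₚ : ∀ {xs : List Point} → Unique xs → ∀ {x} → x ∈L xs → ∑ xs (δₚ x) ≡ 1
∑-δₚ {x ∷ xs} (x∉ ∷ u) (here refl) = cong₂ _+_ (δ-refl (toℕ x)) (∑-δₚ-∉ xs x∉)
∑-δₚ {y ∷ xs} (y∉ ∷ u) (there x∈)  = cong₂ _+_ (δₚ-≢ (λ e → All.lookup y∉ x∈ (sym e))) (∑-δₚ u x∈)

dot : ℕ → ℕ → ℕ
dot d x = eval (form 0 (digit 0F d) (digit 1F d) (digit 2F d) (digit 3F d)) x % 3

abstract
  -- Normal vectors up to sign: the codes whose highest nonzero digit is 1. They correspond to the
  -- 40 parallel classes of hyperplanes.
  directions : List ℕ
  directions = 1 ∷ 3 ∷ 4 ∷ 5 ∷ 9 ∷ 10 ∷ 11 ∷ 12 ∷ 13 ∷ 14 ∷ 15 ∷ 16 ∷ 17 ∷ 27 ∷ 28 ∷ 29 ∷ 30 ∷ 31 ∷ 32 ∷ 33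
    ∷ 34 ∷ 35 ∷ 36 ∷ 37 ∷ 38 ∷ 39 ∷ 40 ∷ 41 ∷ 42 ∷ 43 ∷ 44 ∷ 45 ∷ 46 ∷ 47 ∷ 48 ∷ 49 ∷ 50 ∷ 51 ∷ 52 ∷ 53 ∷ []

  length-directions : length directions ≡ 40
  length-directions = refl

  directions-valid : ∀ {d} → d ∈L directions → 0 < d × d < 81
  directions-valid d∈ = let p , q = ∧-true (All.lookup allValid d∈) in
    ≤ᵇ⇒≤ _ _ (Equivalence.from T-≡ p) , <ᵇ⇒< _ _ (Equivalence.from T-≡ q)
    where
    allValid : All (λ d → (1 ≤ᵇ d) ∧ (d <ᵇ 81) ≡ true) directions
    allValid = refl ∷ refl ∷ refl ∷ refl ∷ refl ∷ refl ∷ refl ∷ refl ∷ refl ∷ refl ∷ refl ∷ refl ∷ refl ∷ refl ∷ refl ∷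
      refl ∷ refl ∷ refl ∷ refl ∷ refl ∷ refl ∷ refl ∷ refl ∷ refl ∷ refl ∷ refl ∷ refl ∷ refl ∷ refl ∷ refl ∷ refl ∷ refl
      ∷ refl ∷ refl ∷ refl ∷ refl ∷ refl ∷ refl ∷ refl ∷ refl ∷ []

residues : List ℕ
residues = 0 ∷ 1 ∷ 2 ∷ []

dot-∘ : ∀ d x y → dot d (toℕ (x ∘ y)) ≡ (2 * (dot d (toℕ x) + dot d (toℕ y))) % 3
dot-∘ d x y = mod≡ (≋-trans (eval-∘ F x y) (*-≋ 2 (+-≋ (≋-sym (%-≋ (eval F (toℕ x)))) (≋-sym (%-≋ (eval F (toℕ y)))))))
  where F = form 0 (digit 0F d) (digit 1F d) (digit 2F d) (digit 3F d)

dot<3 : ∀ d x → dot d x < 3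
dot<3 d x = m%n<n (eval (form 0 (digit 0F d) (digit 1F d) (digit 2F d) (digit 3F d)) x) 3

origin : Point
origin = pt 0

dot-origin : ∀ d → dot d 0 ≡ 0
dot-origin d = cong (_% 3) (zeros (digit 0F d) (digit 1F d) (digit 2F d) (digit 3F d))
  where
  zeros : ∀ a b c d → a * 0 + b * 0 + c * 0 + d * 0 ≡ 0
  zeros = solve-∀

_⊖_ : Point → Point → Point
y ⊖ x = (origin ∘ y) ∘ x

dot-⊖ : ∀ d x y → δ (dot d (toℕ (y ⊖ x))) 0 ≡ δ (dot d (toℕ x)) (dot d (toℕ y))
dot-⊖ d x y = trans (cong (λ s → δ s 0) (trans (dot-∘ d (origin ∘ y) x)
    (cong (λ s → (2 * (s + dot d (toℕ x))) % 3) (trans (dot-∘ d origin y)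
      (cong (λ s → (2 * (s + dot d (toℕ y))) % 3) (dot-origin d))))))
  (lemma (dot<3 d (toℕ x)) (dot<3 d (toℕ y)))
  where
  check : ℕ → ℕ → Bool
  check a b = δ ((2 * ((2 * b) % 3 + a)) % 3) 0 ≡ᵇ δ a b
  lemma : ∀ {a b} → a < 3 → b < 3 → δ ((2 * ((2 * b) % 3 + a)) % 3) 0 ≡ δ a b
  lemma {a} p q = ≡ᵇ-sound (residues₂ check refl p q)

-- 40, 13 or 4 directions are orthogonal to the span of u and v, of dimension 0, 1 or 2.
orthogonalFormula : ℕ → ℕ → ℕ
orthogonalFormula u v = 4 + 9 * (δ u 0 + δ v 0 + δ u v + δ u 0 * δ v 0)

orthogonalTo : ℕ → List ℕ
orthogonalTo u = filterᵇ (λ d → dot d u ≡ᵇ 0) directions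

private
  tableEntry : ℕ → List ℕ → ℕ → Bool
  tableEntry u ds v = (v ≡ᵇ third 0 u) ∧ not (u ≡ᵇ 0) ∨ (∑ ds (λ d → δ (dot d v) 0) ≡ᵇ orthogonalFormula u v)

  tableRow : ℕ → List ℕ → Bool
  tableRow u ds = all< 81 (tableEntry u ds)

  tableCheck : ℕ → Bool
  tableCheck u = tableRow u (orthogonalTo u)

  abstract
    table-true : all< 81 tableCheck ≡ true
    table-true = refl

coord-origin : ∀ i → coord origin i ≡ 0
coord-origin 0F = refl
coord-origin 1F = refl
coord-origin 2F = refl
coord-origin 3F = refl

⊖-inj : ∀ x {y z} → y ⊖ x ≡ z ⊖ x → y ≡ z
⊖-inj x {y} {z} e = ∘-inj origin (∘-inj x (trans (∘-comm x (origin ∘ y)) (trans e (∘-comm (origin ∘ z) x))))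

⊖-self : ∀ x → x ⊖ x ≡ origin
⊖-self x = trans (cong (_∘ x) (∘-comm origin x)) (trans (∘-comm (x ∘ origin) x) (∘-invol x origin))

-- −(y − x) = (−x−y) − x in characteristic 3.
negate-⊖ : ∀ x y → origin ∘ (y ⊖ x) ≡ (x ∘ y) ⊖ x
negate-⊖ x y = point-ext λ i → trans (lhs i) (trans (lemma (coord<3 x i) (coord<3 y i)) (sym (rhs i)))
  where
  neg : ∀ z i → coord (origin ∘ z) i ≡ (2 * coord z i) % 3
  neg z i = trans (coord-∘ origin z i) (cong (λ s → (2 * (s + coord z i)) % 3) (coord-origin i))
  diff : ∀ z i → coord (z ⊖ x) i ≡ (2 * ((2 * coord z i) % 3 + coord x i)) % 3
  diff z i = trans (coord-∘ (origin ∘ z) x i) (cong (λ s → (2 * (s + coord x i)) % 3) (neg z i))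
  lhs : ∀ i → coord (origin ∘ (y ⊖ x)) i ≡ (2 * ((2 * ((2 * coord y i) % 3 + coord x i)) % 3)) % 3
  lhs i = trans (neg (y ⊖ x) i) (cong (λ s → (2 * s) % 3) (diff y i))
  rhs : ∀ i → coord ((x ∘ y) ⊖ x) i ≡ (2 * ((2 * ((2 * (coord x i + coord y i)) % 3)) % 3 + coord x i)) % 3
  rhs i = trans (diff (x ∘ y) i) (cong (λ s → (2 * ((2 * s) % 3 + coord x i)) % 3) (coord-∘ x y i))
  check : ℕ → ℕ → Bool
  check a b = (2 * ((2 * ((2 * b) % 3 + a)) % 3)) % 3 ≡ᵇ (2 * ((2 * ((2 * (a + b)) % 3)) % 3 + a)) % 3
  lemma : ∀ {a b} → a < 3 → b < 3 → (2 * ((2 * ((2 * b) % 3 + a)) % 3)) % 3 ≡ (2 * ((2 * ((2 * (a + b)) % 3)) % 3 + a)) %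
    3
  lemma {a} p q = ≡ᵇ-sound (residues₂ check refl p q)

δₚ-cong : ∀ {x y x′ y′} → (x ≡ y → x′ ≡ y′) → (x′ ≡ y′ → x ≡ y) → δₚ x y ≡ δₚ x′ y′
δₚ-cong {x} {y} {x′} {y′} f g with x ≟F y
... | yes refl rewrite f refl = trans (δ-refl (toℕ x)) (sym (δ-refl (toℕ y′)))
... | no  x≢y = trans (δₚ-≢ x≢y) (sym (δₚ-≢ (λ e → x≢y (g e))))

orthogonal-count : ∀ u v → ¬ (u ≢ origin × v ≡ origin ∘ u) →
  ∑ directions (λ d → δ (dot d (toℕ u)) 0 * δ (dot d (toℕ v)) 0)
  ≡ 4 + 9 * (δₚ u origin + δₚ v origin + δₚ u v + δₚ u origin * δₚ v origin)
orthogonal-count u v ¬line = trans (∑-cong directions λ {d} _ → product (dot d (toℕ u) ≡ᵇ 0) (δ (dot d (toℕ v)) 0))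
  (trans (∑-filterᵇ (λ d → dot d (toℕ u) ≡ᵇ 0) directions (λ d → δ (dot d (toℕ v)) 0)) tabulated)
  where
  product : ∀ b n → (if b then 1 else 0) * n ≡ (if b then n else 0)
  product true  n = +-identityʳ n
  product false n = refl
  resolve : ∀ {p q r} → p ∧ not q ∨ r ≡ true → ¬ (p ≡ true × q ≡ false) → r ≡ true
  resolve {false}        e h = e
  resolve {true} {true}  e h = e
  resolve {true} {false} e h = contradiction (refl , refl) h
  tabulated : ∑ (orthogonalTo (toℕ u)) (λ d → δ (dot d (toℕ v)) 0) ≡ orthogonalFormula (toℕ u) (toℕ v)
  tabulated = ≡ᵇ-sound (resolve {toℕ v ≡ᵇ third 0 (toℕ u)} {toℕ u ≡ᵇ 0}
    (all<-sound 81 (tableEntry (toℕ u) (orthogonalTo (toℕ u))) (all<-sound 81 tableCheck table-true (toℕ<n u)) (toℕ<n v))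
    λ (p , q) → ¬line ((λ { refl → contradiction q λ () }) , toℕ-injective (trans (≡ᵇ-sound p) (sym (toℕ-∘ origin u)))))

∑∑ : (ℕ → ℕ → ℕ) → ℕ
∑∑ F = ∑ directions λ d → ∑ residues λ k → F d k

∑∑-cong : ∀ {F G} → (∀ d k → F d k ≡ G d k) → ∑∑ F ≡ ∑∑ G
∑∑-cong e = ∑-cong directions λ {d} _ → ∑-cong residues λ {k} _ → e d k

∑∑-swap : ∀ {A : Set} (xs : List A) (g : ℕ → ℕ → A → ℕ) → ∑∑ (λ d k → ∑ xs (g d k)) ≡ ∑ xs (λ x → ∑∑ (λ d k → g d k x))
∑∑-swap xs g = trans (∑-cong directions λ {d} _ → ∑-swap residues xs (g d))
  (∑-swap directions xs (λ d x → ∑ residues (λ k → g d k x)))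

ind : Point → ℕ → ℕ → ℕ
ind x d k = δ (dot d (toℕ x)) k

-- Counts the hyperplanes through the three points. Summing over k leaves the directions that take
-- equal values at x, y and z, that is, those orthogonal to y - x and z - x. There are 4 for three
-- distinct points, 13 if exactly two coincide and 40 if all do.
incidence₃ : ∀ x y z → ¬ IsLine x y z →
  ∑∑ (λ d k → ind x d k * ind y d k * ind z d k) ≡ 4 + 9 * (δₚ x y + δₚ x z + δₚ y z + δₚ x y * δₚ x z)
incidence₃ x y z ¬l = begin
  ∑∑ (λ d k → ind x d k * ind y d k * ind z d k)
    ≡⟨ ∑-cong directions (λ {d} _ → lemma (dot<3 d (toℕ x)) (dot<3 d (toℕ y)) (dot<3 d (toℕ z))) ⟩
  ∑ directions (λ d → δ (dot d (toℕ x)) (dot d (toℕ y)) * δ (dot d (toℕ x)) (dot d (toℕ z)))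
    ≡⟨ ∑-cong directions (λ {d} _ → sym (cong₂ _*_ (dot-⊖ d x y) (dot-⊖ d x z))) ⟩
  ∑ directions (λ d → δ (dot d (toℕ (y ⊖ x))) 0 * δ (dot d (toℕ (z ⊖ x))) 0)
    ≡⟨ orthogonal-count (y ⊖ x) (z ⊖ x) ¬line ⟩
  4 + 9 * (δₚ (y ⊖ x) origin + δₚ (z ⊖ x) origin + δₚ (y ⊖ x) (z ⊖ x) + δₚ (y ⊖ x) origin * δₚ (z ⊖ x) origin)
    ≡⟨ cong₂ (λ s t → 4 + 9 * (s + t + δₚ (y ⊖ x) (z ⊖ x) + s * t)) (vanish y) (vanish z) ⟩
  4 + 9 * (δₚ x y + δₚ x z + δₚ (y ⊖ x) (z ⊖ x) + δₚ x y * δₚ x z)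
    ≡⟨ cong (λ s → 4 + 9 * (δₚ x y + δₚ x z + s + δₚ x y * δₚ x z)) (δₚ-cong (⊖-inj x) (cong (_⊖ x))) ⟩
  4 + 9 * (δₚ x y + δₚ x z + δₚ y z + δₚ x y * δₚ x z) ∎
  where
  open ≡-Reasoning
  check : ℕ → ℕ → ℕ → Bool
  check a b c = ∑ residues (λ k → δ a k * δ b k * δ c k) ≡ᵇ δ a b * δ a c
  lemma : ∀ {a b c} → a < 3 → b < 3 → c < 3 → ∑ residues (λ k → δ a k * δ b k * δ c k) ≡ δ a b * δ a c
  lemma {a} {b} p q r = ≡ᵇ-sound (residues₃ check refl p q r)
  vanish : ∀ y → δₚ (y ⊖ x) origin ≡ δₚ x y
  vanish y = δₚ-cong (λ e → sym (⊖-inj x (trans e (sym (⊖-self x))))) (λ { refl → ⊖-self x })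
  ¬line : ¬ (y ⊖ x ≢ origin × z ⊖ x ≡ origin ∘ (y ⊖ x))
  ¬line (p , q) = ¬l (subst (IsLine x y) (sym (⊖-inj x (trans q (negate-⊖ x y)))) (∘-line λ { refl → p (⊖-self x) }))

δₚ-idem : ∀ x y → δₚ x y * δₚ x y ≡ δₚ x y
δₚ-idem x y with toℕ x ≡ᵇ toℕ y
... | true  = refl
... | false = refl

module _ (xs : List Point) (xs-! : Unique xs) (xs-cap : ∀ {x y z} → x ∈L xs → y ∈L xs → z ∈L xs → ¬ IsLine x y z) where

  sectionSize : ℕ → ℕ → ℕ
  sectionSize d k = ∑ xs λ x → ind x d k

  private
    N = length xs

  private
    ind₂ : ℕ → ℕ → Point → Point → ℕ
    ind₂ d k x y = ind x d k * ind y d k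

    ind₃ : ℕ → ℕ → Point → Point → Point → ℕ
    ind₃ d k x y z = ind₂ d k x y * ind z d k

  -- Double counting of pairs of points with a hyperplane through both: distinct points have 13 in
  -- common, and a point lies on 40 = 13 + 27. The pair x, y is treated as the triple x, y, y.
  squares : ∑∑ (λ d k → sectionSize d k * sectionSize d k) ≡ 13 * N * N + 27 * N
  squares = begin
    ∑∑ (λ d k → sectionSize d k * sectionSize d k)
      ≡⟨ ∑∑-cong (λ d k → ∑-*-∑ xs xs (λ x → ind x d k) (λ y → ind y d k)) ⟩
    ∑∑ (λ d k → ∑ xs λ x → ∑ xs λ y → ind₂ d k x y)
      ≡⟨ ∑∑-swap xs (λ d k x → ∑ xs λ y → ind₂ d k x y) ⟩
    ∑ xs (λ x → ∑∑ (λ d k → ∑ xs λ y → ind₂ d k x y))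
      ≡⟨ ∑-cong xs (λ {x} x∈ → trans (∑∑-swap xs (λ d k → ind₂ d k x)) (inner x∈)) ⟩
    ∑ xs (λ _ → N * 13 + 27)
      ≡⟨ ∑-const (N * 13 + 27) xs ⟩
    N * (N * 13 + 27)
      ≡⟨ expand N ⟩
    13 * N * N + 27 * N ∎
    where
    open ≡-Reasoning
    expand : ∀ N → N * (N * 13 + 27) ≡ 13 * N * N + 27 * N
    expand = solve-∀
    idem : ∀ d k y → ind y d k ≡ ind y d k * ind y d k
    idem d k y with dot d (toℕ y) ≡ᵇ k
    ... | true  = refl
    ... | false = refl
    collect : ∀ s → 4 + 9 * (s + s + 1 + s) ≡ 13 + 27 * s
    collect = solve-∀
    pair : ∀ {x y} → x ∈L xs → y ∈L xs → ∑∑ (λ d k → ind₂ d k x y) ≡ 13 + 27 * δₚ x y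
    pair {x} {y} x∈ y∈ = begin
      ∑∑ (λ d k → ind₂ d k x y)
        ≡⟨ ∑∑-cong (λ d k → trans (cong (ind x d k *_) (idem d k y)) (sym (*-assoc (ind x d k) (ind y d k) (ind y d k))))
          ⟩
      ∑∑ (λ d k → ind₃ d k x y y)
        ≡⟨ incidence₃ x y y (xs-cap x∈ y∈ y∈) ⟩
      4 + 9 * (δₚ x y + δₚ x y + δₚ y y + δₚ x y * δₚ x y)
        ≡⟨ cong₂ (λ s t → 4 + 9 * (δₚ x y + δₚ x y + s + t)) (δ-refl (toℕ y)) (δₚ-idem x y) ⟩
      4 + 9 * (δₚ x y + δₚ x y + 1 + δₚ x y)
        ≡⟨ collect (δₚ x y) ⟩
      13 + 27 * δₚ x y ∎
    inner : ∀ {x} → x ∈L xs → ∑ xs (λ y → ∑∑ (λ d k → ind₂ d k x y)) ≡ N * 13 + 27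
    inner {x} x∈ = begin
      ∑ xs (λ y → ∑∑ (λ d k → ind₂ d k x y)) ≡⟨ ∑-cong xs (pair x∈) ⟩
      ∑ xs (λ y → 13 + 27 * δₚ x y)                  ≡⟨ ∑-+ xs (λ _ → 13) (λ y → 27 * δₚ x y) ⟩
      ∑ xs (λ _ → 13) + ∑ xs (λ y → 27 * δₚ x y)
        ≡⟨ cong₂ _+_ (∑-const 13 xs) (trans (∑-* 27 xs (δₚ x)) (cong (27 *_) (∑-δₚ xs-! x∈))) ⟩
      N * 13 + 27 ∎

  -- The same count with triples. This is where being a cap matters: a collinear triple of distinct
  -- points would lie on 13 hyperplanes instead of 4, and the total would depend on the number of
  -- such triples.
  cubes : ∑∑ (λ d k → sectionSize d k * sectionSize d k * sectionSize d k) ≡ 4 * N * N * N + 27 * N * N + 9 * N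
  cubes = begin
    ∑∑ (λ d k → sectionSize d k * sectionSize d k * sectionSize d k)
      ≡⟨ ∑∑-cong (λ d k → trans (cong (_* sectionSize d k) (∑-*-∑ xs xs (λ x → ind x d k) (λ y → ind y d k)))
           (cube d k)) ⟩
    ∑∑ (λ d k → ∑ xs λ x → ∑ xs λ y → ∑ xs λ z → ind₃ d k x y z)
      ≡⟨ ∑∑-swap xs (λ d k x → ∑ xs λ y → ∑ xs λ z → ind₃ d k x y z) ⟩
    ∑ xs (λ x → ∑∑ (λ d k → ∑ xs λ y → ∑ xs λ z → ind₃ d k x y z))
      ≡⟨ ∑-cong xs (λ {x} x∈ → trans (∑∑-swap xs (λ d k y → ∑ xs λ z → ind₃ d k x y z))
           (∑-cong xs λ {y} y∈ → trans (∑∑-swap xs (λ d k → ind₃ d k x y)) (inner x∈ y∈))) ⟩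
    ∑ xs (λ x → ∑ xs (λ y → N * 4 + 18 + 9 * (N + 1) * δₚ x y))
      ≡⟨ ∑-cong xs (λ {x} x∈ → trans (∑-+ xs (λ _ → N * 4 + 18) (λ y → 9 * (N + 1) * δₚ x y))
           (cong₂ _+_ (∑-const (N * 4 + 18) xs) (trans (∑-* (9 * (N + 1)) xs (δₚ x))
             (cong (9 * (N + 1) *_) (∑-δₚ xs-! x∈))))) ⟩
    ∑ xs (λ x → N * (N * 4 + 18) + 9 * (N + 1) * 1)
      ≡⟨ ∑-const (N * (N * 4 + 18) + 9 * (N + 1) * 1) xs ⟩
    N * (N * (N * 4 + 18) + 9 * (N + 1) * 1)
      ≡⟨ expand N ⟩
    4 * N * N * N + 27 * N * N + 9 * N ∎
    where
    open ≡-Reasoning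
    expand : ∀ N → N * (N * (N * 4 + 18) + 9 * (N + 1) * 1) ≡ 4 * N * N * N + 27 * N * N + 9 * N
    expand = solve-∀
    cube : ∀ d k → ∑ xs (λ x → ∑ xs λ y → ind₂ d k x y) * sectionSize d k
                 ≡ ∑ xs λ x → ∑ xs λ y → ∑ xs λ z → ind₃ d k x y z
    cube d k = begin
      ∑ xs (λ x → ∑ xs λ y → ind₂ d k x y) * sectionSize d k
        ≡⟨ ∑-*-∑ xs xs (λ x → ∑ xs λ y → ind₂ d k x y) (λ z → ind z d k) ⟩
      ∑ xs (λ x → ∑ xs λ z → ∑ xs (λ y → ind₂ d k x y) * ind z d k)
        ≡⟨ ∑-cong xs (λ {x} _ → trans (∑-cong xs λ {z} _ → trans (*-comm (∑ xs (λ y → ind₂ d k x y)) (ind z d k))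
             (trans (sym (∑-* (ind z d k) xs (λ y → ind₂ d k x y)))
               (∑-cong xs λ {y} _ → *-comm (ind z d k) (ind₂ d k x y))))
             (∑-swap xs xs (λ z y → ind₃ d k x y z))) ⟩
      ∑ xs (λ x → ∑ xs λ y → ∑ xs λ z → ind₃ d k x y z) ∎
    collect : ∀ s N → N * (4 + 9 * s) + 9 * (1 + 1 + s * 1) ≡ N * 4 + 18 + 9 * (N + 1) * s
    collect = solve-∀
    split : ∀ s t u → 4 + 9 * (s + t + u + s * t) ≡ 4 + 9 * s + 9 * (t + u + s * t)
    split = solve-∀
    inner : ∀ {x y} → x ∈L xs → y ∈L xs →
            ∑ xs (λ z → ∑∑ (λ d k → ind₃ d k x y z)) ≡ N * 4 + 18 + 9 * (N + 1) * δₚ x y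
    inner {x} {y} x∈ y∈ = begin
      ∑ xs (λ z → ∑∑ (λ d k → ind₃ d k x y z))
        ≡⟨ ∑-cong xs (λ {z} z∈ → trans (incidence₃ x y z (xs-cap x∈ y∈ z∈)) (split (δₚ x y) (δₚ x z) (δₚ y z))) ⟩
      ∑ xs (λ z → 4 + 9 * δₚ x y + 9 * (δₚ x z + δₚ y z + δₚ x y * δₚ x z))
        ≡⟨ ∑-+ xs (λ _ → 4 + 9 * δₚ x y) (λ z → 9 * (δₚ x z + δₚ y z + δₚ x y * δₚ x z)) ⟩
      ∑ xs (λ z → 4 + 9 * δₚ x y) + ∑ xs (λ z → 9 * (δₚ x z + δₚ y z + δₚ x y * δₚ x z))
        ≡⟨ cong₂ _+_ (∑-const (4 + 9 * δₚ x y) xs) (trans (∑-* 9 xs (λ z → δₚ x z + δₚ y z + δₚ x y * δₚ x z))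
          (cong (9 *_) sums)) ⟩
      N * (4 + 9 * δₚ x y) + 9 * (1 + 1 + δₚ x y * 1)
        ≡⟨ collect (δₚ x y) N ⟩
      N * 4 + 18 + 9 * (N + 1) * δₚ x y ∎
      where
      sums : ∑ xs (λ z → δₚ x z + δₚ y z + δₚ x y * δₚ x z) ≡ 1 + 1 + δₚ x y * 1
      sums = trans (∑-+ xs (λ z → δₚ x z + δₚ y z) (λ z → δₚ x y * δₚ x z))
        (cong₂ _+_ (trans (∑-+ xs (δₚ x) (δₚ y)) (cong₂ _+_ (∑-δₚ xs-! x∈) (∑-δₚ xs-! y∈)))
                   (trans (∑-* (δₚ x y) xs (δₚ x)) (cong (δₚ x y *_) (∑-δₚ xs-! x∈))))

  parallel-class : ∀ d → ∑ residues (sectionSize d) ≡ N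
  parallel-class d = trans (∑-swap residues xs (λ k x → ind x d k))
    (trans (∑-cong xs λ {x} _ → lemma (dot<3 d (toℕ x))) (trans (∑-const 1 xs) (*-identityʳ N)))
    where
    lemma : ∀ {a} → a < 3 → ∑ residues (δ a) ≡ 1
    lemma p = ≡ᵇ-sound (all<-sound 3 (λ a → ∑ residues (δ a) ≡ᵇ 1) refl p)

  -- With all sections of size at most 8, each parallel class satisfies 19 Σn² ≤ Σn³ + 1648,
  -- which fails after summing over the 40 classes: 19 · 5740 > 42980 + 40 · 1648.
  exists-9-section : N ≡ 20 → ∃ λ d → d ∈L directions × ∃ λ k → k < 3 × 9 ≤ sectionSize d k
  exists-9-section N≡20 with Any.any? (λ d → (9 ≤? sectionSize d 0) ⊎-dec (9 ≤? sectionSize d 1) ⊎-dec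
    (9 ≤? sectionSize d 2)) directions
  ... | yes p with find p
  ...   | d , d∈ , inj₁ q        = d , d∈ , 0 , s≤s z≤n , q
  ...   | d , d∈ , inj₂ (inj₁ q) = d , d∈ , 1 , s≤s (s≤s z≤n) , q
  ...   | d , d∈ , inj₂ (inj₂ q) = d , d∈ , 2 , s≤s (s≤s (s≤s z≤n)) , q
  exists-9-section N≡20 | no ¬p = ⊥-elim (≤⇒≤ᵇ total)
    where
    sq cu : ℕ → ℕ
    sq d = ∑ residues (λ k → sectionSize d k * sectionSize d k)
    cu d = ∑ residues (λ k → sectionSize d k * sectionSize d k * sectionSize d k)
    check : ℕ → ℕ → ℕ → Bool
    check a b c = not (a + (b + (c + 0)) ≡ᵇ 20) ∨
      (19 * (a * a + (b * b + (c * c + 0))) ≤ᵇ a * a * a + (b * b * b + (c * c * c + 0)) + 1648)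
    lemma : ∀ {a b c} → a < 9 → b < 9 → c < 9 → a + (b + (c + 0)) ≡ 20 →
      19 * (a * a + (b * b + (c * c + 0))) ≤ a * a * a + (b * b * b + (c * c * c + 0)) + 1648
    lemma {a} {b} {c} p q r e = ≤ᵇ⇒≤ _ _ (Equivalence.from T-≡ (subst (λ t → not (t ≡ᵇ 20) ∨
        (19 * (a * a + (b * b + (c * c + 0))) ≤ᵇ a * a * a + (b * b * b + (c * c * c + 0)) + 1648) ≡ true) e
      (all<-sound 9 (check a b) (all<-sound 9 (λ b → all< 9 (check a b))
        (all<-sound 9 (λ a → all< 9 λ b → all< 9 (check a b)) refl p) q) r)))
    class : ∀ {d} → d ∈L directions → 19 * sq d ≤ cu d + 1648
    class {d} d∈ = lemma (≰⇒> (λ q → ¬p (lose d∈ (inj₁ q)))) (≰⇒> (λ q → ¬p (lose d∈ (inj₂ (inj₁ q)))))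
      (≰⇒> (λ q → ¬p (lose d∈ (inj₂ (inj₂ q))))) (trans (parallel-class d) N≡20)
    sq-total : ∑ directions sq ≡ 5740
    sq-total = trans squares (cong (λ N → 13 * N * N + 27 * N) N≡20)
    cu-total : ∑ directions cu ≡ 42980
    cu-total = trans cubes (cong (λ N → 4 * N * N * N + 27 * N * N + 9 * N) N≡20)
    summed : 19 * ∑ directions sq ≤ ∑ directions cu + 40 * 1648
    summed = subst₂ _≤_ (∑-* 19 directions sq)
      (trans (∑-+ directions cu (λ _ → 1648)) (cong (∑ directions cu +_)
        (trans (∑-const 1648 directions) (cong (_* 1648) length-directions))))
      (∑-mono directions class)
    total : 19 * 5740 ≤ 42980 + 40 * 1648
    total = subst₂ (λ s t → 19 * s ≤ t + 40 * 1648) sq-total cu-total summed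

-- Exhaustive search

mem : ℕ → List ℕ → Bool
mem x []       = false
mem x (y ∷ ys) = if x ≡ᵇ y then true else mem x ys

mem-sound : ∀ {x} ys → mem x ys ≡ true → x ∈L ys
mem-sound {x} (y ∷ ys) e with x ≡ᵇ y in eq
... | true  = here (≡ᵇ-sound eq)
... | false = there (mem-sound ys e)

mem-complete : ∀ {x ys} → x ∈L ys → mem x ys ≡ true
mem-complete {x} (here refl) rewrite ≡ᵇ-refl x = refl
mem-complete {x} {y ∷ ys} (there x∈) with x ≡ᵇ y
... | true  = refl
... | false = mem-complete x∈

any-sound : ∀ {A : Set} (p : A → Bool) xs → any p xs ≡ true → ∃ λ x → x ∈L xs × p x ≡ true
any-sound p xs e = let x , x∈ , t = find (any⁻ p xs (Equivalence.from T-≡ e)) in x , x∈ , Equivalence.to T-≡ t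

any-complete : ∀ {A : Set} (p : A → Bool) xs {x} → x ∈L xs → p x ≡ true → any p xs ≡ true
any-complete p xs x∈ e = Equivalence.to T-≡ (any⁺ p (lose x∈ (Equivalence.from T-≡ e)))

all-sound : ∀ {A : Set} (p : A → Bool) xs → all p xs ≡ true → ∀ {x} → x ∈L xs → p x ≡ true
all-sound p xs e x∈ = Equivalence.to T-≡ (All.lookup (all⁺ p xs (Equivalence.from T-≡ e)) x∈)

∈-filterᵇ⁺ : ∀ {A : Set} (p : A → Bool) {x} xs → x ∈L xs → p x ≡ true → x ∈L filterᵇ p xs
∈-filterᵇ⁺ p xs x∈ e = ∈-filter⁺ (λ x → T? (p x)) x∈ (Equivalence.from T-≡ e)

∈-filterᵇ⁻ : ∀ {A : Set} (p : A → Bool) {x} xs → x ∈L filterᵇ p xs → x ∈L xs × p x ≡ true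
∈-filterᵇ⁻ p xs x∈ = let q , t = ∈-filter⁻ (λ x → T? (p x)) {xs = xs} x∈ in q , Equivalence.to T-≡ t

remove : List ℕ → List ℕ → List ℕ
remove f []       = []
remove f (z ∷ zs) = if mem z f then remove f zs else z ∷ remove f zs

length-remove : ∀ f xs → length (remove f xs) ≤ length xs
length-remove f []       = z≤n
length-remove f (x ∷ xs) with mem x f
... | true  = m≤n⇒m≤1+n (length-remove f xs)
... | false = s≤s (length-remove f xs)

atLeast : ℕ → List ℕ → Bool
atLeast zero    _        = true
atLeast (suc k) []       = false
atLeast (suc k) (_ ∷ xs) = atLeast k xs

length-filterᵇ≤ : ∀ (p : ℕ → Bool) xs {k} → k ≤ length (filterᵇ p xs) → atLeast k xs ≡ true
length-filterᵇ≤ p xs       {zero}  _ = refl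
length-filterᵇ≤ p (x ∷ xs) {suc k} h with p x
... | true  = length-filterᵇ≤ p xs (s≤s⁻¹ h)
... | false = length-filterᵇ≤ p xs (≤-trans (m≤n⇒m≤1+n ≤-refl) h)

filterᵇ-remove : ∀ (p : ℕ → Bool) f → (∀ {z} → z ∈L f → p z ≡ false) → ∀ xs → filterᵇ p (remove f xs) ≡ filterᵇ p xs
filterᵇ-remove p f h []       = refl
filterᵇ-remove p f h (x ∷ xs) with mem x f in eq
... | true rewrite h (mem-sound f eq) = filterᵇ-remove p f h xs
... | false with p x
...   | true  = cong (x ∷_) (filterᵇ-remove p f h xs)
...   | false = filterᵇ-remove p f h xs

-- search n chosen undecided k lists the ways of extending the chosen points by at least k of the
-- undecided ones without meeting a forbidden point; n bounds the recursion.
module _ (forbidden : ℕ → List ℕ → List ℕ) where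

  search : ℕ → List ℕ → List ℕ → ℕ → List (List ℕ)
  search n       chosen []       zero    = [] ∷ []
  search n       chosen []       (suc k) = []
  search zero    chosen (x ∷ xs) k       = []
  search (suc n) chosen (x ∷ xs) k       =
    if atLeast k (x ∷ xs)
    then map (x ∷_) (search n (x ∷ chosen) (remove (forbidden x chosen) xs) (k ∸ 1)) ++ search n chosen xs k
    else []

  searchFrom : ℕ → List ℕ → List ℕ → List ℕ → ℕ → List (List ℕ)
  searchFrom n chosen []           xs k = search n chosen xs k
  searchFrom n chosen (x ∷ prefix) xs k = searchFrom n (x ∷ chosen) prefix (remove (forbidden x chosen) xs) k

  module _ (p : ℕ → Bool)
           (forbidden-sound : ∀ {x chosen} → p x ≡ true → All (λ c → p c ≡ true) chosen →
                              ∀ {z} → z ∈L forbidden x chosen → p z ≡ false) where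

    -- One follows the branch that chooses x exactly when p x holds. Forbidden points fail p, so
    -- removing them leaves the p-part of the remaining list unchanged, and it is this part that the
    -- branch returns.
    search-complete : ∀ n {chosen} xs k → length xs ≤ n → All (λ c → p c ≡ true) chosen →
      k ≤ length (filterᵇ p xs) → filterᵇ p xs ∈L search n chosen xs k
    search-complete n []       zero _ _ _ = here refl
    search-complete (suc n) {chosen} (x ∷ xs) k fuel pc h rewrite length-filterᵇ≤ p (x ∷ xs) h
      with p x in eq
    ... | true  = ∈-++⁺ˡ (∈-map⁺ (x ∷_) (subst (_∈L search n (x ∷ chosen) (remove (forbidden x chosen) xs) (k ∸ 1)) same
                    (search-complete n (remove (forbidden x chosen) xs) (k ∸ 1)
                      (≤-trans (length-remove (forbidden x chosen) xs) (s≤s⁻¹ fuel))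
                      (eq ∷ pc) (subst (λ l → k ∸ 1 ≤ length l) (sym same) (pred-≤ h)))))
      where
      same = filterᵇ-remove p (forbidden x chosen) (forbidden-sound eq pc) xs
      pred-≤ : ∀ {k m} → k ≤ suc m → k ∸ 1 ≤ m
      pred-≤ {zero}  _ = z≤n
      pred-≤ {suc k} h = s≤s⁻¹ h
    ... | false = ∈-++⁺ʳ (map (x ∷_) (search n (x ∷ chosen) (remove (forbidden x chosen) xs) (k ∸ 1)))
                    (search-complete n xs k (s≤s⁻¹ fuel) pc h)

    searchFrom-complete : ∀ n {chosen} prefix xs k → length xs ≤ n → All (λ c → p c ≡ true) chosen → All
      (λ c → p c ≡ true) prefix →
      k ≤ length (filterᵇ p xs) → filterᵇ p xs ∈L searchFrom n chosen prefix xs k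
    searchFrom-complete n [] xs k fuel pc [] h = search-complete n xs k fuel pc h
    searchFrom-complete n {chosen} (x ∷ prefix) xs k fuel pc (px ∷ pp) h =
      subst (_∈L searchFrom n (x ∷ chosen) prefix (remove (forbidden x chosen) xs) k) same
        (searchFrom-complete n prefix (remove (forbidden x chosen) xs) k
          (≤-trans (length-remove (forbidden x chosen) xs) fuel)
          (px ∷ pc) pp (subst (λ l → k ≤ length l) (sym same) h))
      where same = filterᵇ-remove p (forbidden x chosen) (forbidden-sound px pc) xs

    searchFrom-all : ∀ n test prefix xs k → all test (searchFrom n [] prefix xs k) ≡ true → length xs ≤ n →
      All (λ c → p c ≡ true) prefix → k ≤ length (filterᵇ p xs) → test (filterᵇ p xs) ≡ true
    searchFrom-all n test prefix xs k e fuel pp h =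
      all-sound test (searchFrom n [] prefix xs k) e (searchFrom-complete n prefix xs k fuel [] pp h)

_iff_ : Bool → Bool → Bool
true  iff b = b
false iff b = not b

-- Sends the affine basis 0, 1, 3, 9, 27 to p₀, …, p₄.
basisMap : ℕ → ℕ → ℕ → ℕ → ℕ → Affine
basisMap p₀ p₁ p₂ p₃ p₄ = affine (row 0F) (row 1F) (row 2F) (row 3F)
  where
  row : Fin 4 → Form
  row i = form (digit i p₀) (digit i p₁ + 2 * digit i p₀) (digit i p₂ + 2 * digit i p₀)
               (digit i p₃ + 2 * digit i p₀) (digit i p₄ + 2 * digit i p₀)

-- The point c = x is skipped: `third x x` is x itself, which is not a third point of any line.
lineForbidden : ℕ → List ℕ → List ℕ
lineForbidden x chosen = map (third x) (filterᵇ (λ c → not (x ≡ᵇ c)) chosen)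

low high : List ℕ
low  = upTo 27
high = map (27 +_) (downFrom 54)

-- A point {b, −b} of PG(3,3) is represented by the smaller of its two codes.
neg rep : ℕ → ℕ
neg n = third 0 n
rep n = if n <ᵇ neg n then n else neg n

double : List ℕ → List ℕ
double L = L ++ map neg L

-- The 20-cap shifted, translated so that its anchor 39 becomes 0, is the double cover of this elliptic quadric of PG(3,3).
ovoid : List ℕ
ovoid  = 12 ∷ 28 ∷ 30 ∷ 32 ∷ 34 ∷ 36 ∷ 38 ∷ 39 ∷ 41 ∷ 46 ∷ []

-- The nine affine points of an elliptic quadric, in the hyperplane x₃ = 0.
quadric : List ℕ
quadric = 0 ∷ 1 ∷ 3 ∷ 4 ∷ 9 ∷ 10 ∷ 14 ∷ 17 ∷ 23 ∷ []

shifted : List ℕ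
shifted = 0 ∷ 1 ∷ 3 ∷ 4 ∷ 9 ∷ 10 ∷ 14 ∷ 17 ∷ 23 ∷ 27 ∷ 51 ∷ 58 ∷ 64 ∷ 67 ∷ 69 ∷ 71 ∷ 75 ∷ 77 ∷ 78 ∷ 80 ∷ []

carriesLow : List ℕ → Affine → Bool
carriesLow L A = all< 27 (λ c → (apply A c <ᵇ 27) ∧ (mem (apply A c) L iff mem c quadric)) ∧ isInjective A

module _ (L : List ℕ) where
  -- The basis points 0, 1, 3, 9 belong to `quadric`, so their images only need to be sought in L.
  -- Sending 27 to 27 + p₀ keeps the fourth coordinate direction. In the full search 27 belongs to
  -- `shifted`, and its image is sought in L as well.
  low₃ : ℕ → ℕ → ℕ → ℕ → Bool
  low₃ p₀ p₁ p₂ p₃ = carriesLow L (basisMap p₀ p₁ p₂ p₃ (27 + p₀))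
  low₂ : ℕ → ℕ → ℕ → Bool
  low₂ p₀ p₁ p₂ = any (low₃ p₀ p₁ p₂) L
  low₁ : ℕ → ℕ → Bool
  low₁ p₀ p₁ = not (p₀ ≡ᵇ p₁) ∧ any (low₂ p₀ p₁) L
  low₀ : ℕ → Bool
  low₀ p₀ = any (low₁ p₀) L

lowExtension : List ℕ → List ℕ
lowExtension L = 0 ∷ 1 ∷ 3 ∷ L

testLow : List ℕ → Bool
testLow L = any (low₀ (lowExtension L)) (lowExtension L)

undecidedLow : List ℕ
undecidedLow = remove (0 ∷ 1 ∷ 3 ∷ []) low

carriesFull : List ℕ → Affine → Bool
carriesFull L A = all< 81 (λ c → mem (apply A c) L iff mem c shifted) ∧ isInjective A

module _ (L : List ℕ) where
  full₄ : ℕ → ℕ → ℕ → ℕ → ℕ → Bool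
  full₄ p₀ p₁ p₂ p₃ p₄ = carriesFull L (basisMap p₀ p₁ p₂ p₃ p₄)
  full₃ : ℕ → ℕ → ℕ → ℕ → Bool
  full₃ p₀ p₁ p₂ p₃ = any (full₄ p₀ p₁ p₂ p₃) L
  full₂ : ℕ → ℕ → ℕ → Bool
  full₂ p₀ p₁ p₂ = not (mem p₂ (p₀ ∷ p₁ ∷ [])) ∧ any (full₃ p₀ p₁ p₂) L
  full₁ : ℕ → ℕ → Bool
  full₁ p₀ p₁ = not (p₀ ≡ᵇ p₁) ∧ any (full₂ p₀ p₁) L
  full₀ : ℕ → Bool
  full₀ p₀ = any (full₁ p₀) L

fullExtension : List ℕ → List ℕ
fullExtension L = quadric ++ 27 ∷ L

testFull : List ℕ → Bool
testFull L = any (full₀ (fullExtension L)) (fullExtension L)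

undecidedFull : List ℕ
undecidedFull = remove (27 ∷ []) high

module _ (p : ℕ → Bool)
         (sound : ∀ {x chosen} → p x ≡ true → All (λ c → p c ≡ true) chosen →
                  ∀ {z} → z ∈L lineForbidden x chosen → p z ≡ false) where

  abstract
    -- Neither evaluation depends on p, so `refl` settles each search once for all caps. The bounds
    -- 6 and 10 are what remains of 9 and 20 points after the 3 and the 9 + 1 points already placed.
    lowSearch : All (λ c → p c ≡ true) (0 ∷ 1 ∷ 3 ∷ []) → 6 ≤ length (filterᵇ p undecidedLow) →
                testLow (filterᵇ p undecidedLow) ≡ true
    lowSearch = searchFrom-all lineForbidden p sound 24 testLow (0 ∷ 1 ∷ 3 ∷ []) undecidedLow 6 refl (≤ᵇ⇒≤ 24 24 _)

    fullSearch : All (λ c → p c ≡ true) (27 ∷ quadric) → 10 ≤ length (filterᵇ p undecidedFull) →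
                 testFull (filterᵇ p undecidedFull) ≡ true
    fullSearch = searchFrom-all lineForbidden p sound 53 testFull (27 ∷ quadric) undecidedFull 10 refl (≤ᵇ⇒≤ 53 53 _)

-- Classification of the 20-caps

<⇒<ᵇ-true : ∀ {m n} → m < n → (m <ᵇ n) ≡ true
<⇒<ᵇ-true m<n = Equivalence.to T-≡ (<⇒<ᵇ m<n)

<ᵇ-true⇒< : ∀ {m n} → (m <ᵇ n) ≡ true → m < n
<ᵇ-true⇒< {m} {n} e = <ᵇ⇒< m n (Equivalence.from T-≡ e)

abstract
  fromCodes : List ℕ → PSet
  fromCodes L = tabulate λ x → mem (toℕ x) L

  lookup-fromCodes : ∀ L x → lookup (fromCodes L) x ≡ mem (toℕ x) L
  lookup-fromCodes L x = lookup∘tabulate (λ x → mem (toℕ x) L) x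

abstract
  χ : PSet → ℕ → Bool
  χ C n = (n <ᵇ 81) ∧ lookup C (pt n)

  χ-< : ∀ C {n} → χ C n ≡ true → n < 81
  χ-< C e = <ᵇ-true⇒< (proj₁ (∧-true e))

  χ-∈ : ∀ C {n} → χ C n ≡ true → pt n ∈ C
  χ-∈ C {n} e = lookup-∈ (proj₂ (∧-true {n <ᵇ 81} e))

  χ-lookup : ∀ C {n} → n < 81 → χ C n ≡ lookup C (pt n)
  χ-lookup C {n} n<81 = cong (_∧ lookup C (pt n)) (<⇒<ᵇ-true n<81)

χ-toℕ : ∀ C x → χ C (toℕ x) ≡ lookup C x
χ-toℕ C x = trans (χ-lookup C (toℕ<n x)) (cong (lookup C) (pt-toℕ x))

∈-χ : ∀ C {x} → x ∈ C → χ C (toℕ x) ≡ true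
∈-χ C {x} p = trans (χ-toℕ C x) (∈-lookup p)

χ-ext : ∀ {C} L → (∀ {n} → n < 81 → χ C n ≡ mem n L) → C ≡ fromCodes L
χ-ext {C} L e = subset-ext λ x → trans (sym (χ-toℕ C x)) (trans (e (toℕ<n x)) (sym (lookup-fromCodes L x)))

χ-act : ∀ A inj C {n} → n < 81 → χ (act (affineColl A inj) C) n ≡ χ C (apply A n)
χ-act A inj C {n} n<81 = begin
  χ (act g C) n                         ≡⟨ χ-lookup (act g C) n<81 ⟩
  lookup (act g C) (pt n)               ≡⟨ lookup-act g C (pt n) ⟩
  lookup C (Coll.to g (pt n))           ≡⟨ cong (lookup C) (to-affineColl A inj (pt n)) ⟩
  lookup C (pt (apply A (toℕ (pt n))))  ≡⟨ cong (λ m → lookup C (pt (apply A m))) (toℕ-pt n<81) ⟩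
  lookup C (pt (apply A n))             ≡⟨ χ-lookup C (apply<81 A n) ⟨
  χ C (apply A n)                       ∎
  where
  open ≡-Reasoning
  g = affineColl A inj

lineForbidden-sound : ∀ {C} → Cap C → ∀ {x chosen} → χ C x ≡ true → All (λ c → χ C c ≡ true) chosen →
                      ∀ {z} → z ∈L lineForbidden x chosen → χ C z ≡ false
lineForbidden-sound {C} cap {x} {chosen} χx χc z∈ with ∈-map⁻ (third x) z∈
... | c , c∈ , refl with ∈-filterᵇ⁻ (λ c → not (x ≡ᵇ c)) chosen c∈
...   | c∈chosen , x≢c = ¬-not λ χz → cap (pt x) (pt c) (pt (third x c)) (χ-∈ C χx) (χ-∈ C (All.lookup χc c∈chosen))
  (χ-∈ C χz)
        (subst (IsLine (pt x) (pt c)) (trans (∘-pt (pt x) (pt c))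
          (cong₂ (λ s t → pt (third s t)) (toℕ-pt x<81) (toℕ-pt c<81)))
          (∘-line λ e → not-≡ᵇ⇒≢ x≢c (trans (sym (toℕ-pt x<81)) (trans (cong toℕ e) (toℕ-pt c<81)))))
  where
  x<81 = χ-< C χx
  c<81 = χ-< C (All.lookup χc c∈chosen)

escape : ∀ {xs} (bad : List ℕ) → Unique xs → length bad < length xs → ∃ λ x → x ∈L xs × mem x bad ≡ false
escape {xs} bad u h with any (λ x → not (mem x bad)) xs in eq
... | true  = let x , x∈ , e = any-sound (λ x → not (mem x bad)) xs eq in x , x∈ , not-true e
  where
  not-true : ∀ {b} → not b ≡ true → b ≡ false
  not-true {false} _ = refl
... | false = contradiction (length-⊆ u λ x∈ → mem-sound bad (none xs eq x∈)) (<⇒≱ h)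
  where
  none : ∀ xs → any (λ x → not (mem x bad)) xs ≡ false → ∀ {x} → x ∈L xs → mem x bad ≡ true
  none (x ∷ xs) e p with mem x bad in e′
  none (x ∷ xs) e (here refl) | true = e′
  none (x ∷ xs) e (there x∈)  | true = none xs e x∈

∈-remove : ∀ {x} f xs → x ∈L xs → mem x f ≡ false → x ∈L remove f xs
∈-remove f (x ∷ xs) (here refl) e rewrite e = here refl
∈-remove f (y ∷ xs) (there x∈) e with mem y f
... | true  = ∈-remove f xs x∈ e
... | false = there (∈-remove f xs x∈ e)

any-elim : ∀ {A R : Set} (p : A → Bool) xs → any p xs ≡ true → (∀ x → p x ≡ true → R) → R
any-elim p xs e k = let x , _ , q = any-sound p xs e in k x q

Equivalent : PSet → PSet → Set
Equivalent C D = ∃ λ g → act g C ≡ D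

via : ∀ g {C D} → Equivalent (act g C) D → Equivalent C D
via g {C} (h , e) = compose g h , trans (sym (act-compose g h C)) e

iff-≡ : ∀ {a b} → a iff b ≡ true → a ≡ b
iff-≡ {true}  {true}  _ = refl
iff-≡ {false} {false} _ = refl

anchored : List ℕ
anchored = double ovoid

model : PSet
model = fromCodes anchored

translation : ℕ → Affine
translation p = affine (form (digit 0F p) 1 0 0 0) (form (digit 1F p) 0 1 0 0) (form (digit 2F p) 0 0 1 0)
  (form (digit 3F p) 0 0 0 1)

shifted-equivalent : ∀ {C} → (∀ {n} → n < 81 → χ C n ≡ mem n shifted) → Equivalent C model
shifted-equivalent {C} e = affineColl (translation 39) refl , χ-ext anchored λ {n} n<81 →
  trans (χ-act (translation 39) refl C n<81) (trans (e (apply<81 (translation 39) n))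
    (iff-≡ (all<-sound 81 (λ n → mem (apply (translation 39) n) shifted iff mem n anchored) refl n<81)))

codes : PSet → List ℕ
codes C = map toℕ (members C)

length-codes : ∀ C → length (codes C) ≡ ∣ C ∣
length-codes C = trans (length-map toℕ (members C)) (length-members C)

size-codes : ∀ C → 20 ≤ ∣ C ∣ → 20 ≤ length (codes C)
size-codes C h = ≤-trans h (≤-reflexive (sym (length-codes C)))

codes-! : ∀ C → Unique (codes C)
codes-! C = Unique-map⁺ toℕ-injective (members-! C)

codes-χ : ∀ C {n} → n ∈L codes C → χ C n ≡ true
codes-χ C n∈ with ∈-map⁻ toℕ n∈
... | x , x∈ , refl = ∈-χ C (∈-members⁻ C x∈)

∧-true₃ : ∀ {a b c} → a ∧ b ∧ c ≡ true → a ≡ true × b ≡ true × c ≡ true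
∧-true₃ {true} {true} p = refl , refl , p

module _ {C : PSet} (cap : Cap C) (size : 20 ≤ ∣ C ∣) where

  private
    p = χ C

  full-equivalent : (∀ {n} → n < 27 → p n ≡ mem n quadric) → p 27 ≡ true → Equivalent C model
  full-equivalent lowQ p27 = finish
    where
    L = filterᵇ p undecidedFull
    F = fullExtension L
    χ-quadric : All (λ c → p c ≡ true) quadric
    χ-quadric = All.tabulate λ n∈ → trans (lowQ (<ᵇ-true⇒< (all-sound (_<ᵇ 27) quadric refl n∈))) (mem-complete n∈)
    inHigh : ∀ {n} → n < 81 → ¬ n < 27 → n ∈L high
    inHigh {n} n<81 n≮27 with n <ᵇ 27 in eq | all<-sound 81 (λ n → (n <ᵇ 27) ∨ mem n high) refl n<81
    ... | true  | _ = contradiction (<ᵇ-true⇒< eq) n≮27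
    ... | false | e = mem-sound high e
    p⇒F : ∀ {n} → p n ≡ true → n ∈L F
    p⇒F {n} pn with n <? 27
    ... | yes n<27 = ∈-++⁺ˡ (mem-sound quadric (trans (sym (lowQ n<27)) pn))
    ... | no n≮27 with mem n (27 ∷ []) in eq
    ...   | true  = ∈-++⁺ʳ quadric (∈-++⁺ˡ (mem-sound (27 ∷ []) eq))
    ...   | false = ∈-++⁺ʳ quadric (there (∈-filterᵇ⁺ p undecidedFull
      (∈-remove (27 ∷ []) high (inHigh (χ-< C pn) n≮27) eq) pn))
    F⇒p : ∀ {n} → n ∈L F → p n ≡ true
    F⇒p n∈ with ∈-++⁻ quadric n∈
    ... | inj₁ n∈Q          = All.lookup χ-quadric n∈Q
    ... | inj₂ (here refl)  = p27
    ... | inj₂ (there n∈L)  = proj₂ (∈-filterᵇ⁻ p undecidedFull n∈L)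
    p≡mem : ∀ n → p n ≡ mem n F
    p≡mem n = bool-ext (λ e → mem-complete (p⇒F e)) (λ e → F⇒p (mem-sound F e))
    -- The nine points of `quadric` and the point 27 account for the other ten.
    enough : 10 ≤ length L
    enough = +-cancelˡ-≤ 10 10 (length L) (≤-trans (size-codes C size) (length-⊆ (codes-! C) λ n∈ → p⇒F (codes-χ C n∈)))
    e₀ : testFull L ≡ true
    e₀ = fullSearch p (lineForbidden-sound cap) (p27 ∷ χ-quadric) enough
    carried : ∀ A → carriesFull F A ≡ true → Equivalent C model
    carried A e = via (affineColl A inj) (shifted-equivalent λ {n} n<81 →
      trans (χ-act A inj C n<81) (trans (p≡mem (apply A n)) (iff-≡ (all<-sound 81 maps (proj₁ split) n<81))))
      where
      maps : ℕ → Bool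
      maps c = mem (apply A c) F iff mem c shifted
      split : all< 81 maps ≡ true × isInjective A ≡ true
      split = ∧-true e
      inj = proj₂ split
    finish : Equivalent C model
    finish = any-elim (full₀ F) F e₀ λ p₀ e₁ → any-elim (full₁ F p₀) F e₁ λ p₁ e₂ →
      any-elim (full₂ F p₀ p₁) F (proj₂ (∧-true {not (p₀ ≡ᵇ p₁)} e₂)) λ p₂ e₃ →
      any-elim (full₃ F p₀ p₁ p₂) F (proj₂ (∧-true {not (mem p₂ (p₀ ∷ p₁ ∷ []))} e₃)) λ p₃ e₄ →
      any-elim (full₄ F p₀ p₁ p₂ p₃) F e₄ λ p₄ e₅ → carried (basisMap p₀ p₁ p₂ p₃ p₄) e₅

-- The affine maps fixing x₃ = 0 pointwise are transitive on the remaining 54 points. So once the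
-- section is in place, some further point of the cap may be assumed to be 27; `apex-ok` is the
-- verification.
apex : ℕ → Affine
apex = basisMap 0 1 3 9

apexFixes : ℕ → ℕ → Bool
apexFixes n c = apply (apex n) c ≡ᵇ c

apexCheck : ℕ → Bool
apexCheck n = (n <ᵇ 27) ∨ (isInjective (apex n) ∧ (apply (apex n) 27 ≡ᵇ n) ∧ all< 27 (apexFixes n))

or-false : ∀ {a b} → a ∨ b ≡ true → a ≡ false → b ≡ true
or-false {false} e _ = e

abstract
  apex-ok : all< 81 apexCheck ≡ true
  apex-ok = refl

≮⇒<ᵇ-false : ∀ {m n} → ¬ m < n → (m <ᵇ n) ≡ false
≮⇒<ᵇ-false m≮n = ¬-not λ e → m≮n (<ᵇ-true⇒< e)

act-cap : ∀ g {C} → Cap C → 20 ≤ ∣ C ∣ → Cap (act g C) × 20 ≤ ∣ act g C ∣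
act-cap g {C} cap size = Cap-act g cap , subst (20 ≤_) (sym (∣act∣ g C)) size

quadric-equivalent : ∀ {C} → Cap C → 20 ≤ ∣ C ∣ → (∀ {n} → n < 27 → χ C n ≡ mem n quadric) → Equivalent C model
quadric-equivalent {C} cap size lowQ = from-point (escape quadric (codes-! C)
  (≤-trans (≤ᵇ⇒≤ 10 20 _) (size-codes C size)))
  where
  from-point : (∃ λ n → n ∈L codes C × mem n quadric ≡ false) → Equivalent C model
  from-point (n , n∈ , n∉Q) = via g (full-equivalent (proj₁ capsize) (proj₂ capsize)
    (λ {c} c<27 → trans (χ-act (apex n) inj C (≤-trans c<27 (≤ᵇ⇒≤ 27 81 _)))
      (trans (cong (χ C) (≡ᵇ-sound (all<-sound 27 (apexFixes n) fixes c<27))) (lowQ c<27)))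
    (trans (χ-act (apex n) inj C (≤ᵇ⇒≤ 28 81 _)) (trans (cong (χ C) (≡ᵇ-sound top)) χn)))
    where
    χn : χ C n ≡ true
    χn = codes-χ C n∈
    n≮27 : ¬ n < 27
    n≮27 n<27 with trans (sym χn) (trans (lowQ n<27) n∉Q)
    ... | ()
    checked = ∧-true₃ {isInjective (apex n)} {apply (apex n) 27 ≡ᵇ n} {all< 27 (apexFixes n)}
      (or-false (all<-sound 81 apexCheck apex-ok (χ-< C χn)) (≮⇒<ᵇ-false n≮27))
    inj = proj₁ checked
    top = proj₁ (proj₂ checked)
    fixes = proj₂ (proj₂ checked)
    g = affineColl (apex n) inj
    capsize = act-cap g cap size

-- Only some nine points with x₃ = 0 are recorded; C may meet this hyperplane in more points.
record Section (C : PSet) : Set where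
  constructor section
  field
    points  : List Point
    unique  : Unique points
    contained  : ∀ {x} → x ∈L points → x ∈ C × toℕ x < 27
    large   : 9 ≤ length points

  codes-contained : ∀ {n} → n ∈L map toℕ points → χ C n ≡ true × n < 27
  codes-contained n∈ with ∈-map⁻ toℕ n∈
  ... | x , x∈ , refl = ∈-χ C (proj₁ (contained x∈)) , proj₂ (contained x∈)

  codes-unique : Unique (map toℕ points)
  codes-unique = Unique-map⁺ toℕ-injective unique

  codes-large : 9 ≤ length (map toℕ points)
  codes-large = subst (9 ≤_) (sym (length-map toℕ points)) large

moveSection : ∀ A inj {C} (ys : List Point) → Unique ys → 9 ≤ length ys →
  (∀ {y} → y ∈L ys → y ∈ C × (∀ {c} → c < 81 → apply A c ≡ toℕ y → c < 27)) → Section (act (affineColl A inj) C)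
moveSection A inj {C} ys ys-! large contained = section (map from ys)
  (Unique-map⁺ (Coll.to-inj (inverse g)) ys-!) inside′ (subst (9 ≤_) (sym (length-map from ys)) large)
  where
  g = affineColl A inj
  open Coll g
  inside′ : ∀ {x} → x ∈L map from ys → x ∈ act g C × toℕ x < 27
  inside′ x∈ with ∈-map⁻ from x∈
  ... | y , y∈ , refl = ∈-act-from g (proj₁ (contained y∈)) ,
    proj₂ (contained y∈) (toℕ<n (from y)) (trans (sym (toℕ-pt (apply<81 A (toℕ (from y)))))
      (cong toℕ (trans (sym (to-affineColl A inj (from y))) (to-from y))))

-- F consists of all points of C with x₃ = 0, not only of the recorded ones. The map found therefore
-- carries the complete section to `quadric`, which is what the next stage needs to rule out further
-- points below 27.
lowBasis-equivalent : ∀ {C} → Cap C → 20 ≤ ∣ C ∣ → Section C → χ C 0 ≡ true → χ C 1 ≡ true → χ C 3 ≡ true → Equivalent C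
  model
lowBasis-equivalent {C} cap size sec χ0 χ1 χ3 = finish
  where
  p = χ C
  L = filterᵇ p undecidedLow
  F = lowExtension L
  p⇒F : ∀ {n} → n < 27 → p n ≡ true → n ∈L F
  p⇒F {n} n<27 pn with mem n (0 ∷ 1 ∷ 3 ∷ []) in eq
  ... | true  = ∈-++⁺ˡ {xs = 0 ∷ 1 ∷ 3 ∷ []} (mem-sound (0 ∷ 1 ∷ 3 ∷ []) eq)
  ... | false = there (there (there (∈-filterᵇ⁺ p undecidedLow (∈-remove (0 ∷ 1 ∷ 3 ∷ []) low (∈-upTo⁺ n<27) eq) pn)))
  F⇒p : ∀ {n} → n ∈L F → p n ≡ true
  F⇒p (here refl)                 = χ0
  F⇒p (there (here refl))         = χ1
  F⇒p (there (there (here refl))) = χ3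
  F⇒p (there (there (there n∈)))  = proj₂ (∈-filterᵇ⁻ p undecidedLow n∈)
  p≡mem : ∀ {n} → n < 27 → p n ≡ mem n F
  p≡mem {n} n<27 = bool-ext (λ e → mem-complete (p⇒F n<27 e)) (λ e → F⇒p (mem-sound F e))
  enough : 6 ≤ length L
  enough = s≤s⁻¹ (s≤s⁻¹ (s≤s⁻¹ (≤-trans (Section.codes-large sec)
    (length-⊆ (Section.codes-unique sec) λ n∈ → let χn , n<27 = Section.codes-contained sec n∈ in p⇒F n<27 χn))))
  tested : testLow L ≡ true
  tested = lowSearch p (lineForbidden-sound cap) (χ0 ∷ χ1 ∷ χ3 ∷ []) enough
  carried : ∀ A → carriesLow F A ≡ true → Equivalent C model
  carried A e = via g (quadric-equivalent (proj₁ capsize) (proj₂ capsize) λ {n} n<27 →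
      let low , maps = ∧-true {apply A n <ᵇ 27} (all<-sound 27 mapsLow (proj₁ split) n<27) in
      trans (χ-act A inj C (≤-trans n<27 (≤ᵇ⇒≤ 27 81 _))) (trans (p≡mem (<ᵇ-true⇒< low)) (iff-≡ maps)))
    where
    mapsLow : ℕ → Bool
    mapsLow c = (apply A c <ᵇ 27) ∧ (mem (apply A c) F iff mem c quadric)
    split : all< 27 mapsLow ≡ true × isInjective A ≡ true
    split = ∧-true e
    inj = proj₂ split
    g = affineColl A inj
    capsize = act-cap g cap size
  finish : Equivalent C model
  finish = any-elim (low₀ F) F tested λ p₀ e₁ → any-elim (low₁ F p₀) F e₁ λ p₁ e₂ →
    any-elim (low₂ F p₀ p₁) F (proj₂ (∧-true {not (p₀ ≡ᵇ p₁)} e₂)) λ p₂ e₃ →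
    any-elim (low₃ F p₀ p₁ p₂) F e₃ λ p₃ e₄ → carried (basisMap p₀ p₁ p₂ p₃ (27 + p₀)) e₄

-- Points of the cap move by the inverse of A. For the recorded section to stay in x₃ = 0, the
-- preimage of that hyperplane under A has to lie in it.
reflectsLow : Affine → ℕ → Bool
reflectsLow A c = not (apply A c <ᵇ 27) ∨ (c <ᵇ 27)

admissible : Affine → Bool
admissible A = isInjective A ∧ all< 81 (reflectsLow A)

extends : List ℕ → ℕ → ℕ → Affine → Bool
extends fixed b n A = all (λ c → apply A c ≡ᵇ c) fixed ∧ (apply A b ≡ᵇ n) ∧ admissible A

-- One normalisation step: move a point n of the section to b, keeping the points already placed.
normalise : ∀ {C} → Cap C → 20 ≤ ∣ C ∣ → Section C → ∀ fixed b n A → extends fixed b n A ≡ true → b < 81 →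
  (∀ {c} → c ∈L fixed → c < 81) →
  χ C n ≡ true → (∀ {c} → c ∈L fixed → χ C c ≡ true) →
  (∀ {C′} → Cap C′ → 20 ≤ ∣ C′ ∣ → Section C′ → χ C′ b ≡ true → (∀ {c} → c ∈L fixed → χ C′ c ≡ true) → Equivalent C′
    model) →
  Equivalent C model
normalise {C} cap size sec fixed b n A e b<81 fixed<81 χn χfixed next = via g
  (next (proj₁ capsize) (proj₂ capsize)
    (moveSection A inj (Section.points sec) (Section.unique sec) (Section.large sec)
      λ y∈ → let y∈C , y<27 = Section.contained sec y∈ in y∈C ,
        λ {c} c<81 e → <ᵇ-true⇒< (or-false (all<-sound 81 (reflectsLow A) reflects c<81)
          (cong not (<⇒<ᵇ-true (subst (_< 27) (sym e) y<27)))))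
    (trans (χ-act A inj C b<81) (trans (cong (χ C) (≡ᵇ-sound (proj₁ (proj₂ checked)))) χn))
    (λ {c} c∈ → trans (χ-act A inj C (fixed<81 c∈))
      (trans (cong (χ C) (≡ᵇ-sound (all-sound (λ c → apply A c ≡ᵇ c) fixed (proj₁ checked) c∈))) (χfixed c∈))))
  where
  checked = ∧-true₃ {all (λ c → apply A c ≡ᵇ c) fixed} {apply A b ≡ᵇ n} {admissible A} e
  inj = proj₁ (∧-true {isInjective A} (proj₂ (proj₂ checked)))
  reflects = proj₂ (∧-true {isInjective A} (proj₂ (proj₂ checked)))
  g = affineColl A inj
  capsize = act-cap g cap size

-- Steinitz exchange: n takes the place of one of the basis vectors still free, and the others are
-- kept. Some candidate is injective, which `check₁` and `check₃` confirm for each admissible n.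
completions₁ completions₃ : ℕ → List Affine
completions₁ n = basisMap 0 n 3 9 27 ∷ basisMap 0 n 1 9 27 ∷ basisMap 0 n 1 3 27 ∷ []
completions₃ n = basisMap 0 1 n 9 27 ∷ basisMap 0 1 n 3 27 ∷ []

check₀ check₁ check₃ : ℕ → Bool
check₀ n = extends [] 0 n (translation n)
check₁ n = mem n (0 ∷ []) ∨ any (extends (0 ∷ []) 1 n) (completions₁ n)
check₃ n = mem n (0 ∷ 1 ∷ 2 ∷ []) ∨ any (extends (0 ∷ 1 ∷ []) 3 n) (completions₃ n)

abstract
  ok₀ : all< 27 check₀ ≡ true
  ok₀ = refl
  ok₁ : all< 27 check₁ ≡ true
  ok₁ = refl
  ok₃ : all< 27 check₃ ≡ true
  ok₃ = refl

equivalent₀₁ : ∀ {C} → Cap C → 20 ≤ ∣ C ∣ → Section C → χ C 1 ≡ true → (∀ {c} → c ∈L 0 ∷ [] → χ C c ≡ true) → Equivalent C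
  model
-- The line through 0 and 1 is {0, 1, 2}; a point of the section off this line is affinely
-- independent of 0 and 1.
equivalent₀₁ {C} cap size sec χ1 χ0 = pick (escape (0 ∷ 1 ∷ 2 ∷ []) (Section.codes-unique sec)
  (≤-trans (≤ᵇ⇒≤ 4 9 _) (Section.codes-large sec)))
  where
  pick : (∃ λ n → n ∈L map toℕ (Section.points sec) × mem n (0 ∷ 1 ∷ 2 ∷ []) ≡ false) → Equivalent C model
  pick (n , n∈ , n∉) = any-elim (extends (0 ∷ 1 ∷ []) 3 n) (completions₃ n)
    (or-false (all<-sound 27 check₃ ok₃ (proj₂ (Section.codes-contained sec n∈))) n∉)
    λ A e → normalise cap size sec (0 ∷ 1 ∷ []) 3 n A e (≤ᵇ⇒≤ 4 81 _)
      (λ { (here refl) → ≤ᵇ⇒≤ 1 81 _ ; (there (here refl)) → ≤ᵇ⇒≤ 2 81 _ })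
      (proj₁ (Section.codes-contained sec n∈))
      (λ { (here refl) → χ0 (here refl) ; (there (here refl)) → χ1 })
      λ cap size sec χ3 χ01 → lowBasis-equivalent cap size sec (χ01 (here refl)) (χ01 (there (here refl))) χ3

equivalent₀ : ∀ {C} → Cap C → 20 ≤ ∣ C ∣ → Section C → χ C 0 ≡ true → (∀ {c} → c ∈L [] → χ C c ≡ true) → Equivalent C
  model
equivalent₀ {C} cap size sec χ0 _ = pick (escape (0 ∷ []) (Section.codes-unique sec)
  (≤-trans (≤ᵇ⇒≤ 2 9 _) (Section.codes-large sec)))
  where
  pick : (∃ λ n → n ∈L map toℕ (Section.points sec) × mem n (0 ∷ []) ≡ false) → Equivalent C model
  pick (n , n∈ , n∉) = any-elim (extends (0 ∷ []) 1 n) (completions₁ n)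
    (or-false (all<-sound 27 check₁ ok₁ (proj₂ (Section.codes-contained sec n∈))) n∉)
    λ A e → normalise cap size sec (0 ∷ []) 1 n A e (≤ᵇ⇒≤ 2 81 _) (λ { (here refl) → ≤ᵇ⇒≤ 1 81 _ })
      (proj₁ (Section.codes-contained sec n∈)) (λ { (here refl) → χ0 }) equivalent₀₁

section-equivalent : ∀ {C} → Cap C → 20 ≤ ∣ C ∣ → Section C → Equivalent C model
section-equivalent {C} cap size sec = pick (escape [] (Section.codes-unique sec)
  (≤-trans (≤ᵇ⇒≤ 1 9 _) (Section.codes-large sec)))
  where
  pick : (∃ λ n → n ∈L map toℕ (Section.points sec) × mem n [] ≡ false) → Equivalent C model
  pick (n , n∈ , _) = normalise cap size sec [] 0 n (translation n)
    (all<-sound 27 check₀ ok₀ (proj₂ (Section.codes-contained sec n∈)))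
    (≤ᵇ⇒≤ 1 81 _) (λ ()) (proj₁ (Section.codes-contained sec n∈)) (λ ()) equivalent₀

-- Carries the hyperplane x₃ = 0 onto {x | dot d x = k}.
sectionMap : ℕ → ℕ → Affine
sectionMap d k =
  if not (d₃ ≡ᵇ 0) then affine (form 0 1 0 0 0) (form 0 0 1 0 0) (form 0 0 0 1 0) (solved d₃ d₀ d₁ d₂)
  else if not (d₂ ≡ᵇ 0) then affine (form 0 1 0 0 0) (form 0 0 1 0 0) (solved d₂ d₀ d₁ d₃) (form 0 0 0 1 0)
  else if not (d₁ ≡ᵇ 0) then affine (form 0 1 0 0 0) (solved d₁ d₀ d₂ d₃) (form 0 0 1 0 0) (form 0 0 0 1 0)
  else affine (solved d₀ d₁ d₂ d₃) (form 0 1 0 0 0) (form 0 0 1 0 0) (form 0 0 0 1 0)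
  where
  d₀ = digit 0F d
  d₁ = digit 1F d
  d₂ = digit 2F d
  d₃ = digit 3F d
  solved : ℕ → ℕ → ℕ → ℕ → Form
  -- Modulo 3 a nonzero e is its own inverse and 2 is -1. The solved coordinate makes `dot d` equal
  -- to k + e x₃ at the image, which is k exactly when x₃ = 0.
  solved e a b c = form (e * k) (2 * e * a) (2 * e * b) (2 * e * c) 1

sectionReflects : ℕ → ℕ → ℕ → Bool
sectionReflects d k c = not (dot d (apply (sectionMap d k) c) ≡ᵇ k) ∨ (c <ᵇ 27)

sectionCheck : ℕ → ℕ → Bool
sectionCheck d k = isInjective (sectionMap d k) ∧ all< 81 (sectionReflects d k)

sectionRow : ℕ → Bool
sectionRow d = (d ≡ᵇ 0) ∨ all< 3 (sectionCheck d)

abstract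
  section-ok : all< 81 sectionRow ≡ true
  section-ok = refl

-- The moment identities need an exact number of points, so they are applied to 20 points of C,
-- which again form a cap. The nine points of a section found among them lie in C, and the later
-- stages use all of C.
classify : ∀ {C} → Cap C → 20 ≤ ∣ C ∣ → Equivalent C model
classify {C} cap size = pick (exists-9-section xs xs-! (λ x∈ y∈ z∈ → cap _ _ _ (xs⊆ x∈) (xs⊆ y∈) (xs⊆ z∈)) xs-20)
  where
  xs = take 20 (members C)
  xs-! : Unique xs
  xs-! = take⁺ 20 (members-! C)
  xs⊆ : ∀ {x} → x ∈L xs → x ∈ C
  xs⊆ x∈ = ∈-members⁻ C (∈-take 20 (members C) x∈)
    where
    ∈-take : ∀ {A : Set} {x : A} n xs → x ∈L take n xs → x ∈L xs
    ∈-take (suc n) (x ∷ xs) (here e)   = here e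
    ∈-take (suc n) (x ∷ xs) (there x∈) = there (∈-take n xs x∈)
  xs-20 : length xs ≡ 20
  xs-20 = trans (length-take 20 (members C)) (m≤n⇒m⊓n≡m (subst (20 ≤_) (sym (length-members C)) size))
  pick : (∃ λ d → d ∈L directions × ∃ λ k → k < 3 × 9 ≤ ∑ xs (λ x → ind x d k)) → Equivalent C model
  pick (d , d∈ , k , k<3 , nine) = via g (section-equivalent (proj₁ capsize) (proj₂ capsize)
    (moveSection A inj ys (Unique-filter⁺ (λ x → T? (onSection x)) xs-!) (subst (9 ≤_) count-ys nine)
      λ y∈ → let y∈xs , on = ∈-filterᵇ⁻ onSection xs y∈ in xs⊆ y∈xs ,
        λ {c} c<81 e → <ᵇ-true⇒< (or-false (all<-sound 81 (sectionReflects d k) reflects c<81)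
          (cong not (subst (λ m → (dot d m ≡ᵇ k) ≡ true) (sym e) on)))))
    where
    A = sectionMap d k
    onSection : Point → Bool
    onSection x = dot d (toℕ x) ≡ᵇ k
    ys = filterᵇ onSection xs
    count-ys : ∑ xs (λ x → ind x d k) ≡ length ys
    count-ys = trans (∑-filterᵇ onSection xs (λ _ → 1)) (trans (∑-const 1 ys) (*-identityʳ (length ys)))
    row : all< 3 (sectionCheck d) ≡ true
    row = or-false (all<-sound 81 sectionRow section-ok (proj₂ (directions-valid d∈)))
      (positive (proj₁ (directions-valid d∈)))
      where
      positive : ∀ {d} → 0 < d → (d ≡ᵇ 0) ≡ false
      positive (s≤s _) = refl
    checked = ∧-true {isInjective A} (all<-sound 3 (sectionCheck d) row k<3)
    inj = proj₁ checked
    reflects = proj₂ checked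
    g = affineColl A inj
    capsize = act-cap g cap size

abstract
  classification : ∀ {C} → Cap C → 20 ≤ ∣ C ∣ → Equivalent C model
  classification = classify

-- Decompositions and ovoids by computation

-- The 30 points of PG(3,3) off the quadric, each by its smaller code; the strict inequality drops
-- 0.
others : List ℕ
others = filterᵇ (λ n → (n <ᵇ neg n) ∧ not (mem n ovoid)) (upTo 81)

_==_ : List ℕ → List ℕ → Bool
[]       == []       = true
(x ∷ xs) == (y ∷ ys) = (x ≡ᵇ y) ∧ (xs == ys)
_        == _        = false

memL : List ℕ → List (List ℕ) → Bool
memL L = any (L ==_)

nodup : List ℕ → Bool
nodup []       = true
nodup (x ∷ xs) = not (mem x xs) ∧ nodup xs

pairwise : {A : Set} → (A → A → Bool) → List A → Bool
pairwise r []       = true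
pairwise r (x ∷ xs) = all (r x) xs ∧ pairwise r xs

-- `LineInH` puts the anchor 0 into the hyperplane, so only linear hyperplanes occur, that is,
-- planes of PG(3,3). Their nonzero normals are the codes suc d.
coplanar : List ℕ → Bool
coplanar L = any (λ d → atLeast 4 (filterᵇ (λ r → dot (suc d) r ≡ᵇ 0) L)) (upTo 80)

splits : List ℕ → List (List ℕ × List ℕ)
splits []       = ([] , []) ∷ []
splits (x ∷ xs) = map (λ (s , t) → x ∷ s , t) (splits xs) ++ map (λ (s , t) → s , x ∷ t) (splits xs)

splits-complete : ∀ (p : ℕ → Bool) xs → (filterᵇ p xs , filterᵇ (λ x → not (p x)) xs) ∈L splits xs
splits-complete p []       = here refl
splits-complete p (x ∷ xs) with p x
... | true  = ∈-++⁺ˡ (∈-map⁺ (λ (s , t) → x ∷ s , t) (splits-complete p xs))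
... | false = ∈-++⁺ʳ (map (λ (s , t) → x ∷ s , t) (splits xs)) (∈-map⁺ (λ (s , t) → s , x ∷ t) (splits-complete p xs))

-- Of the two orders of a decomposition, keep the one whose first half contains 12.
isDecomposition : List ℕ × List ℕ → Bool
isDecomposition (σ , σ′) = mem 12 σ ∧ atLeast 5 σ ∧ atLeast 5 σ′ ∧ not (coplanar σ) ∧ not (coplanar σ′)

completesOne : List ℕ → ℕ → Bool
-- A single completed line contributes both of its points x, hence 2.
completesOne L n = not (mem n L) ∧ (length (filterᵇ (λ x → mem (third n x) L) L) ≡ᵇ 2)

completesBoth : List ℕ → List ℕ → ℕ → Bool
completesBoth L L′ n = completesOne L n ∧ completesOne L′ n

-- The completing points are sought among `others` and up to sign. That nothing else completes one
-- line with each half is verified over all 81 points by `completionCheck`.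
image : List ℕ × List ℕ → List ℕ
image (σ , σ′) = filterᵇ (completesBoth (double σ) (double σ′)) others

Entry : Set
Entry = (List ℕ × List ℕ) × List ℕ

-- A line of PG(3,3) has four points. Besides x and c these are -x - c and -x + c up to sign, and an
-- ovoid through x and c avoids both.
conicRow : ℕ → ℕ → List ℕ
conicRow x c = if (x ≡ᵇ c) ∨ (x ≡ᵇ neg c) then [] else rep (third x c) ∷ rep (third x (neg c)) ∷ []

nth : {A : Set} → A → List A → ℕ → A
nth a []       n       = a
nth a (x ∷ xs) zero    = x
nth a (x ∷ xs) (suc n) = nth a xs n

tabulated : (ℕ → ℕ → List ℕ) → ℕ → List (List (List ℕ))
tabulated F n = map (λ x → map (F x) (upTo n)) (upTo n)

rowForbidden : List (List ℕ) → List ℕ → List ℕ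
rowForbidden row []       = []
rowForbidden row (c ∷ cs) = nth [] row c ++ rowForbidden row cs

tableForbidden : List (List (List ℕ)) → ℕ → List ℕ → List ℕ
tableForbidden table x chosen = rowForbidden (nth [] table x) chosen

abstract
  -- The only candidate for the fourth block once the model, M and A are blocks.
  rest₂ : List ℕ → List ℕ → List ℕ
  rest₂ M A = remove (M ++ A) others

  rest₂-remove : ∀ M A → rest₂ M A ≡ remove (M ++ A) others
  rest₂-remove M A = refl

module _ (ovoids : List (List ℕ)) where

  completing : List ℕ → List ℕ → Bool
  completing M A = not (any (λ r → mem r M) A) ∧ memL (rest₂ M A) ovoids

  completions : List ℕ → List (List ℕ)
  completions M = filterᵇ (completing M) ovoids

  -- Each partition puts both of its remaining blocks into the list of completions. A single
  -- partition thus means two entries, each the rest of the other.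
  uniquePair : List ℕ → List (List ℕ) → Bool
  uniquePair M (A ∷ B ∷ []) = (rest₂ M A == B) ∧ (rest₂ M B == A)
  uniquePair M _            = false

  -- Two completions that are neither equal nor partners belong to different partitions.
  severalPairs : List ℕ → List (List ℕ) → Bool
  severalPairs M cs = any (λ A → any (λ B → not (A == B) ∧ not (A == rest₂ M B)) cs) cs

isCapᵇ : List ℕ → Bool
isCapᵇ L = all (λ x → all (λ y → (x ≡ᵇ y) ∨ not (mem (third x y) L)) L) L

decompositionCheck : Entry → Bool
decompositionCheck ((σ , σ′) , _) =
  (length σ ≡ᵇ 5) ∧ (length σ′ ≡ᵇ 5) ∧ (filterᵇ (λ r → mem r σ) ovoid == σ) ∧ (filterᵇ (λ r → mem r σ′) ovoid == σ′) ∧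
    nodup (double σ) ∧ nodup (double σ′)
  ∧ all (λ r → not (mem r σ′)) σ ∧ all (λ r → mem r σ ∨ mem r σ′) ovoid ∧ not (coplanar σ) ∧ not (coplanar σ′)

completionCheck : Entry → Bool
completionCheck ((σ , σ′) , E) = go (double σ) (double σ′) (double E)
  where
  go : List ℕ → List ℕ → List ℕ → Bool
  go S S′ T = all< 81 λ n → completesBoth S S′ n iff mem n T

ovoidCheck : List ℕ → Bool
ovoidCheck M = (length M ≡ᵇ 10) ∧ (filterᵇ (λ r → mem r M) others == M) ∧ go (double M)
  where
  go : List ℕ → Bool
  go L = nodup L ∧ isCapᵇ L

-- The core of the correspondence: an ovoid that is an image has just one pair of completions, and
-- any other ovoid has completions from two different pairs.
pairCheck : List (List ℕ) → List (List ℕ) → List ℕ → Bool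
pairCheck ovoids images M =
  if memL M images then uniquePair ovoids M (completions ovoids M) else severalPairs ovoids M (completions ovoids M)

-- Different images give injectivity of the correspondence. Comparing σ with both halves of the
-- other entry makes the decompositions distinct as unordered pairs.
distinctEntries : Entry → Entry → Bool
distinctEntries ((σ , _) , E) ((τ , τ′) , F) = not (σ == τ) ∧ not (σ == τ′) ∧ not (E == F)

checkAll : List Entry → List (List ℕ) → Bool
checkAll table ovoids = go (map proj₂ table)
  where
  go : List (List ℕ) → Bool
  go images =
    (length table ≡ᵇ 36) ∧ pairwise distinctEntries table ∧ all decompositionCheck table ∧ all completionCheck table
    ∧ all (λ E → memL E ovoids) images ∧ all ovoidCheck ovoids ∧ all (pairCheck ovoids images) ovoids

-- The computed data, packaged generically so that they are evaluated only in the proof of checked.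
record Searched (xs : List ℕ) (good : List ℕ × List ℕ → Bool) (forbidden : ℕ → List ℕ → List ℕ) (und : List ℕ) (k : ℕ)
                (check : List Entry → List (List ℕ) → Bool) : Set where
  field
    table           : List Entry
    ovoids          : List (List ℕ)
    checked         : check table ovoids ≡ true
    table-complete  : ∀ p → good (filterᵇ p xs , filterᵇ (λ x → not (p x)) xs) ≡ true →
                      ∃ λ E → ((filterᵇ p xs , filterᵇ (λ x → not (p x)) xs) , E) ∈L table
    ovoids-complete : ∀ p → (∀ {x chosen} → p x ≡ true → All (λ c → p c ≡ true) chosen → ∀ {z} → z ∈L forbidden x chosen →
      p z ≡ false) →
                      k ≤ length (filterᵇ p und) → filterᵇ p und ∈L ovoids

tableOf : List ℕ → (List ℕ × List ℕ → Bool) → List Entry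
tableOf xs good = map (λ d → d , image d) (filterᵇ good (splits xs))

searched : ∀ xs good forbidden und k check n → check (tableOf xs good) (search forbidden n [] und k) ≡ true → length und ≤
  n →
           Searched xs good forbidden und k check
searched xs good forbidden und k check n e fuel = record
  { table           = tableOf xs good
  ; ovoids          = search forbidden n [] und k
  ; checked         = e
  ; table-complete  = λ p h → _ , ∈-map⁺ (λ d → d , image d) (∈-filterᵇ⁺ good (splits xs) (splits-complete p xs) h)
  ; ovoids-complete = λ p sound h → search-complete forbidden p sound n und k fuel [] h
  }

abstract
  -- Ovoids are sought as sets of at least 10 of the 30 remaining points. The computation takes
  -- place in the `refl`, and later proofs use only the fields of the record.
  computed : Searched ovoid isDecomposition (tableForbidden (tabulated conicRow 81)) others 10 checkAll
  computed = searched ovoid isDecomposition (tableForbidden (tabulated conicRow 81)) others 10 checkAll 30 refl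
    (≤ᵇ⇒≤ 30 30 _)

nth-map-applyUpTo : ∀ {A : Set} (a : A) (f : ℕ → A) (g : ℕ → ℕ) n {m} → m < n → nth a (map f (applyUpTo g n)) m ≡ f (g m)
nth-map-applyUpTo a f g (suc n) {zero}  _   = refl
nth-map-applyUpTo a f g (suc n) {suc m} m<n = nth-map-applyUpTo a f (λ k → g (suc k)) n (s≤s⁻¹ m<n)

∈-tableForbidden : ∀ (F : ℕ → ℕ → List ℕ) n {x chosen} → x < n → All (_< n) chosen → ∀ {z} →
  z ∈L tableForbidden (tabulated F n) x chosen → ∃ λ c → c ∈L chosen × z ∈L F x c
∈-tableForbidden F n {x} {chosen} x<n c<n {z} z∈ = go chosen c<n
  (subst (λ r → z ∈L rowForbidden r chosen) (nth-map-applyUpTo [] (λ x → map (F x) (upTo n)) (λ k → k) n x<n) z∈)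
  where
  go : ∀ cs → All (_< n) cs → z ∈L rowForbidden (map (F x) (upTo n)) cs → ∃ λ c → c ∈L cs × z ∈L F x c
  go (c ∷ cs) (c<n ∷ cs<n) z∈ with ∈-++⁻ (nth [] (map (F x) (upTo n)) c) z∈
  ... | inj₁ p = c , here refl , subst (z ∈L_) (nth-map-applyUpTo [] (F x) (λ k → k) n c<n) p
  ... | inj₂ p = let c′ , c′∈ , q = go cs cs<n p in c′ , there c′∈ , q

-- Sets symmetric about the origin

neg<81 : ∀ n → neg n < 81
neg<81 n = third<81 0 n

neg-neg : ∀ {n} → n < 81 → neg (neg n) ≡ n
neg-neg n<81 = ≡ᵇ-sound (all<-sound 81 (λ n → neg (neg n) ≡ᵇ n) refl n<81)

pt-neg : ∀ x → origin ∘ x ≡ pt (neg (toℕ x))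
pt-neg x = ∘-pt origin x

toℕ-neg : ∀ x → toℕ (origin ∘ x) ≡ neg (toℕ x)
toℕ-neg x = toℕ-∘ origin x

Bounded : List ℕ → Set
Bounded L = ∀ {n} → n ∈L L → n < 81

χ-fromCodes : ∀ L {n} → n < 81 → χ (fromCodes L) n ≡ mem n L
χ-fromCodes L {n} n<81 = trans (χ-lookup (fromCodes L) n<81)
  (trans (lookup-fromCodes L (pt n)) (cong (λ m → mem m L) (toℕ-pt n<81)))

∈-fromCodes⁺ : ∀ L {x} → toℕ x ∈L L → x ∈ fromCodes L
∈-fromCodes⁺ L {x} p = lookup-∈ (trans (lookup-fromCodes L x) (mem-complete p))

∈-fromCodes⁻ : ∀ L {x} → x ∈ fromCodes L → toℕ x ∈L L
∈-fromCodes⁻ L {x} p = mem-sound L (trans (sym (lookup-fromCodes L x)) (∈-lookup p))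

fromCodes-ext : ∀ {C L} → (∀ {n} → χ C n ≡ true → n ∈L L) → (∀ {n} → n ∈L L → χ C n ≡ true) → C ≡ fromCodes L
fromCodes-ext {C} {L} f g = subset-antisym
  (λ x x∈ → ∈-fromCodes⁺ L (f (∈-χ C x∈)))
  (λ x x∈ → lookup-∈ (trans (sym (χ-toℕ C x)) (g (∈-fromCodes⁻ L x∈))))

size≤ : ∀ C L → (∀ {n} → χ C n ≡ true → n ∈L L) → ∣ C ∣ ≤ length L
size≤ C L f = subst (_≤ length L) (length-codes C)
  (length-⊆ (codes-! C) λ n∈ → f (codes-χ C n∈))

size≥ : ∀ C L → Unique L → (∀ {n} → n ∈L L → χ C n ≡ true) → length L ≤ ∣ C ∣
size≥ C L L-! f = subst (length L ≤_) (length-codes C)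
  (length-⊆ L-! λ n∈ → subst (_∈L codes C) (toℕ-pt (χ-< C (f n∈))) (∈-map⁺ toℕ (∈-members⁺ C (χ-∈ C (f n∈)))))

size-fromCodes : ∀ L → Unique L → Bounded L → ∣ fromCodes L ∣ ≡ length L
size-fromCodes L L-! L<81 = ≤-antisym
  (size≤ (fromCodes L) L (λ {n} e → mem-sound L (trans (sym (χ-fromCodes L (χ-< (fromCodes L) e))) e)))
  (size≥ (fromCodes L) L L-! λ n∈ → trans (χ-fromCodes L (L<81 n∈)) (mem-complete n∈))

nodup-sound : ∀ L → nodup L ≡ true → Unique L
nodup-sound []       _ = []
nodup-sound (x ∷ L) e = All.tabulate (λ y∈ x≡y → absurd (proj₁ (∧-true {not (mem x L)} e))
  (mem-complete (subst (_∈L L) (sym x≡y) y∈)))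
    ∷ nodup-sound L (proj₂ (∧-true {not (mem x L)} e))
  where
  absurd : ∀ {b} → not b ≡ true → b ≡ true → ⊥
  absurd {true} ()

isCapᵇ-sound : ∀ L → isCapᵇ L ≡ true → Cap (fromCodes L)
isCapᵇ-sound L e x y z x∈ y∈ z∈ l@(x≢y , _) = absurd (toℕ x ≡ᵇ toℕ y) refl
  (all-sound (λ y → (toℕ x ≡ᵇ y) ∨ not (mem (third (toℕ x) y) L)) L
    (all-sound (λ x → all (λ y → (x ≡ᵇ y) ∨ not (mem (third x y) L)) L) L e (∈-fromCodes⁻ L x∈)) (∈-fromCodes⁻ L y∈))
  (mem-complete (subst (_∈L L) (trans (cong toℕ (line⇒∘ l)) (toℕ-∘ x y)) (∈-fromCodes⁻ L z∈)))
  where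
  absurd : ∀ {b} c → (toℕ x ≡ᵇ toℕ y) ≡ c → c ∨ not b ≡ true → b ≡ true → ⊥
  absurd true e _ _ = x≢y (toℕ-injective (≡ᵇ-sound e))
  absurd {true} false _ () _

Symmetric : PSet → Set
Symmetric S = ∀ {n} → χ S n ≡ true → χ S (neg n) ≡ true

closed⇒symmetric : ∀ {S} → (∀ b → b ∈ S → ∃ λ c → c ∈ S × IsLine origin b c) → Symmetric S
closed⇒symmetric {S} f {n} χn with f (pt n) (χ-∈ S χn)
... | c , c∈ , l = subst (λ m → χ S m ≡ true)
  (trans (cong toℕ (line⇒∘ l)) (trans (toℕ-neg (pt n)) (cong neg (toℕ-pt (χ-< S χn))))) (∈-χ S c∈)

symmetric⇒closed : ∀ {S} → origin ∉ S → Symmetric S → ∀ b → b ∈ S → ∃ λ c → c ∈ S × IsLine origin b c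
symmetric⇒closed {S} o∉ symm b b∈ = origin ∘ b , subst (_∈ S) (sym (pt-neg b)) (χ-∈ S (symm (∈-χ S b∈)))
  , ∘-line λ { refl → o∉ b∈ }

set : List ℕ → PSet
set L = fromCodes (double L)

∈-double⁻ : ∀ L {n} → n ∈L double L → n ∈L L ⊎ ∃ λ r → r ∈L L × n ≡ neg r
∈-double⁻ L n∈ with ∈-++⁻ L n∈
... | inj₁ p = inj₁ p
... | inj₂ p = inj₂ (∈-map⁻ neg p)

∈-doubleˡ : ∀ {L n} → n ∈L L → n ∈L double L
∈-doubleˡ p = ∈-++⁺ˡ p

∈-doubleʳ : ∀ L {n} → n ∈L L → neg n ∈L double L
∈-doubleʳ L p = ∈-++⁺ʳ L (∈-map⁺ neg p)

double-bounded : ∀ L → Bounded L → Bounded (double L)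
double-bounded L b n∈ with ∈-double⁻ L n∈
... | inj₁ p              = b p
... | inj₂ (r , _ , refl) = neg<81 r

double-neg : ∀ L → Bounded L → ∀ {n} → n ∈L double L → neg n ∈L double L
double-neg L b n∈ with ∈-double⁻ L n∈
... | inj₁ p               = ∈-doubleʳ L p
... | inj₂ (r , r∈ , refl) = ∈-doubleˡ (subst (_∈L L) (sym (neg-neg (b r∈))) r∈)

length-double : ∀ L → length (double L) ≡ length L + length L
length-double L = trans (length-++ L) (cong (length L +_) (length-map neg L))

χ-set : ∀ L {n} → n < 81 → χ (set L) n ≡ mem n (double L)
χ-set L = χ-fromCodes (double L)

χ-set⁻ : ∀ L {n} → χ (set L) n ≡ true → n ∈L double L
χ-set⁻ L e = mem-sound (double L) (trans (sym (χ-set L (χ-< (set L) e))) e)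

χ-set⁺ : ∀ L → Bounded L → ∀ {n} → n ∈L double L → χ (set L) n ≡ true
χ-set⁺ L b n∈ = trans (χ-set L (double-bounded L b n∈)) (mem-complete n∈)

set-symmetric : ∀ L → Bounded L → Symmetric (set L)
set-symmetric L b e = χ-set⁺ L b (double-neg L b (χ-set⁻ L e))

-- The passage to PG(3,3): a symmetric set is recovered from its representatives in R, so the blocks
-- and demicaps can be named by lists of projective points.
symmetric-set : ∀ {S} R → Bounded R → Symmetric S → (∀ {n} → χ S n ≡ true → n ∈L double R) → S ≡ set (filterᵇ (χ S) R)
symmetric-set {S} R b symm sub = fromCodes-ext into out
  where
  F = filterᵇ (χ S) R
  into : ∀ {n} → χ S n ≡ true → n ∈L double F
  into χn with ∈-double⁻ R (sub χn)
  ... | inj₁ p               = ∈-doubleˡ (∈-filterᵇ⁺ (χ S) R p χn)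
  ... | inj₂ (r , r∈ , refl) = ∈-doubleʳ F (∈-filterᵇ⁺ (χ S) R r∈ (subst (λ m → χ S m ≡ true) (neg-neg (b r∈)) (symm χn)))
  out : ∀ {n} → n ∈L double F → χ S n ≡ true
  out n∈ with ∈-double⁻ F n∈
  ... | inj₁ p               = proj₂ (∈-filterᵇ⁻ (χ S) R p)
  ... | inj₂ (r , r∈ , refl) = symm (proj₂ (∈-filterᵇ⁻ (χ S) R r∈))

==-sound : ∀ {xs ys} → (xs == ys) ≡ true → xs ≡ ys
==-sound {[]}     {[]}     _ = refl
==-sound {x ∷ xs} {y ∷ ys} e = let p , q = ∧-true {x ≡ᵇ y} e in cong₂ _∷_ (≡ᵇ-sound p) (==-sound q)

==-refl : ∀ xs → (xs == xs) ≡ true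
==-refl []       = refl
==-refl (x ∷ xs) rewrite ≡ᵇ-refl x = ==-refl xs

memL-sound : ∀ {xs} L → memL xs L ≡ true → xs ∈L L
memL-sound {xs} L e with any-sound (xs ==_) L e
... | ys , ys∈ , q = subst (_∈L L) (sym (==-sound q)) ys∈

memL-complete : ∀ {xs L} → xs ∈L L → memL xs L ≡ true
memL-complete {xs} (here refl) rewrite ==-refl xs = refl
memL-complete {xs} {ys ∷ L} (there p) with xs == ys
... | true  = refl
... | false = memL-complete p

pairwise-sound : ∀ {A : Set} (r : A → A → Bool) xs → pairwise r xs ≡ true → AllPairs (λ x y → r x y ≡ true) xs
pairwise-sound r []       _ = []
pairwise-sound r (x ∷ xs) e = let p , q = ∧-true {all (r x) xs} e in All.tabulate (all-sound (r x) xs p) ∷ pairwise-sound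
  r xs q

ovoid-bounded : Bounded ovoid
ovoid-bounded n∈ = <ᵇ-true⇒< (all-sound (_<ᵇ 81) ovoid refl n∈)

others-bounded : Bounded others
others-bounded n∈ = <ᵇ-true⇒< (all-sound (_<ᵇ 81) others refl n∈)

covers : ∀ {n} → n < 81 → n ≡ 0 ⊎ n ∈L double ovoid ⊎ n ∈L double others
covers {n} n<81 = split (all<-sound 81 (λ n → (n ≡ᵇ 0) ∨ mem n (double ovoid) ∨ mem n (double others)) refl n<81)
  where
  split : (n ≡ᵇ 0) ∨ mem n (double ovoid) ∨ mem n (double others) ≡ true → n ≡ 0 ⊎ n ∈L double ovoid ⊎ n ∈L double others
  split e with n ≡ᵇ 0 in e₀
  ... | true = inj₁ (≡ᵇ-sound e₀)
  ... | false with mem n (double ovoid) in e₁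
  ...   | true  = inj₂ (inj₁ (mem-sound (double ovoid) e₁))
  ...   | false = inj₂ (inj₂ (mem-sound (double others) e))

ovoid-others : ∀ {n} → n ∈L double others → ¬ n ∈L double ovoid
ovoid-others {n} n∈ n∈′ with trans (sym (all-sound (λ n → not (mem n (double ovoid))) (double others) refl n∈))
  (cong not (mem-complete n∈′))
... | ()

0∉ovoid : ¬ 0 ∈L double ovoid
0∉ovoid p with trans (sym (mem-complete p)) (refl {x = mem 0 (double ovoid)})
... | ()

0∉others : ¬ 0 ∈L double others
0∉others p with trans (sym (mem-complete p)) (refl {x = mem 0 (double others)})
... | ()

-- Coplanar lines through the anchor

model-cap : Cap model
model-cap = isCapᵇ-sound anchored refl

model-size : ∣ model ∣ ≡ 20
model-size = size-fromCodes anchored (nodup-sound anchored refl) (double-bounded ovoid ovoid-bounded)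

-- The equivalence carries all of T onto the model, so a lower bound of 20 on the size already
-- forces equality. This supplies the maximality of the model.
large-cap-size : ∀ {T} → Cap T → 20 ≤ ∣ T ∣ → ∣ T ∣ ≡ 20
large-cap-size {T} cap size = trans (sym (∣act∣ (proj₁ equivalence) T)) (trans (cong ∣_∣ (proj₂ equivalence)) model-size)
  where
  equivalence : Equivalent T model
  equivalence = classification cap size

cap-size≤20 : ∀ {T} → Cap T → ∣ T ∣ ≤ 20
cap-size≤20 {T} cap with ≤-total ∣ T ∣ 20
... | inj₁ h = h
... | inj₂ h = ≤-reflexive (large-cap-size cap h)

maxCap : ∀ {S} → Cap S → ∣ S ∣ ≡ 20 → MaxCap S
maxCap {S} cap size = cap , λ T capT → subst (∣ T ∣ ≤_) (sym size) (cap-size≤20 capT)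

maxCap-size : ∀ {S} → MaxCap S → ∣ S ∣ ≡ 20
maxCap-size {S} (cap , max) = large-cap-size cap (subst (_≤ ∣ S ∣) model-size (max model model-cap))

model-max : MaxCap model
model-max = maxCap model-cap model-size

abstract
  -- The threshold 10 tested next is the number of points on the five lines through the anchor of a
  -- demicap, so the same table serves demicaps and the blocks of a partition.
  modelLines : ℕ → List ℕ
  modelLines a = filterᵇ (λ b → mem (third a b) anchored) anchored

  modelLines-few : all< 81 (λ a → (a ≡ᵇ 0) ∨ not (atLeast 10 (modelLines a))) ≡ true
  modelLines-few = refl

  ∈-modelLines : ∀ a {b} → b ∈L anchored → third a b ∈L anchored → b ∈L modelLines a
  ∈-modelLines a b∈ c∈ = ∈-filterᵇ⁺ (λ b → mem (third a b) anchored) anchored b∈ (mem-complete c∈)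

∨-not : ∀ {a b} → a ∨ not b ≡ true → b ≡ true → a ≡ true
∨-not {true} _ _ = refl
∨-not {false} {true} () _

atLeast-sound : ∀ k (xs : List ℕ) → atLeast k xs ≡ true → k ≤ length xs
atLeast-sound zero    xs       _ = z≤n
atLeast-sound (suc k) (x ∷ xs) e = s≤s (atLeast-sound k xs e)

atLeast-complete : ∀ k (xs : List ℕ) → k ≤ length xs → atLeast k xs ≡ true
atLeast-complete zero    xs       _ = refl
atLeast-complete (suc k) (x ∷ xs) h = atLeast-complete k xs (s≤s⁻¹ h)

-- Only the origin lies on five or more lines through pairs of points of the model.
anchor-origin : ∀ {a D} → (∀ {x} → x ∈ D → x ∈ model) → 10 ≤ ∣ D ∣ →
                (∀ b → b ∈ D → ∃ λ c → c ∈ D × IsLine a b c) → a ≡ origin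
anchor-origin {a} {D} sub size closed = toℕ-injective (≡ᵇ-sound (∨-not
    (all<-sound 81 (λ a → (a ≡ᵇ 0) ∨ not (atLeast 10 (modelLines a))) modelLines-few (toℕ<n a))
    (atLeast-complete 10 (modelLines (toℕ a)) (≤-trans size (size≤ D (modelLines (toℕ a)) inLines)))))
  where
  inLines : ∀ {n} → χ D n ≡ true → n ∈L modelLines (toℕ a)
  inLines {n} χn = subst (_∈L modelLines (toℕ a)) n≡ (∈-modelLines (toℕ a)
      (∈-fromCodes⁻ anchored (sub (χ-∈ D χn)))
      (subst (_∈L anchored) (trans (cong toℕ (line⇒∘ (proj₂ (proj₂ c)))) (toℕ-∘ a (pt n)))
        (∈-fromCodes⁻ anchored (sub (proj₁ (proj₂ c))))))
    where
    n≡ = toℕ-pt (χ-< D χn)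
    c : ∃ λ c → c ∈ D × IsLine a (pt n) c
    c = closed (pt n) (χ-∈ D χn)

lookup-injective : ∀ {A : Set} {xs : List A} → Unique xs → ∀ {i j} → L.lookup xs i ≡ L.lookup xs j → i ≡ j
lookup-injective (x∉ ∷ u) {zero}  {zero}  _ = refl
lookup-injective (x∉ ∷ u) {suc i} {suc j} e = cong suc (lookup-injective u e)
lookup-injective (x∉ ∷ u) {zero}  {suc j} e = contradiction e (All.lookup x∉ (∈-lookupL j))
lookup-injective (x∉ ∷ u) {suc i} {zero}  e = contradiction (sym e) (All.lookup x∉ (∈-lookupL i))

FourCoplanar : Point → PSet → Set
FourCoplanar a D = Σ Hyperplane λ H → Σ (Fin 4 → Point) λ b →
  (∀ i → b i ∈ D) × (∀ i j → i ≢ j → DiffALines a (b i) (b j)) × (∀ i → LineInH a (b i) H)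

dot-neg : ∀ d x → dot d (toℕ x) ≡ 0 → dot d (toℕ (origin ∘ x)) ≡ 0
dot-neg d x e = trans (dot-∘ d origin x) (cong₂ (λ s t → (2 * (s + t)) % 3) (dot-origin d) e)

module _ (d : ℕ) (d<80 : d < 80) where

  private
    w : Fin 4 → Fin 3
    w i = fromℕ< (digit<3 i (suc d))

    toℕ-w : ∀ i → toℕ (w i) ≡ digit i (suc d)
    toℕ-w i = toℕ-fromℕ< (digit<3 i (suc d))

    w-nonzero : ∃ λ i → w i ≢ 0F
    w-nonzero = some-nonzero w λ z → contradiction
      (trans (sym (code-digits (s≤s d<80))) (zero-digits (at z 0F) (at z 1F) (at z 2F) (at z 3F))) λ ()
      where
      at : (∀ i → w i ≡ 0F) → ∀ i → digit i (suc d) ≡ 0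
      at z i = trans (sym (toℕ-w i)) (cong toℕ (z i))
      zero-digits : ∀ {a b c e} → a ≡ 0 → b ≡ 0 → c ≡ 0 → e ≡ 0 → code a b c e ≡ 0
      zero-digits refl refl refl refl = refl

  orthogonalPlane : Hyperplane
  orthogonalPlane = hyp w 0F w-nonzero

  ∈-orthogonalPlane : ∀ x → dot (suc d) (toℕ x) ≡ 0 → x ∈H orthogonalPlane
  ∈-orthogonalPlane x e = trans (cong (_% 3) (cong₂ _+_ (cong₂ _+_ (cong₂ _+_ (term 0F) (term 1F)) (term 2F)) (term 3F)))
    e
    where
    term : ∀ i → toℕ (w i) * coord x i ≡ digit i (suc d) * digit i (toℕ x)
    term i = cong₂ _*_ (toℕ-w i) (coord-digit x i)

-- Distinct representatives lie on distinct lines through 0, because σ never contains r together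
-- with -r.
coplanar⇒fourCoplanar : ∀ {D} σ → Unique σ → (∀ {r} → r ∈L σ → χ D r ≡ true) →
  (∀ {r} → r ∈L σ → ¬ neg r ∈L σ) → coplanar σ ≡ true → FourCoplanar origin D
coplanar⇒fourCoplanar {D} σ σ-! σ⊆D antipodal e =
  pick (any-sound (λ d → atLeast 4 (filterᵇ (λ r → dot (suc d) r ≡ᵇ 0) σ)) (upTo 80) e)
  where
  pick : (∃ λ d → d ∈L upTo 80 × atLeast 4 (filterᵇ (λ r → dot (suc d) r ≡ᵇ 0) σ) ≡ true) → FourCoplanar origin D
  pick (d , d∈ , four) = orthogonalPlane d d<80 , b , (λ i → χ-∈ D (χr i)) ,
      (λ i j i≢j → (λ bi≡bj → i≢j (r-inj (trans (sym (toℕ-b i)) (trans (cong toℕ bi≡bj) (toℕ-b j))))) ,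
        λ l → antipodal (proj₁ (r∈ i)) (subst (_∈L σ) (trans (sym (toℕ-b j))
          (trans (cong toℕ (line⇒∘ l)) (trans (toℕ-neg (b i)) (cong neg (toℕ-b i))))) (proj₁ (r∈ j)))) ,
      λ i → ∈-orthogonalPlane d d<80 origin (dot-origin (suc d)) , ∈-orthogonalPlane d d<80 (b i) (dot-b i) ,
        λ c l → subst (_∈H orthogonalPlane d d<80) (sym (line⇒∘ l))
          (∈-orthogonalPlane d d<80 (origin ∘ b i) (dot-neg (suc d) (b i) (dot-b i)))
    where
    d<80 = ∈-upTo⁻ {80} d∈
    F = filterᵇ (λ r → dot (suc d) r ≡ᵇ 0) σ
    4≤ = atLeast-sound 4 F four
    r : Fin 4 → ℕ
    r i = L.lookup F (inject≤ i 4≤)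
    r-inj : ∀ {i j} → r i ≡ r j → i ≡ j
    r-inj {i} {j} eq = inject≤-injective 4≤ 4≤ i j (lookup-injective (Unique-filter⁺ (λ r → T? (dot (suc d) r ≡ᵇ 0)) σ-!)
      eq)
    r∈ : ∀ i → r i ∈L σ × (dot (suc d) (r i) ≡ᵇ 0) ≡ true
    r∈ i = ∈-filterᵇ⁻ (λ r → dot (suc d) r ≡ᵇ 0) σ (∈-lookupL (inject≤ i 4≤))
    χr : ∀ i → χ D (r i) ≡ true
    χr i = σ⊆D (proj₁ (r∈ i))
    b : Fin 4 → Point
    b i = pt (r i)
    toℕ-b : ∀ i → toℕ (b i) ≡ r i
    toℕ-b i = toℕ-pt (χ-< D (χr i))
    dot-b : ∀ i → dot (suc d) (toℕ (b i)) ≡ 0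
    dot-b i = trans (cong (dot (suc d)) (toℕ-b i)) (≡ᵇ-sound (proj₂ (r∈ i)))

module _ (w : Fin 4 → Fin 3) (k : Fin 3) (nonzero : ∃ λ i → w i ≢ 0F) where

  private
    H = hyp w k nonzero

  normal : ℕ
  normal = code (toℕ (w 0F)) (toℕ (w 1F)) (toℕ (w 2F)) (toℕ (w 3F))

  digit-normal : ∀ i → digit i normal ≡ toℕ (w i)
  digit-normal i = trans (digit-code (toℕ<n (w 0F)) (toℕ<n (w 1F)) (toℕ<n (w 2F)) (toℕ<n (w 3F)) i)
    (select-η (λ i → toℕ (w i)) i)

  normal-positive : ∃ λ d → d < 80 × suc d ≡ normal
  normal-positive = positive normal (code<81 (toℕ<n (w 0F)) (toℕ<n (w 1F)) (toℕ<n (w 2F)) (toℕ<n (w 3F))) digit-normal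
    where
    digit-0 : ∀ i → digit i 0 ≡ 0
    digit-0 0F = refl
    digit-0 1F = refl
    digit-0 2F = refl
    digit-0 3F = refl
    positive : ∀ m → m < 81 → (∀ i → digit i m ≡ toℕ (w i)) → ∃ λ d → d < 80 × suc d ≡ m
    positive zero    _       e = contradiction (toℕ-injective (trans (sym (e (proj₁ nonzero))) (digit-0 (proj₁ nonzero))))
      (proj₂ nonzero)
    positive (suc d) d<80    e = d , s≤s⁻¹ d<80 , refl

  dot-normal : ∀ x → x ∈H H → dot normal (toℕ x) ≡ toℕ k
  dot-normal x p = trans (cong (_% 3) (cong₂ _+_ (cong₂ _+_ (cong₂ _+_ (term 0F) (term 1F)) (term 2F)) (term 3F))) p
    where
    term : ∀ i → digit i normal * digit i (toℕ x) ≡ toℕ (w i) * coord x i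
    term i = cong₂ _*_ (digit-normal i) (sym (coord-digit x i))

same-line : ∀ {x y r s} → x ≡ pt r ⊎ x ≡ origin ∘ pt r → y ≡ pt s ⊎ y ≡ origin ∘ pt s → r ≡ s → x ≡ y ⊎ y ≡ origin ∘ x
same-line         (inj₁ p) (inj₁ q) refl = inj₁ (trans p (sym q))
same-line         (inj₂ p) (inj₂ q) refl = inj₁ (trans p (sym q))
same-line         (inj₁ p) (inj₂ q) refl = inj₂ (trans q (cong (origin ∘_) (sym p)))
same-line {r = r} (inj₂ p) (inj₁ q) refl = inj₂ (trans q (sym (trans (cong (origin ∘_) p) (∘-invol origin (pt r)))))

-- Each point b i is replaced by its representative, which lies in the same linear hyperplane. Two
-- points with the same representative would be equal or opposite, and both are excluded by
-- `DiffALines`.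
fourCoplanar⇒coplanar : ∀ σ → Bounded σ → ¬ 0 ∈L double σ → FourCoplanar origin (set σ) → coplanar σ ≡ true
fourCoplanar⇒coplanar σ bounded 0∉ (hyp w k nz , b , b∈ , diff , inH) = found (normal-positive w k nz)
  where
  ν = normal w k nz
  -- The anchor 0 lies in the hyperplane, so its level is 0.
  k≡0 : toℕ k ≡ 0
  k≡0 = trans (sym (dot-normal w k nz origin (proj₁ (inH 0F)))) (dot-origin ν)
  dot-b : ∀ i → dot ν (toℕ (b i)) ≡ 0
  dot-b i = trans (dot-normal w k nz (b i) (proj₁ (proj₂ (inH i)))) k≡0
  representative : ∀ i → ∃ λ r → r ∈L σ × dot ν r ≡ 0 × (b i ≡ pt r ⊎ b i ≡ origin ∘ pt r)
  representative i with ∈-double⁻ σ (∈-fromCodes⁻ (double σ) (b∈ i))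
  ... | inj₁ p = toℕ (b i) , p , dot-b i , inj₁ (sym (pt-toℕ (b i)))
  ... | inj₂ (r , r∈ , e) = r , r∈ , trans (cong (dot ν) r≡) (dot-neg ν (b i) (dot-b i)) ,
      inj₂ (trans (sym (pt-toℕ (b i))) (trans (cong pt (trans e (cong neg (sym (toℕ-pt (bounded r∈))))))
        (sym (pt-neg (pt r)))))
    where
    r≡ : r ≡ toℕ (origin ∘ b i)
    r≡ = trans (sym (neg-neg (bounded r∈))) (trans (cong neg (sym e)) (sym (toℕ-neg (b i))))
  r : Fin 4 → ℕ
  r i = proj₁ (representative i)
  b≢origin : ∀ i → origin ≢ b i
  b≢origin i e = 0∉ (∈-fromCodes⁻ (double σ) (subst (_∈ set σ) (sym e) (b∈ i)))
  opposite : ∀ i j → b j ≡ origin ∘ b i → IsLine origin (b i) (b j)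
  opposite i j e = subst (IsLine origin (b i)) (sym e) (∘-line (b≢origin i))
  r-inj : ∀ {i j} → r i ≡ r j → i ≡ j
  r-inj {i} {j} e = decidable-stable (i ≟F j) λ i≢j →
    [ proj₁ (diff i j i≢j) , (λ q → proj₂ (diff i j i≢j) (opposite i j q)) ]′
      (same-line (proj₂ (proj₂ (proj₂ (representative i)))) (proj₂ (proj₂ (proj₂ (representative j)))) e)
  found : (∃ λ d → d < 80 × suc d ≡ ν) → coplanar σ ≡ true
  found (d , d<80 , e) = any-complete (λ d → atLeast 4 (filterᵇ (λ r → dot (suc d) r ≡ᵇ 0) σ)) (upTo 80) (∈-upTo⁺ d<80)
    (atLeast-complete 4 F (length-⊆ (Unique-tabulate⁺ r-inj) into))
    where
    F = filterᵇ (λ r → dot (suc d) r ≡ᵇ 0) σ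
    into : ∀ {x} → x ∈L L.tabulate r → x ∈L F
    into x∈ with ∈-tabulate⁻ {f = r} x∈
    ... | i , refl = ∈-filterᵇ⁺ (λ r → dot (suc d) r ≡ᵇ 0) σ (proj₁ (proj₂ (representative i)))
      (subst (λ m → (dot m (r i) ≡ᵇ 0) ≡ true) (sym e) (subst (λ t → (t ≡ᵇ 0) ≡ true)
        (sym (proj₁ (proj₂ (proj₂ (representative i))))) refl))

-- Lines completed by a point

isYes-≡ : ∀ {A : Set} (d : Dec A) (b : Bool) → (A → b ≡ true) → (b ≡ true → A) → ⌊ d ⌋ ≡ b
isYes-≡ (yes a) b f g = sym (f a)
isYes-≡ (no ¬a) b f g = sym (¬-not λ e → ¬a (g e))

sum-map : ∀ {A : Set} (f : A → ℕ) xs → sum (map f xs) ≡ ∑ xs f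
sum-map f []       = refl
sum-map f (x ∷ xs) = cong (f x +_) (sum-map f xs)

if-∧ : ∀ a b → (if a ∧ b then 1 else 0) ≡ (if a then 1 else 0) * (if b then 1 else 0)
if-∧ true  b = sym (+-identityʳ (if b then 1 else 0))
if-∧ false b = refl

completedBy : PSet → Point → Point → Bool
completedBy S p x = lookup S x ∧ lookup S (p ∘ x)

module _ (p : Point) (S : PSet) (p∉S : p ∉ S) (xs : List Point) (xs-! : Unique xs) (xs-complete : ∀ x → x ∈L xs) where

  private
    completed : Point → Bool
    completed = completedBy S p

    term : ∀ x y → ⌊ (x ∈? S) ×-dec (y ∈? S) ×-dec isLine? p x y ⌋ ≡ completed x ∧ (toℕ (p ∘ x) ≡ᵇ toℕ y)
    term x y = isYes-≡ ((x ∈? S) ×-dec (y ∈? S) ×-dec isLine? p x y) (completed x ∧ (toℕ (p ∘ x) ≡ᵇ toℕ y)) forth back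
      where
      forth : (x ∈ S × y ∈ S × IsLine p x y) → completed x ∧ (toℕ (p ∘ x) ≡ᵇ toℕ y) ≡ true
      forth (x∈ , y∈ , l) = cong₂ _∧_ (cong₂ _∧_ (∈-lookup x∈) (trans (cong (lookup S) (sym (line⇒∘ l))) (∈-lookup y∈)))
        (trans (cong (λ z → toℕ z ≡ᵇ toℕ y) (sym (line⇒∘ l))) (≡ᵇ-refl (toℕ y)))
      back : completed x ∧ (toℕ (p ∘ x) ≡ᵇ toℕ y) ≡ true → x ∈ S × y ∈ S × IsLine p x y
      back e = x∈ , subst (_∈ S) z≡y (lookup-∈ (proj₂ both)) , subst (IsLine p x) z≡y (∘-line λ { refl → p∉S x∈ })
        where
        split = ∧-true {completed x} e
        both = ∧-true {lookup S x} (proj₁ split)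
        x∈ = lookup-∈ (proj₁ both)
        z≡y : p ∘ x ≡ y
        z≡y = toℕ-injective (≡ᵇ-sound (proj₂ split))

  -- For a given x the only possible partner on a line with p is p ∘ x, so the inner sum is an
  -- indicator. The condition p ∉ S ensures p ≠ x.
  pairs-count : sum (map (λ x → sum (map (λ y → if ⌊ (x ∈? S) ×-dec (y ∈? S) ×-dec isLine? p x y ⌋ then 1 else 0) xs)) xs)
                ≡ length (filterᵇ (completedBy S p) xs)
  pairs-count = begin
    sum (map (λ x → sum (map (f x) xs)) xs)
      ≡⟨ trans (sum-map (λ x → sum (map (f x) xs)) xs) (∑-cong xs λ {x} _ → trans (sum-map (f x) xs) (inner x)) ⟩
    ∑ xs (λ x → if completed x then 1 else 0)
      ≡⟨ ∑-filterᵇ completed xs (λ _ → 1) ⟩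
    ∑ (filterᵇ completed xs) (λ _ → 1)
      ≡⟨ trans (∑-const 1 (filterᵇ completed xs)) (*-identityʳ (length (filterᵇ completed xs))) ⟩
    length (filterᵇ completed xs) ∎
    where
    open ≡-Reasoning
    f : Point → Point → ℕ
    f x y = if ⌊ (x ∈? S) ×-dec (y ∈? S) ×-dec isLine? p x y ⌋ then 1 else 0
    inner : ∀ x → ∑ xs (f x) ≡ (if completed x then 1 else 0)
    inner x = trans (∑-cong xs λ {y} _ → trans (cong (λ b → if b then 1 else 0) (term x y))
      (if-∧ (completed x) (toℕ (p ∘ x) ≡ᵇ toℕ y)))
      (trans (∑-* (if completed x then 1 else 0) xs (δₚ (p ∘ x)))
        (trans (cong ((if completed x then 1 else 0) *_) (∑-δₚ xs-! (xs-complete (p ∘ x))))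
          (*-identityʳ (if completed x then 1 else 0))))

module _ (L : List ℕ) (L-! : Unique L) (bounded : Bounded L) (p : Point) where

  private
    S = fromCodes L

    completedCode : ℕ → Bool
    completedCode n = mem (third (toℕ p) n) L

    completedPoint : Point → Bool
    completedPoint = completedBy (fromCodes L) p

    lookup-∘ : ∀ x → lookup S (p ∘ x) ≡ completedCode (toℕ x)
    lookup-∘ x = trans (lookup-fromCodes L (p ∘ x)) (cong (λ n → mem n L) (toℕ-∘ p x))

  codes-count : ∀ xs → Unique xs → (∀ x → x ∈L xs) → length (filterᵇ (completedBy (fromCodes L) p) xs) ≡ length
    (filterᵇ completedCode L)
  codes-count xs xs-! complete = ≤-antisym
    (subst (_≤ length (filterᵇ completedCode L)) (length-map toℕ (filterᵇ completedPoint xs))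
      (length-⊆ (Unique-map⁺ toℕ-injective (Unique-filter⁺ (λ x → T? (completedPoint x)) xs-!)) into))
    (subst (length (filterᵇ completedCode L) ≤_) (length-map toℕ (filterᵇ completedPoint xs))
      (length-⊆ (Unique-filter⁺ (λ n → T? (completedCode n)) L-!) back))
    where
    into : ∀ {n} → n ∈L map toℕ (filterᵇ completedPoint xs) → n ∈L filterᵇ completedCode L
    into n∈ with ∈-map⁻ toℕ n∈
    ... | x , x∈ , refl = let _ , e = ∈-filterᵇ⁻ completedPoint xs x∈
                              inS , c = ∧-true {lookup S x} e in
      ∈-filterᵇ⁺ completedCode L (mem-sound L (trans (sym (lookup-fromCodes L x)) inS)) (trans (sym (lookup-∘ x)) c)
    back : ∀ {n} → n ∈L filterᵇ completedCode L → n ∈L map toℕ (filterᵇ completedPoint xs)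
    back {n} n∈ = let n∈L , c = ∈-filterᵇ⁻ completedCode L n∈
                      n≡ = toℕ-pt (bounded n∈L) in
      subst (_∈L map toℕ (filterᵇ completedPoint xs)) n≡
        (∈-map⁺ toℕ (∈-filterᵇ⁺ completedPoint xs (complete (pt n))
          (cong₂ _∧_ (∈-lookup (∈-fromCodes⁺ L (subst (_∈L L) (sym n≡) n∈L)))
                     (trans (lookup-∘ (pt n)) (trans (cong completedCode n≡) c)))))

  pairs-codes : p ∉ fromCodes L → ∀ xs → Unique xs → (∀ x → x ∈L xs) → (F : Point → Point → ℕ) →
    (∀ x y → F x y ≡ (if ⌊ (x ∈? fromCodes L) ×-dec (y ∈? fromCodes L) ×-dec isLine? p x y ⌋ then 1 else 0)) →
    sum (map (λ x → sum (map (F x) xs)) xs) ≡ length (filterᵇ completedCode L)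
  pairs-codes p∉ xs u c F e = trans
    (cong sum (map-cong (λ x → cong sum (map-cong (e x) xs)) xs))
    (trans (pairs-count p (fromCodes L) p∉ xs u c) (codes-count xs u c))

  orderedCompletions-codes : p ∉ fromCodes L → orderedCompletions p (fromCodes L) ≡ length (filterᵇ completedCode L)
  orderedCompletions-codes p∉ = pairs-codes p∉ (allFin 81) (allFin⁺ 81) ∈-allFin
    (λ x y → if ⌊ (x ∈? fromCodes L) ×-dec (y ∈? fromCodes L) ×-dec isLine? p x y ⌋ then 1 else 0) (λ x y → refl)

  completesOne-sound : completesOne L (toℕ p) ≡ true → CompletesExactlyOne p S
  completesOne-sound e = p∉ , trans (orderedCompletions-codes p∉) (≡ᵇ-sound (proj₂ split))
    where
    split = ∧-true {not (mem (toℕ p) L)} e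
    p∉ : p ∉ S
    p∉ p∈ with trans (sym (proj₁ split)) (cong not (mem-complete (∈-fromCodes⁻ L p∈)))
    ... | ()

  completesOne-complete : CompletesExactlyOne p S → completesOne L (toℕ p) ≡ true
  completesOne-complete (p∉ , e) = cong₂ _∧_ (cong not (¬-not λ q → p∉ (∈-fromCodes⁺ L (mem-sound L q))))
    (trans (cong (_≡ᵇ 2) (trans (sym (orderedCompletions-codes p∉)) e)) refl)

completionSet-codes : ∀ {L L′ M} → Unique L → Bounded L → Unique L′ → Bounded L′ →
  (∀ {n} → n < 81 → completesBoth L L′ n ≡ mem n M) → completionSet (fromCodes L) (fromCodes L′) ≡ fromCodes M
completionSet-codes {L} {L′} {M} u b u′ b′ e = subset-ext λ p → trans
  (lookup-completionSet (fromCodes L) (fromCodes L′) p)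
  (trans (isYes-≡ (completesExactlyOne? p (fromCodes L) ×-dec completesExactlyOne? p (fromCodes L′))
    (completesBoth L L′ (toℕ p))
      (λ (c , c′) → cong₂ _∧_ (completesOne-complete L u b p c) (completesOne-complete L′ u′ b′ p c′))
      (λ h → let c , c′ = ∧-true {completesOne L (toℕ p)} h in completesOne-sound L u b p c , completesOne-sound L′ u′ b′
        p c′))
    (trans (e (toℕ<n p)) (sym (lookup-fromCodes M p))))

-- Decompositions of the model

open Searched computed

images : List (List ℕ)
images = map proj₂ table

∧-true₇ : ∀ {a b c d e f g} → a ∧ b ∧ c ∧ d ∧ e ∧ f ∧ g ≡ true →
          a ≡ true × b ≡ true × c ≡ true × d ≡ true × e ≡ true × f ≡ true × g ≡ true
∧-true₇ {true} {true} {true} {true} {true} {true} e = refl , refl , refl , refl , refl , refl , e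

private
  checks = ∧-true₇ {length table ≡ᵇ 36} {pairwise distinctEntries table} {all decompositionCheck table}
    {all completionCheck table}
    {all (λ E → memL E ovoids) images} {all ovoidCheck ovoids} {all (pairCheck ovoids images) ovoids} checked

table-length : length table ≡ 36
table-length = let c , _ = checks in ≡ᵇ-sound c

table-distinct : AllPairs (λ e f → distinctEntries e f ≡ true) table
table-distinct = let _ , c , _ = checks in pairwise-sound distinctEntries table c

entry-decomposition : ∀ {e} → e ∈L table → decompositionCheck e ≡ true
entry-decomposition = let _ , _ , c , _ = checks in all-sound decompositionCheck table c

entry-completion : ∀ {e} → e ∈L table → completionCheck e ≡ true
entry-completion = let _ , _ , _ , c , _ = checks in all-sound completionCheck table c

image-ovoid : ∀ {E} → E ∈L images → E ∈L ovoids
image-ovoid E∈ = let _ , _ , _ , _ , c , _ = checks in memL-sound ovoids (all-sound (λ E → memL E ovoids) images c E∈)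

ovoid-checked : ∀ {M} → M ∈L ovoids → ovoidCheck M ≡ true
ovoid-checked = let _ , _ , _ , _ , _ , c , _ = checks in all-sound ovoidCheck ovoids c

pair-checked : ∀ {M} → M ∈L ovoids → pairCheck ovoids images M ≡ true
pair-checked = let _ , _ , _ , _ , _ , _ , c = checks in all-sound (pairCheck ovoids images) ovoids c

true≢false : ∀ {a} → a ≡ true → not a ≡ true → ⊥
true≢false {true} _ ()

not⇒false : ∀ {a} → not a ≡ true → a ≡ false
not⇒false {false} _ = refl

Antipodal : List ℕ → Set
Antipodal R = ∀ {r} → r ∈L R → ¬ neg r ∈L R

ovoid-antipodal : Antipodal ovoid
ovoid-antipodal r∈ q = true≢false (mem-complete q) (all-sound (λ r → not (mem (neg r) ovoid)) ovoid refl r∈)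

others-antipodal : Antipodal others
others-antipodal r∈ q = true≢false (mem-complete q) (all-sound (λ r → not (mem (neg r) others)) others refl r∈)

filterᵇ-cong : ∀ (p q : ℕ → Bool) xs → (∀ {x} → x ∈L xs → p x ≡ q x) → filterᵇ p xs ≡ filterᵇ q xs
filterᵇ-cong p q []       e = refl
filterᵇ-cong p q (x ∷ xs) e with p x | q x | e (here refl)
... | true  | .true  | refl = cong (x ∷_) (filterᵇ-cong p q xs λ x∈ → e (there x∈))
... | false | .false | refl = filterᵇ-cong p q xs λ x∈ → e (there x∈)

remove-filterᵇ : ∀ f xs → remove f xs ≡ filterᵇ (λ z → not (mem z f)) xs
remove-filterᵇ f []       = refl
remove-filterᵇ f (x ∷ xs) with mem x f
... | true  = remove-filterᵇ f xs
... | false = cong (x ∷_) (remove-filterᵇ f xs)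

-- As an equation of lists this fixes order and multiplicity, so L is determined by its members and
-- two lists naming the same set are equal.
Sublist : List ℕ → List ℕ → Set
Sublist R L = filterᵇ (λ r → mem r L) R ≡ L

sublist-⊆ : ∀ {R L} → Sublist R L → ∀ {n} → n ∈L L → n ∈L R
sublist-⊆ {R} {L} s {n} n∈ = proj₁ (∈-filterᵇ⁻ (λ r → mem r L) R (subst (n ∈L_) (sym s) n∈))

double-mono : ∀ {L R} → (∀ {n} → n ∈L L → n ∈L R) → ∀ {n} → n ∈L double L → n ∈L double R
double-mono {L} {R} f n∈ with ∈-double⁻ L n∈
... | inj₁ p               = ∈-doubleˡ (f p)
... | inj₂ (r , r∈ , refl) = ∈-doubleʳ R (f r∈)

module _ {R : List ℕ} (bounded : Bounded R) (antipodal : Antipodal R) where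

  double-∩ : ∀ {L r} → (∀ {n} → n ∈L L → n ∈L R) → r ∈L R → r ∈L double L → r ∈L L
  double-∩ {L} sub r∈ p with ∈-double⁻ L p
  ... | inj₁ q              = q
  ... | inj₂ (s , s∈ , refl) = contradiction r∈ (antipodal (sub s∈))

  set-injective : ∀ {L M} → Sublist R L → Sublist R M → set L ≡ set M → L ≡ M
  set-injective {L} {M} l m e = trans (sym l) (trans (filterᵇ-cong (λ r → mem r L) (λ r → mem r M) R agree) m)
    where
    move : ∀ {L M r} → Sublist R L → Sublist R M → set L ≡ set M → r ∈L R → mem r L ≡ true → mem r M ≡ true
    move {L} {M} {r} l m e r∈ q = mem-complete (double-∩ (sublist-⊆ m) r∈
      (χ-set⁻ M (subst (λ S → χ S r ≡ true) e (χ-set⁺ L (λ n∈ → bounded (sublist-⊆ l n∈)) (∈-doubleˡ (mem-sound L q))))))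
    agree : ∀ {r} → r ∈L R → mem r L ≡ mem r M
    agree {r} r∈ = bool-ext (move l m e r∈) (move m l (sym e) r∈)

  set-disjoint : ∀ {L M} → (∀ {n} → n ∈L L → n ∈L R) → (∀ {n} → n ∈L M → n ∈L R) → (∀ {n} → n ∈L L → ¬ n ∈L M) → Disjoint
    (set L) (set M)
  set-disjoint {L} {M} l m apart x x∈ x∈′ = clash (∈-double⁻ L (∈-fromCodes⁻ (double L) x∈))
    (∈-double⁻ M (∈-fromCodes⁻ (double M) x∈′))
    where
    clash : (toℕ x ∈L L ⊎ ∃ λ r → r ∈L L × toℕ x ≡ neg r) → (toℕ x ∈L M ⊎ ∃ λ r → r ∈L M × toℕ x ≡ neg r) → ⊥
    clash (inj₁ p) (inj₁ q) = apart p q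
    clash (inj₁ p) (inj₂ (s , s∈ , e)) = antipodal (m s∈) (subst (_∈L R) e (l p))
    clash (inj₂ (r , r∈ , e)) (inj₁ q) = antipodal (l r∈) (subst (_∈L R) e (m q))
    clash (inj₂ (r , r∈ , e)) (inj₂ (s , s∈ , e′)) = apart r∈ (subst (_∈L M) (sym r≡s) s∈)
      where
      r≡s : r ≡ s
      r≡s = trans (sym (neg-neg (bounded (l r∈)))) (trans (cong neg (trans (sym e) e′)) (neg-neg (bounded (m s∈))))

Cap-⊆ : ∀ {S T} → (∀ {x} → x ∈ S → x ∈ T) → Cap T → Cap S
Cap-⊆ sub cap x y z x∈ y∈ z∈ = cap x y z (sub x∈) (sub y∈) (sub z∈)

origin∉ : ∀ {L} → ¬ 0 ∈L double L → origin ∉ set L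
origin∉ {L} 0∉ p = 0∉ (∈-fromCodes⁻ (double L) p)

record Half (σ : List ℕ) : Set where
  field
    five       : length σ ≡ 5
    sublist    : Sublist ovoid σ
    unique     : Unique (double σ)
    nonplanar  : coplanar σ ≡ false

  ⊆ovoid : ∀ {n} → n ∈L σ → n ∈L ovoid
  ⊆ovoid = sublist-⊆ sublist

  bounded : Bounded σ
  bounded n∈ = ovoid-bounded (⊆ovoid n∈)

  ⊆model : ∀ {x} → x ∈ set σ → x ∈ model
  ⊆model x∈ = ∈-fromCodes⁺ anchored (double-mono ⊆ovoid (∈-fromCodes⁻ (double σ) x∈))

  0∉ : ¬ 0 ∈L double σ
  0∉ p = 0∉ovoid (double-mono ⊆ovoid p)

  demicap : DemicapWith origin (set σ)
  demicap = Cap-⊆ ⊆model model-cap , origin∉ {σ} 0∉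
    , trans (size-fromCodes (double σ) unique (double-bounded σ bounded)) (trans (length-double σ) (cong₂ _+_ five five))
    , symmetric⇒closed (origin∉ {σ} 0∉) (set-symmetric σ bounded)
    , λ v → true-false (fourCoplanar⇒coplanar σ bounded 0∉ v) nonplanar
    where
    true-false : ∀ {a} → a ≡ true → a ≡ false → ⊥
    true-false refl ()

module _ {σ σ′ : List ℕ} (left : Half σ) (right : Half σ′) where

  halves-disjoint : (∀ {n} → n ∈L σ → ¬ n ∈L σ′) → Disjoint (set σ) (set σ′)
  halves-disjoint = set-disjoint ovoid-bounded ovoid-antipodal (Half.⊆ovoid left) (Half.⊆ovoid right)

  module _ (cover : ∀ {n} → n ∈L ovoid → n ∈L σ ⊎ n ∈L σ′) where

    cover-double : ∀ {n} → n ∈L ovoid ⊎ (∃ λ r → r ∈L ovoid × n ≡ neg r) → n ∈L double σ ⊎ n ∈L double σ′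
    cover-double (inj₁ p)               = ⊎-map ∈-doubleˡ ∈-doubleˡ (cover p)
    cover-double (inj₂ (r , r∈ , refl)) = ⊎-map (∈-doubleʳ σ) (∈-doubleʳ σ′) (cover r∈)

    halves-cover : ∀ x → x ∈ model → x ∈ set σ ⊎ x ∈ set σ′
    halves-cover x x∈ = ⊎-map (∈-fromCodes⁺ (double σ)) (∈-fromCodes⁺ (double σ′))
      (cover-double (∈-double⁻ ovoid (∈-fromCodes⁻ anchored x∈)))

    halves-union : model ≡ set σ ∪ set σ′
    halves-union = subset-antisym {p = model} {q = set σ ∪ set σ′}
      (λ x x∈ → x∈p∪q⁺ {p = set σ} {q = set σ′} (halves-cover x x∈))
      (λ x x∈ → [ Half.⊆model left , Half.⊆model right ]′ (x∈p∪q⁻ (set σ) (set σ′) x∈))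

left right : Entry → List ℕ
left  e = proj₁ (proj₁ e)
right e = proj₂ (proj₁ e)

record Splitting (e : Entry) : Set where
  field
    left-half  : Half (left e)
    right-half : Half (right e)
    apart      : ∀ {n} → n ∈L left e → ¬ n ∈L right e
    cover      : ∀ {n} → n ∈L ovoid → n ∈L left e ⊎ n ∈L right e

  decomposition : Decomposition model (set (left e)) (set (right e))
  decomposition = (origin , Half.demicap left-half) , (origin , Half.demicap right-half)
    , halves-disjoint left-half right-half apart , halves-union left-half right-half cover

splitting : ∀ {e} → e ∈L table → Splitting e
splitting {e@((σ , σ′) , E)} e∈ = record
  { left-half  = left-σ
  ; right-half = right-σ
  ; apart = λ p q → true≢false (mem-complete q) (all-sound (λ r → not (mem r σ′)) σ (c₇ .proj₁) p)
  ; cover = λ {n} p → cover-split (all-sound (λ r → mem r σ ∨ mem r σ′) ovoid (c₈ .proj₁) p)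
  }
  where
  c₁ = ∧-true {length σ ≡ᵇ 5} (entry-decomposition e∈)
  c₂ = ∧-true {length σ′ ≡ᵇ 5} (c₁ .proj₂)
  c₃ = ∧-true {filterᵇ (λ r → mem r σ) ovoid == σ} (c₂ .proj₂)
  c₄ = ∧-true {filterᵇ (λ r → mem r σ′) ovoid == σ′} (c₃ .proj₂)
  c₅ = ∧-true {nodup (double σ)} (c₄ .proj₂)
  c₆ = ∧-true {nodup (double σ′)} (c₅ .proj₂)
  c₇ = ∧-true {all (λ r → not (mem r σ′)) σ} (c₆ .proj₂)
  c₈ = ∧-true {all (λ r → mem r σ ∨ mem r σ′) ovoid} (c₇ .proj₂)
  c₉ = ∧-true {not (coplanar σ)} (c₈ .proj₂)
  left-σ : Half σ
  left-σ = record { five = ≡ᵇ-sound (c₁ .proj₁) ; sublist = ==-sound (c₃ .proj₁)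
    ; unique = nodup-sound (double σ) (c₅ .proj₁) ; nonplanar = not⇒false (c₉ .proj₁) }
  right-σ : Half σ′
  right-σ = record { five = ≡ᵇ-sound (c₂ .proj₁) ; sublist = ==-sound (c₄ .proj₁)
    ; unique = nodup-sound (double σ′) (c₆ .proj₁) ; nonplanar = not⇒false (c₉ .proj₂) }
  cover-split : ∀ {n} → mem n σ ∨ mem n σ′ ≡ true → n ∈L σ ⊎ n ∈L σ′
  cover-split {n} h with mem n σ in eq
  ... | true  = inj₁ (mem-sound σ eq)
  ... | false = inj₂ (mem-sound σ′ h)

entry-image : ∀ {e} → e ∈L table → completionSet (set (left e)) (set (right e)) ≡ set (proj₂ e)
entry-image {e} e∈ = completionSet-codes {double (left e)} {double (right e)} {double (proj₂ e)}
    (Half.unique left-half) (double-bounded (left e) (Half.bounded left-half))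
    (Half.unique right-half) (double-bounded (right e) (Half.bounded right-half))
    λ n<81 → iff-≡ (all<-sound 81 (λ n → completesBoth (double (left e)) (double (right e)) n iff mem n
      (double (proj₂ e))) (entry-completion e∈) n<81)
  where open Splitting (splitting e∈) using (left-half; right-half)

Decomposition-sym : ∀ {C D D′} → Decomposition C D D′ → Decomposition C D′ D
Decomposition-sym {C} {D} {D′} (d , d′ , dis , e) = d′ , d , (λ x x∈′ x∈ → dis x x∈ x∈′) , trans e (∪-comm D D′)

halve-≤ : ∀ k {n} → k + k ≤ n + n → k ≤ n
halve-≤ k {n} h with k ≤? n
... | yes p = p
... | no k≰n = contradiction h (<⇒≱ (+-mono-< (≰⇒> k≰n) (≰⇒> k≰n)))

module _ {D D′ : PSet} (dec : Decomposition model D D′) where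

  private
    p = χ D
    σ  = filterᵇ p ovoid
    σ′ = filterᵇ (λ r → not (p r)) ovoid

  module FromDemicap (a : Point) {D : PSet} (sub : ∀ {x} → x ∈ D → x ∈ model) (d : DemicapWith a D) where
    a≡origin : a ≡ origin
    a≡origin = anchor-origin sub (≤-reflexive (sym (proj₁ (proj₂ (proj₂ d))))) (proj₁ (proj₂ (proj₂ (proj₂ d))))
    half = filterᵇ (χ D) ovoid
    d′ : DemicapWith origin D
    d′ = subst (λ a → DemicapWith a D) a≡origin d
    symmetric : Symmetric D
    symmetric = closed⇒symmetric (proj₁ (proj₂ (proj₂ (proj₂ d′))))
    represented : D ≡ set half
    represented = symmetric-set ovoid ovoid-bounded symmetric
      (λ χn → subst (_∈L anchored) (toℕ-pt (χ-< D χn)) (∈-fromCodes⁻ anchored (sub (χ-∈ D χn))))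
    -- A lower bound is enough for `isDecomposition`: complementary parts of a ten-element list with
    -- at least five elements each have exactly five.
    large : 5 ≤ length half
    large = halve-≤ 5 (subst (10 ≤_) (length-double half)
      (≤-trans (≤-reflexive (sym (proj₁ (proj₂ (proj₂ d′))))) (size≤ D (double half)
        (λ {n} χn → χ-set⁻ half (subst (λ S → χ S n ≡ true) represented χn)))))
    nonplanar : coplanar half ≡ false
    nonplanar = ¬-not λ e → proj₂ (proj₂ (proj₂ (proj₂ d′)))
      (coplanar⇒fourCoplanar half (Unique-filter⁺ (λ r → T? (χ D r)) (nodup-sound ovoid refl))
        (λ r∈ → proj₂ (∈-filterᵇ⁻ (χ D) ovoid r∈))
        (λ r∈ q → ovoid-antipodal (proj₁ (∈-filterᵇ⁻ (χ D) ovoid r∈)) (proj₁ (∈-filterᵇ⁻ (χ D) ovoid q))) e)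

  private
    ⊆ˡ : ∀ {x} → x ∈ D → x ∈ model
    ⊆ˡ {x} x∈ = subst (x ∈_) (sym (proj₂ (proj₂ (proj₂ dec)))) (x∈p∪q⁺ (inj₁ x∈))
    ⊆ʳ : ∀ {x} → x ∈ D′ → x ∈ model
    ⊆ʳ {x} x∈ = subst (x ∈_) (sym (proj₂ (proj₂ (proj₂ dec)))) (x∈p∪q⁺ (inj₂ x∈))
    module Left = FromDemicap (proj₁ (proj₁ dec)) ⊆ˡ (proj₂ (proj₁ dec))
    module Right = FromDemicap (proj₁ (proj₁ (proj₂ dec))) ⊆ʳ (proj₂ (proj₁ (proj₂ dec)))

  ∈-model : ∀ {n} → n ∈L anchored → χ D n ≡ true ⊎ χ D′ n ≡ true
  ∈-model {n} n∈ = ⊎-map into into (x∈p∪q⁻ D D′ (subst (pt n ∈_) (proj₂ (proj₂ (proj₂ dec)))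
    (∈-fromCodes⁺ anchored (subst (_∈L anchored) (sym n≡) n∈))))
    where
    n≡ : toℕ (pt n) ≡ n
    n≡ = toℕ-pt (double-bounded ovoid ovoid-bounded n∈)
    into : ∀ {S} → pt n ∈ S → χ S n ≡ true
    into {S} q = subst (λ m → χ S m ≡ true) n≡ (∈-χ S q)

  entry : χ D 12 ≡ true → ∃ λ E → ((σ , σ′) , E) ∈L table × D ≡ set σ × D′ ≡ set σ′
  entry χ12 = proj₁ found , proj₂ found , Left.represented , trans Right.represented (cong set complement)
    where
    complement : filterᵇ (χ D′) ovoid ≡ σ′
    complement = filterᵇ-cong (χ D′) (λ r → not (p r)) ovoid λ r∈ → exclusive (∈-model (∈-doubleˡ r∈))
      (λ e e′ → proj₁ (proj₂ (proj₂ dec)) _ (χ-∈ D e) (χ-∈ D′ e′))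
      where
      exclusive : ∀ {a b} → a ≡ true ⊎ b ≡ true → (a ≡ true → b ≡ true → ⊥) → b ≡ not a
      exclusive {true}  {true}  _ f = ⊥-elim (f refl refl)
      exclusive {true}  {false} _ _ = refl
      exclusive {false} {true}  _ _ = refl
      exclusive {false} {false} (inj₁ ()) _
      exclusive {false} {false} (inj₂ ()) _
    good : isDecomposition (σ , σ′) ≡ true
    good = cong₂ _∧_ (mem-complete (∈-filterᵇ⁺ p ovoid (here refl) χ12))
      (cong₂ _∧_ (atLeast-complete 5 σ Left.large)
      (cong₂ _∧_ (atLeast-complete 5 σ′ (subst (λ l → 5 ≤ length l) complement Right.large))
      (cong₂ _∧_ (cong not Left.nonplanar) (cong not (subst (λ l → coplanar l ≡ false) complement Right.nonplanar)))))
    found = table-complete p good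

EntryOf : PSet → PSet → Set
EntryOf D D′ = ∃ λ e → e ∈L table ×
  ((D ≡ set (left e) × D′ ≡ set (right e)) ⊎ (D ≡ set (right e) × D′ ≡ set (left e)))

12∈anchored : 12 ∈L anchored
12∈anchored = here refl

-- The table keeps one order of each decomposition, so the half containing 12 is put first.
entry-of : ∀ {D D′} → Decomposition model D D′ → EntryOf D D′
entry-of {D} {D′} dec = choose (∈-model dec 12∈anchored)
  where
  choose : χ D 12 ≡ true ⊎ χ D′ 12 ≡ true → EntryOf D D′
  choose (inj₁ h) = let E , e∈ , p , q = entry dec h in (_ , E) , e∈ , inj₁ (p , q)
  choose (inj₂ h) = let E , e∈ , p , q = entry (Decomposition-sym dec) h in (_ , E) , e∈ , inj₂ (q , p)

-- Partitions containing the model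

record Ovoid (M : List ℕ) : Set where
  field
    ten     : length M ≡ 10
    sublist : Sublist others M
    unique  : Unique (double M)
    cap     : Cap (set M)

  ⊆others : ∀ {n} → n ∈L M → n ∈L others
  ⊆others = sublist-⊆ sublist

  bounded : Bounded M
  bounded n∈ = others-bounded (⊆others n∈)

  0∉ : ¬ 0 ∈L double M
  0∉ p = 0∉others (double-mono ⊆others p)

  max : MaxCap (set M)
  max = maxCap cap (trans (size-fromCodes (double M) unique (double-bounded M bounded))
    (trans (length-double M) (cong₂ _+_ ten ten)))

  anchor : AnchorOf origin (set M)
  anchor = origin∉ {M} 0∉ , symmetric⇒closed (origin∉ {M} 0∉) (set-symmetric M bounded)

  disjoint : Disjoint model (set M)
  disjoint x x∈ x∈′ = ovoid-others (double-mono ⊆others (∈-fromCodes⁻ (double M) x∈′)) (∈-fromCodes⁻ anchored x∈)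

isOvoid : ∀ {M} → M ∈L ovoids → Ovoid M
isOvoid {M} M∈ = record
  { ten     = ≡ᵇ-sound (proj₁ c₁)
  ; sublist = ==-sound (proj₁ c₂)
  ; unique  = nodup-sound (double M) (proj₁ c₃)
  ; cap     = isCapᵇ-sound (double M) (proj₂ c₃)
  }
  where
  c₁ = ∧-true {length M ≡ᵇ 10} (ovoid-checked M∈)
  c₂ = ∧-true {filterᵇ (λ r → mem r M) others == M} (proj₂ c₁)
  c₃ = ∧-true {nodup (double M)} (proj₂ c₂)

rep-symmetric : ∀ {S} → Symmetric S → ∀ {n} → n < 81 → χ S (rep n) ≡ true → χ S n ≡ true
rep-symmetric {S} symm {n} n<81 = choose (n <ᵇ neg n) n (neg n) λ e → subst (λ m → χ S m ≡ true) (neg-neg n<81) (symm e)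
  where
  choose : ∀ b k m → (χ S m ≡ true → χ S k ≡ true) → χ S (if b then k else m) ≡ true → χ S k ≡ true
  choose true  k m f e = e
  choose false k m f e = f e

-- By symmetry, if a normalised third point belonged to S, so would the actual third point of the
-- line through x and c, or through x and -c, which the cap excludes.
conicRow-sound : ∀ {S} → Cap S → Symmetric S → ∀ {x c} → χ S x ≡ true → χ S c ≡ true → ∀ {z} → z ∈L conicRow x c → χ S z ≡
  false
conicRow-sound {S} cap symm {x} {c} χx χc {z} z∈ = on-line (proj₂ (proj₂ guard))
  where
  guarded : ∀ a b (xs : List ℕ) → z ∈L (if a ∨ b then [] else xs) → a ≡ false × b ≡ false × z ∈L xs
  guarded false false xs p = refl , refl , p
  guard : (x ≡ᵇ c) ≡ false × (x ≡ᵇ neg c) ≡ false × z ∈L rep (third x c) ∷ rep (third x (neg c)) ∷ []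
  guard = guarded (x ≡ᵇ c) (x ≡ᵇ neg c) (rep (third x c) ∷ rep (third x (neg c)) ∷ []) z∈
  avoid : ∀ d → χ S d ≡ true → (x ≡ᵇ d) ≡ false → χ S (rep (third x d)) ≡ false
  avoid d χd e = ¬-not λ h → true≢false (rep-symmetric symm (third<81 x d) h)
    (cong not (lineForbidden-sound cap {x} {d ∷ []} χx (χd ∷ [])
      (∈-map⁺ (third x) (∈-filterᵇ⁺ (λ c → not (x ≡ᵇ c)) (d ∷ []) (here refl) (cong not e)))))
  on-line : ∀ {z} → z ∈L rep (third x c) ∷ rep (third x (neg c)) ∷ [] → χ S z ≡ false
  on-line (here e)         = subst (λ n → χ S n ≡ false) (sym e) (avoid c χc (proj₁ guard))
  on-line (there (here e)) = subst (λ n → χ S n ≡ false) (sym e) (avoid (neg c) (symm χc) (proj₁ (proj₂ guard)))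

representatives : PSet → List ℕ
representatives S = filterᵇ (χ S) others

module _ {S : PSet} (max : MaxCap S) (anchor : AnchorOf origin S) (disjoint : Disjoint model S) where

  private
    symm : Symmetric S
    symm = closed⇒symmetric (proj₂ anchor)

    in-others : ∀ {n} → χ S n ≡ true → n ∈L double others
    in-others {n} χn = [ (λ { refl → ⊥-elim (proj₁ anchor (χ-∈ S χn)) }) ,
      [ (λ p → ⊥-elim (disjoint (pt n) (∈-fromCodes⁺ anchored (subst (_∈L anchored) (sym (toℕ-pt (χ-< S χn))) p))
        (χ-∈ S χn))) , (λ p → p) ]′ ]′
      (covers (χ-< S χn))

    forbidden-sound : ∀ {x chosen} → χ S x ≡ true → All (λ c → χ S c ≡ true) chosen →
                      ∀ {z} → z ∈L tableForbidden (tabulated conicRow 81) x chosen → χ S z ≡ false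
    forbidden-sound {x} {chosen} χx χc z∈ = let
      c , c∈ , q = ∈-tableForbidden conicRow 81 (χ-< S χx) (All.map (χ-< S) χc) z∈ in
      conicRow-sound (proj₁ max) symm χx (All.lookup χc c∈) q

  block-set : S ≡ set (representatives S)
  block-set = symmetric-set others others-bounded symm in-others

  -- Anchored at 0 and disjoint from the model, the 20 points of S form at least ten pairs over
  -- `others`; the search is complete for such sets.
  block-ovoid : representatives S ∈L ovoids
  block-ovoid = ovoids-complete (χ S) forbidden-sound (halve-≤ 10 (subst (20 ≤_) (length-double (representatives S))
    (≤-trans (≤-reflexive (sym (maxCap-size max))) (size≤ S (double (representatives S))
      (λ {n} χn → χ-set⁻ (representatives S) (subst (λ T → χ T n ≡ true) block-set χn))))))

any-false : ∀ {A : Set} (p : A → Bool) xs → (∀ {x} → x ∈L xs → p x ≡ false) → any p xs ≡ false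
any-false p []       h = refl
any-false p (x ∷ xs) h rewrite h (here refl) = any-false p xs λ x∈ → h (there x∈)

false-any : ∀ {A : Set} (p : A → Bool) xs → any p xs ≡ false → ∀ {x} → x ∈L xs → p x ≡ false
false-any p (x ∷ xs) e (here refl) with p x
... | false = refl
false-any p (y ∷ xs) e (there x∈) with p y
... | false = false-any p xs e x∈

completing-intro : ∀ os M A → any (λ r → mem r M) A ≡ false → memL (rest₂ M A) os ≡ true → completing os M A ≡ true
completing-intro os M A e f = cong₂ _∧_ (cong not e) f

completing-elim : ∀ os M A → completing os M A ≡ true → any (λ r → mem r M) A ≡ false × memL (rest₂ M A) os ≡ true
completing-elim os M A h = let e , f = ∧-true {not (any (λ r → mem r M) A)} h in not⇒false e , f

module _ {a : Point} {C′ C₃ C₄ : PSet} (P : Partition a model C′ C₃ C₄) where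

  partition-anchor : a ≡ origin
  partition-anchor = let _ , _ , _ , _ , anchorₘ , _ = P in
    anchor-origin (λ x∈ → x∈) (≤-trans (≤ᵇ⇒≤ 10 20 _) (≤-reflexive (sym model-size))) (proj₂ anchorₘ)

module _ {C′ C₃ C₄ : PSet} (P : Partition origin model C′ C₃ C₄) where

  private
    M′ = representatives C′
    M₃ = representatives C₃
    M₄ = representatives C₄

  partition-second : M′ ∈L ovoids × C′ ≡ set M′
  partition-second = let _ , m , _ , _ , _ , an , _ , _ , d , _ = P in block-ovoid m an d , block-set m an d

  partition-third : M₃ ∈L ovoids × C₃ ≡ set M₃
  partition-third = let _ , _ , m , _ , _ , _ , an , _ , _ , d , _ = P in block-ovoid m an d , block-set m an d

  partition-fourth : M₄ ∈L ovoids × C₄ ≡ set M₄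
  partition-fourth = let _ , _ , _ , m , _ , _ , _ , an , _ , _ , d , _ = P in block-ovoid m an d , block-set m an d

  private
    d₂₃ : Disjoint C′ C₃
    d₂₃ = let _ , _ , _ , _ , _ , _ , _ , _ , _ , _ , _ , d , _ = P in d
    d₂₄ : Disjoint C′ C₄
    d₂₄ = let _ , _ , _ , _ , _ , _ , _ , _ , _ , _ , _ , _ , d , _ = P in d
    d₃₄ : Disjoint C₃ C₄
    d₃₄ = let _ , _ , _ , _ , _ , _ , _ , _ , _ , _ , _ , _ , _ , d , _ = P in d
    everything : ∀ p → p ≡ origin ⊎ p ∈ model ⊎ p ∈ C′ ⊎ p ∈ C₃ ⊎ p ∈ C₄
    everything = let _ , _ , _ , _ , _ , _ , _ , _ , _ , _ , _ , _ , _ , _ , c = P in c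

    apart : ∀ {S T} → Disjoint S T → ∀ {n} → χ S n ≡ true → χ T n ≡ true → ⊥
    apart {S} {T} d {n} e e′ = d (pt n) (χ-∈ S e) (χ-∈ T e′)

    χ-of : ∀ {S r} → r ∈L representatives S → χ S r ≡ true
    χ-of {S} r∈ = proj₂ (∈-filterᵇ⁻ (χ S) others r∈)

  -- The blocks are disjoint and cover everything, so the fourth block has exactly the
  -- representatives outside M′ and M₃.
  partition-rest : rest₂ M′ M₃ ≡ M₄
  partition-rest = trans (rest₂-remove M′ M₃) (trans (remove-filterᵇ (M′ ++ M₃) others)
    (filterᵇ-cong (λ r → not (mem r (M′ ++ M₃))) (χ C₄) others
      λ r∈ → bool-ext (λ e → located r∈ (not⇒false e)) (λ e → cong not
        (¬-not λ q → elsewhere e (∈-++⁻ M′ (mem-sound (M′ ++ M₃) q))))))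
    where
    elsewhere : ∀ {r} → χ C₄ r ≡ true → r ∈L M′ ⊎ r ∈L M₃ → ⊥
    elsewhere e (inj₁ p) = apart d₂₄ (χ-of {C′} p) e
    elsewhere e (inj₂ p) = apart d₃₄ (χ-of {C₃} p) e
    located : ∀ {r} → r ∈L others → mem r (M′ ++ M₃) ≡ false → χ C₄ r ≡ true
    located {r} r∈ e = place (everything (pt r))
      where
      r≡ : toℕ (pt r) ≡ r
      r≡ = toℕ-pt (others-bounded r∈)
      within : ∀ {S} → pt r ∈ S → χ S r ≡ true
      within {S} p = subst (λ m → χ S m ≡ true) r≡ (∈-χ S p)
      absurd : r ∈L M′ ++ M₃ → χ C₄ r ≡ true
      absurd p = ⊥-elim (true≢false (mem-complete p) (cong not e))
      place : pt r ≡ origin ⊎ pt r ∈ model ⊎ pt r ∈ C′ ⊎ pt r ∈ C₃ ⊎ pt r ∈ C₄ → χ C₄ r ≡ true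
      place (inj₁ p) = ⊥-elim (0∉others (∈-doubleˡ (subst (_∈L others) (trans (sym r≡) (cong toℕ p)) r∈)))
      place (inj₂ (inj₁ p)) = ⊥-elim (ovoid-others (∈-doubleˡ r∈) (subst (_∈L anchored) r≡ (∈-fromCodes⁻ anchored p)))
      place (inj₂ (inj₂ (inj₁ p))) = absurd (∈-++⁺ˡ (∈-filterᵇ⁺ (χ C′) others r∈ (within p)))
      place (inj₂ (inj₂ (inj₂ (inj₁ p)))) = absurd (∈-++⁺ʳ M′ (∈-filterᵇ⁺ (χ C₃) others r∈ (within p)))
      place (inj₂ (inj₂ (inj₂ (inj₂ p)))) = within p

  private
    M₃-apart : any (λ r → mem r M′) M₃ ≡ false
    M₃-apart = any-false (λ r → mem r M′) M₃ λ r∈ → ¬-not λ q → apart d₂₃ (χ-of {C′} (mem-sound M′ q)) (χ-of {C₃} r∈)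

    rest-listed : memL (rest₂ M′ M₃) ovoids ≡ true
    rest-listed = memL-complete (subst (_∈L ovoids) (sym partition-rest) (proj₁ partition-fourth))

  partition-completions : M₃ ∈L completions ovoids M′
  partition-completions = ∈-filterᵇ⁺ (completing ovoids M′) ovoids (proj₁ partition-third)
    (completing-intro ovoids M′ M₃ M₃-apart rest-listed)

  partition-fourth-set : C₄ ≡ set (rest₂ M′ M₃)
  partition-fourth-set = trans (proj₂ partition-fourth) (cong set (sym partition-rest))

remove-∉ : ∀ f xs {n} → n ∈L remove f xs → ¬ n ∈L f
remove-∉ f xs {n} n∈ p = true≢false (mem-complete p) (proj₂ (∈-filterᵇ⁻ (λ z → not (mem z f)) xs
  (subst (n ∈L_) (remove-filterᵇ f xs) n∈)))

remove-cover : ∀ M A xs {n} → n ∈L xs → n ∈L M ⊎ n ∈L A ⊎ n ∈L remove (M ++ A) xs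
remove-cover M A xs {n} n∈ with mem n (M ++ A) in e
... | true  = [ inj₁ , (λ p → inj₂ (inj₁ p)) ]′ (∈-++⁻ M (mem-sound (M ++ A) e))
... | false = inj₂ (inj₂ (∈-remove (M ++ A) xs n∈ e))

three-ovoids : ∀ {M A B} → Ovoid M → Ovoid A → Ovoid B → (∀ {n} → n ∈L M → ¬ n ∈L A) → (∀ {n} → n ∈L B → ¬ n ∈L M ++ A) →
  (∀ {n} → n ∈L others → n ∈L M ⊎ n ∈L A ⊎ n ∈L B) → Partition origin model (set M) (set A) (set B)
three-ovoids {M} {A} {B} M-ok A-ok B-ok apart-MA B-outside cover =
  model-max , M.max , A.max , B.max
    , (origin∉ {ovoid} 0∉ovoid , symmetric⇒closed (origin∉ {ovoid} 0∉ovoid) (set-symmetric ovoid ovoid-bounded))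
    , M.anchor , A.anchor , B.anchor , M.disjoint , A.disjoint , B.disjoint
    , set-disjoint others-bounded others-antipodal M.⊆others A.⊆others apart-MA
    , set-disjoint others-bounded others-antipodal M.⊆others B.⊆others (λ p q → B-outside q (∈-++⁺ˡ p))
    , set-disjoint others-bounded others-antipodal A.⊆others B.⊆others (λ p q → B-outside q (∈-++⁺ʳ M p))
    , λ p → point p (covers (toℕ<n p))
  where
  module M = Ovoid M-ok
  module A = Ovoid A-ok
  module B = Ovoid B-ok
  place : ∀ {n} → n ∈L others ⊎ (∃ λ r → r ∈L others × n ≡ neg r) → n ∈L double M ⊎ n ∈L double A ⊎ n ∈L double B
  place (inj₁ p)               = ⊎-map ∈-doubleˡ (⊎-map ∈-doubleˡ ∈-doubleˡ) (cover p)
  place (inj₂ (r , r∈ , refl)) = ⊎-map (∈-doubleʳ M) (⊎-map (∈-doubleʳ A) (∈-doubleʳ B)) (cover r∈)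
  point : ∀ p → toℕ p ≡ 0 ⊎ toℕ p ∈L double ovoid ⊎ toℕ p ∈L double others →
          p ≡ origin ⊎ p ∈ model ⊎ p ∈ set M ⊎ p ∈ set A ⊎ p ∈ set B
  point p (inj₁ e)        = inj₁ (toℕ-injective e)
  point p (inj₂ (inj₁ q)) = inj₂ (inj₁ (∈-fromCodes⁺ anchored q))
  point p (inj₂ (inj₂ q)) = inj₂ (inj₂ (⊎-map (∈-fromCodes⁺ (double M))
    (⊎-map (∈-fromCodes⁺ (double A)) (∈-fromCodes⁺ (double B)))
    (place (∈-double⁻ others q))))

module _ {M A : List ℕ} (M∈ : M ∈L ovoids) (A∈ : A ∈L completions ovoids M) where

  completion-ovoid : A ∈L ovoids
  completion-ovoid = proj₁ (∈-filterᵇ⁻ (completing ovoids M) ovoids A∈)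

  private
    conditions : any (λ r → mem r M) A ≡ false × memL (rest₂ M A) ovoids ≡ true
    conditions = completing-elim ovoids M A (proj₂ (∈-filterᵇ⁻ (completing ovoids M) ovoids A∈))

  rest-ovoid : rest₂ M A ∈L ovoids
  rest-ovoid = memL-sound ovoids (proj₂ conditions)

  -- The converse of `partition-completions`. Together they identify the completions of M with the
  -- third blocks of the partitions that contain the model and `set M`.
  completion-partition : Partition origin model (set M) (set A) (set (rest₂ M A))
  completion-partition = three-ovoids (isOvoid M∈) (isOvoid completion-ovoid) (isOvoid rest-ovoid)
    (λ p q → true≢false (mem-complete p) (cong not (false-any (λ r → mem r M) A (proj₁ conditions) q)))
    (λ {n} q → remove-∉ (M ++ A) others (subst (n ∈L_) (rest₂-remove M A) q))
    (λ {n} p → subst (λ B → n ∈L M ⊎ n ∈L A ⊎ n ∈L B) (sym (rest₂-remove M A)) (remove-cover M A others p))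

-- The correspondence

if-true : ∀ {b x y} → (if b then x else y) ≡ true → b ≡ true → x ≡ true
if-true {true} e _ = e

if-false : ∀ {b x y} → (if b then x else y) ≡ true → b ≡ false → y ≡ true
if-false {false} e _ = e

uniquePair-sound : ∀ os M cs → uniquePair os M cs ≡ true →
  ∃ λ A → ∃ λ B → cs ≡ A ∷ B ∷ [] × rest₂ M A ≡ B × rest₂ M B ≡ A
uniquePair-sound os M (A ∷ B ∷ []) e = let p , q = ∧-true {rest₂ M A == B} e in A , B , refl , ==-sound p , ==-sound q

severalPairs-sound : ∀ os M cs → severalPairs os M cs ≡ true →
  ∃ λ A → ∃ λ B → A ∈L cs × B ∈L cs × A ≢ B × A ≢ rest₂ M B
severalPairs-sound os M cs e with any-sound (λ A → any (λ B → not (A == B) ∧ not (A == rest₂ M B)) cs) cs e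
... | A , A∈ , e′ with any-sound (λ B → not (A == B) ∧ not (A == rest₂ M B)) cs e′
...   | B , B∈ , e″ = A , B , A∈ , B∈ , differ (proj₁ split) , differ (proj₂ split)
  where
  split = ∧-true {not (A == B)} e″
  differ : ∀ {X} → not (A == X) ≡ true → A ≢ X
  differ h refl = true≢false (==-refl A) h

ovoid-set-injective : ∀ {M A} → M ∈L ovoids → A ∈L ovoids → set M ≡ set A → M ≡ A
ovoid-set-injective M∈ A∈ = set-injective others-bounded others-antipodal (Ovoid.sublist (isOvoid M∈))
  (Ovoid.sublist (isOvoid A∈))

partition-blocks : ∀ {M a C₃ C₄} → M ∈L ovoids → Partition a model (set M) C₃ C₄ →
  a ≡ origin × ∃ λ A → A ∈L completions ovoids M × C₃ ≡ set A × C₄ ≡ set (rest₂ M A)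
partition-blocks {M} {a} {C₃} {C₄} M∈ P = partition-anchor P , representatives C₃
    , subst (λ M → representatives C₃ ∈L completions ovoids M) same (partition-completions P₀)
    , proj₂ (partition-third P₀) , subst (λ M → C₄ ≡ set (rest₂ M (representatives C₃))) same (partition-fourth-set P₀)
  where
  P₀ : Partition origin model (set M) C₃ C₄
  P₀ = subst (λ a → Partition a model (set M) C₃ C₄) (partition-anchor P) P
  same : representatives (set M) ≡ M
  same = ovoid-set-injective (proj₁ (partition-second P₀)) M∈ (sym (proj₂ (partition-second P₀)))

module _ {M : List ℕ} (M∈ : M ∈L ovoids) where

  private
    module M = Ovoid (isOvoid M∈)

  -- The only completions A and B are each other's rest, so every partition has these two as its
  -- remaining blocks, in one of two orders.
  image⇒oneCompletable : memL M images ≡ true → OneCompletable model (set M)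
  image⇒oneCompletable e = model-max , M.max , M.disjoint , (origin , set A , set (rest₂ M A) , completion-partition M∈
    A∈) , unique
    where
    pair = uniquePair-sound ovoids M (completions ovoids M) (if-true (pair-checked M∈) e)
    A = proj₁ pair
    B = proj₁ (proj₂ pair)
    cs≡ : completions ovoids M ≡ A ∷ B ∷ []
    cs≡ = proj₁ (proj₂ (proj₂ pair))
    A∈ : A ∈L completions ovoids M
    A∈ = subst (A ∈L_) (sym cs≡) (here refl)
    Outcome : PSet → PSet → Set
    Outcome C₃ C₄ = (C₃ ≡ set A × C₄ ≡ set B) ⊎ (C₃ ≡ set B × C₄ ≡ set A)
    outcome : ∀ {C₃ C₄} X → X ∈L A ∷ B ∷ [] → C₃ ≡ set X → C₄ ≡ set (rest₂ M X) → Outcome C₃ C₄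
    outcome X (here p)         e f = inj₁ (trans e (cong set p) , trans f
      (cong set (trans (cong (rest₂ M) p) (proj₁ (proj₂ (proj₂ (proj₂ pair)))))))
    outcome X (there (here p)) e f = inj₂ (trans e (cong set p) , trans f
      (cong set (trans (cong (rest₂ M) p) (proj₂ (proj₂ (proj₂ (proj₂ pair)))))))
    outcome-of : ∀ {a C₃ C₄} → Partition a model (set M) C₃ C₄ → Outcome C₃ C₄
    outcome-of P = let _ , X , X∈ , e , f = partition-blocks M∈ P in outcome X (subst (X ∈L_) cs≡ X∈) e f
    compare : ∀ {C₃ C₄ D₃ D₄} → Outcome C₃ C₄ → Outcome D₃ D₄ → SamePair (C₃ , C₄) (D₃ , D₄)
    compare (inj₁ (p , q)) (inj₁ (r , s)) = inj₁ (trans p (sym r) , trans q (sym s))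
    compare (inj₁ (p , q)) (inj₂ (r , s)) = inj₂ (trans p (sym s) , trans q (sym r))
    compare (inj₂ (p , q)) (inj₁ (r , s)) = inj₂ (trans p (sym s) , trans q (sym r))
    compare (inj₂ (p , q)) (inj₂ (r , s)) = inj₁ (trans p (sym r) , trans q (sym s))
    unique : ∀ a C₃ C₄ b D₃ D₄ → Partition a model (set M) C₃ C₄ → Partition b model (set M) D₃ D₄ → a ≡ b × SamePair
      (C₃ , C₄) (D₃ , D₄)
    unique a C₃ C₄ b D₃ D₄ P Q = trans (proj₁ (partition-blocks M∈ P)) (sym (proj₁ (partition-blocks M∈ Q))) , compare
      (outcome-of P) (outcome-of Q)

  -- An ovoid that is not an image has two completions that are neither equal nor partners, and
  -- their partitions contradict uniqueness.
  oneCompletable⇒image : OneCompletable model (set M) → memL M images ≡ true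
  oneCompletable⇒image (_ , _ , _ , _ , unique) = decide (memL M images) refl
    where
    decide : ∀ b → memL M images ≡ b → memL M images ≡ true
    decide true  e = e
    decide false e = ⊥-elim (clash (proj₂ (unique _ _ _ _ _ _ (completion-partition M∈ A∈) (completion-partition M∈ B∈))))
      where
      several = severalPairs-sound ovoids M (completions ovoids M) (if-false (pair-checked M∈) e)
      A = proj₁ several
      B = proj₁ (proj₂ several)
      A∈ : A ∈L completions ovoids M
      A∈ = proj₁ (proj₂ (proj₂ several))
      B∈ : B ∈L completions ovoids M
      B∈ = proj₁ (proj₂ (proj₂ (proj₂ several)))
      clash : SamePair (set A , set (rest₂ M A)) (set B , set (rest₂ M B)) → ⊥
      clash (inj₁ (p , _)) = proj₁ (proj₂ (proj₂ (proj₂ (proj₂ several))))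
        (ovoid-set-injective (completion-ovoid M∈ A∈) (completion-ovoid M∈ B∈) p)
      clash (inj₂ (p , _)) = proj₂ (proj₂ (proj₂ (proj₂ (proj₂ several))))
        (ovoid-set-injective (completion-ovoid M∈ A∈) (rest-ovoid M∈ B∈) p)

oneCompletable-image : ∀ {C′} → OneCompletable model C′ → ∃ λ M → M ∈L images × C′ ≡ set M
oneCompletable-image {C′} o@(_ , _ , _ , (a , C₃ , C₄ , P) , _) = representatives C′
    , memL-sound images (oneCompletable⇒image (proj₁ second) (subst (OneCompletable model) (proj₂ second) o)) , proj₂
      second
  where
  P₀ : Partition origin model C′ C₃ C₄
  P₀ = subst (λ a → Partition a model C′ C₃ C₄) (partition-anchor P) P
  second = partition-second P₀

image-oneCompletable : ∀ {M} → M ∈L images → MaxCap (set M) × OneCompletable model (set M)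
image-oneCompletable M∈ = Ovoid.max (isOvoid (image-ovoid M∈)) , image⇒oneCompletable (image-ovoid M∈) (memL-complete M∈)

allPairs-with : ∀ {A : Set} {P : A → Set} {R : A → A → Set} {xs} → All P xs → AllPairs R xs → AllPairs
  (λ x y → P x × P y × R x y) xs
allPairs-with []         []         = []
allPairs-with (px ∷ pxs) (rx ∷ rxs) = All.map (λ (py , r) → px , py , r) (All.zip (pxs , rx)) ∷ allPairs-with pxs rxs

halves : Entry → PSet × PSet
halves e = set (left e) , set (right e)

entry∈images : ∀ {e} → e ∈L table → proj₂ e ∈L images
entry∈images e∈ = ∈-map⁺ proj₂ e∈

distinct-sound : ∀ e f → distinctEntries e f ≡ true → left e ≢ left f × left e ≢ right f × proj₂ e ≢ proj₂ f
distinct-sound ((σ , σ′) , E) ((τ , τ′) , F) h = differ (proj₁ s₁) , differ (proj₁ s₂) , differ (proj₂ s₂)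
  where
  s₁ = ∧-true {not (σ == τ)} h
  s₂ = ∧-true {not (σ == τ′)} (proj₂ s₁)
  differ : ∀ {X Y} → not (X == Y) ≡ true → X ≢ Y
  differ {X} h refl = true≢false (==-refl X) h

table-pairs : AllPairs (λ e f → e ∈L table × f ∈L table × (left e ≢ left f × left e ≢ right f × proj₂ e ≢ proj₂ f)) table
table-pairs = allPairs-with (All.tabulate λ e∈ → e∈) (AllPairs.map (λ {e} {f} → distinct-sound e f) table-distinct)

half-injective : ∀ {σ τ} → Half σ → Half τ → set σ ≡ set τ → σ ≡ τ
half-injective h k = set-injective ovoid-bounded ovoid-antipodal (Half.sublist h) (Half.sublist k)

-- Used with the image as key: as the images in the table are pairwise distinct, equal completion
-- sets come from the same entry.
key-unique : ∀ {A B : Set} (key : A → B) {xs} → AllPairs (λ x y → key x ≢ key y) xs → ∀ {x y} → x ∈L xs → y ∈L xs → key x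
  ≡ key y → x ≡ y
key-unique key (h ∷ hs) (here refl) (here refl) _ = refl
key-unique key (h ∷ hs) (here refl) (there y∈)  e = contradiction e (All.lookup h y∈)
key-unique key (h ∷ hs) (there x∈)  (here refl) e = contradiction (sym e) (All.lookup h x∈)
key-unique key (h ∷ hs) (there x∈)  (there y∈)  e = key-unique key hs x∈ y∈ e

image-of : ∀ {D D′} (d : EntryOf D D′) → completionSet D D′ ≡ set (proj₂ (proj₁ d))
image-of (e , e∈ , inj₁ (p , q)) = trans (cong₂ completionSet p q) (entry-image {e} e∈)
image-of (e , e∈ , inj₂ (p , q)) = trans (cong₂ completionSet p q)
  (trans (completionSet-comm (set (right e)) (set (left e))) (entry-image {e} e∈))

decompositions-counted : ExactlyNUnordered 36 (Decomposition model)
decompositions-counted = map halves table , trans (length-map halves table) table-length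
  , AllPairs-map⁺ (AllPairs.map (λ (e∈ , f∈ , l≢ , r≢ , _) → different e∈ f∈ l≢ r≢) table-pairs)
  , All-map⁺ (All.tabulate λ e∈ → Splitting.decomposition (splitting e∈))
  , λ D D′ d → listed (entry-of d)
  where
  different : ∀ {e f} → e ∈L table → f ∈L table → left e ≢ left f → left e ≢ right f → ¬ SamePair (halves e) (halves f)
  different e∈ f∈ l≢ r≢ (inj₁ (p , _)) = l≢ (half-injective (Splitting.left-half (splitting e∈))
    (Splitting.left-half (splitting f∈)) p)
  different e∈ f∈ l≢ r≢ (inj₂ (p , _)) = r≢ (half-injective (Splitting.left-half (splitting e∈))
    (Splitting.right-half (splitting f∈)) p)
  listed : ∀ {D D′} → EntryOf D D′ → ((D , D′) ∈L map halves table) ⊎ ((D′ , D) ∈L map halves table)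
  listed (e , e∈ , inj₁ (refl , refl)) = inj₁ (∈-map⁺ halves e∈)
  listed (e , e∈ , inj₂ (refl , refl)) = inj₂ (∈-map⁺ halves e∈)

completables-counted : ExactlyN 36 (λ C′ → MaxCap C′ × OneCompletable model C′)
completables-counted = map image-set table , trans (length-map image-set table) table-length
  , AllPairs-map⁺ (AllPairs.map (λ (e∈ , f∈ , _ , _ , E≢F) p →
      E≢F (ovoid-set-injective (image-ovoid (entry∈images e∈)) (image-ovoid (entry∈images f∈)) p)) table-pairs)
  , All-map⁺ (All.tabulate λ e∈ → image-oneCompletable (entry∈images e∈))
  , λ S (_ , o) → listed (oneCompletable-image o)
  where
  image-set : Entry → PSet
  image-set e = set (proj₂ e)
  listed : ∀ {S} → (∃ λ M → M ∈L images × S ≡ set M) → S ∈L map image-set table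
  listed (M , M∈ , refl) with ∈-map⁻ proj₂ M∈
  ... | e , e∈ , refl = ∈-map⁺ image-set e∈

model-correspondence : Correspondence model
model-correspondence = decompositions-counted , completables-counted
  , (λ D D′ d → completable (entry-of d))
  , completionSet-comm
  , (λ D₁ D₁′ D₂ D₂′ d₁ d₂ e → injective (entry-of d₁) (entry-of d₂) e)
  , λ C′ _ o → surjective (oneCompletable-image o)
  where
  completable : ∀ {D D′} → EntryOf D D′ → MaxCap (completionSet D D′) × OneCompletable model (completionSet D D′)
  completable d = subst (λ S → MaxCap S × OneCompletable model S) (sym (image-of d))
    (image-oneCompletable (entry∈images (proj₁ (proj₂ d))))
  same-entry : ∀ {D₁ D₁′ D₂ D₂′} (d₁ : EntryOf D₁ D₁′) (d₂ : EntryOf D₂ D₂′) → proj₁ d₁ ≡ proj₁ d₂ → SamePair (D₁ , D₁′)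
    (D₂ , D₂′)
  same-entry (e , _ , inj₁ (refl , refl)) (.e , _ , inj₁ (refl , refl)) refl = inj₁ (refl , refl)
  same-entry (e , _ , inj₁ (refl , refl)) (.e , _ , inj₂ (refl , refl)) refl = inj₂ (refl , refl)
  same-entry (e , _ , inj₂ (refl , refl)) (.e , _ , inj₁ (refl , refl)) refl = inj₂ (refl , refl)
  same-entry (e , _ , inj₂ (refl , refl)) (.e , _ , inj₂ (refl , refl)) refl = inj₁ (refl , refl)
  injective : ∀ {D₁ D₁′ D₂ D₂′} → EntryOf D₁ D₁′ → EntryOf D₂ D₂′ → completionSet D₁ D₁′ ≡ completionSet D₂ D₂′ → SamePair
    (D₁ , D₁′) (D₂ , D₂′)
  injective d₁@(e , e∈ , _) d₂@(f , f∈ , _) h = same-entry d₁ d₂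
    (key-unique proj₂ (AllPairs.map (λ (_ , _ , _ , _ , E≢F) → E≢F) table-pairs) e∈ f∈
    (ovoid-set-injective (image-ovoid (entry∈images e∈)) (image-ovoid (entry∈images f∈))
      (trans (sym (image-of d₁)) (trans h (image-of d₂)))))
  surjective : ∀ {C′} → (∃ λ M → M ∈L images × C′ ≡ set M) → ∃ λ D → ∃ λ D′ → Decomposition model D D′ × completionSet D
    D′ ≡ C′
  surjective (M , M∈ , p) = let e , e∈ , q = ∈-map⁻ proj₂ M∈ in
    set (left e) , set (right e) , Splitting.decomposition (splitting e∈) , trans (entry-image {e} e∈)
      (trans (cong set (sym q)) (sym p))

correspondence : ∀ C → MaxCap C → Correspondence C
correspondence C max = subst Correspondence (trans (cong (act (inverse g)) (sym (proj₂ equivalence))) (act-inverseʳ g C))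
    (Correspondence-act (inverse g) model-correspondence)
  where
  equivalence : Equivalent C model
  equivalence = classification (proj₁ max) (≤-reflexive (sym (maxCap-size max)))
  g = proj₁ equivalence

theorem4p1 : (C : PSet) → MaxCap C →
    ExactlyNUnordered 36 (Decomposition C)
    × ExactlyN 36 (λ C' → MaxCap C' × OneCompletable C C')
    × (∀ D D' → Decomposition C D D' →
    MaxCap (completionSet D D') × OneCompletable C (completionSet D D'))
    × (∀ D D' → completionSet D D' ≡ completionSet D' D)
    × (∀ D₁ D₁' D₂ D₂' → Decomposition C D₁ D₁' → Decomposition C D₂ D₂' →
    completionSet D₁ D₁' ≡ completionSet D₂ D₂' → SamePair (D₁ , D₁') (D₂ , D₂'))
    × (∀ C' → MaxCap C' → OneCompletable C C' →
    ∃ λ D → ∃ λ D' → Decomposition C D D' × completionSet D D' ≡ C')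
theorem4p1 = correspondence
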